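{- \textsc{ESSD} is fixed-parameter tractable when parameterized by the number $n$ of clients.
   Context: \textsc{ESSD}: given $n$ clients, $m$ days, integer processing times $p_{i,j}$ for the job of client $i$ on day $j$, a common integer deadline $d_j$ for all jobs of day $j$, and an integer $k\in\{0,\dots,m\}$, decide whether there exist schedules $\sigma_1,\dots,\sigma_m$ (each a permutation of $\{1,\dots,n\}$ giving the non-preemptive processing order on a single machine on day $j$) such that every client $i$ satisfies $|\{j: C_{i,j}\le d_j\}|\ge k$, where $C_{i,j}=\sum_{i_0:\sigma_j(i_0)\le\sigma_j(i)} p_{i_0,j}$. Fixed-parameter tractable means solvable in $f(n)\cdot|x|^{O(1)}$ time for some computable $f$, where $|x|$ is the input size. -}

module Defs where

open import Data.Bool using (Bool; true; false)
open import Data.Nat using (ℕ; zero; suc; _+_; _*_; _^_; _≤_)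
import Data.Nat as ℕ
open import Data.Nat.Binary.Base using (ℕᵇ; 2[1+_]; 1+[2_]) renaming (zero to zeroᵇ; fromℕ to toℕᵇ)
open import Data.Fin using (Fin; toℕ)
import Data.Fin as F
open import Data.Fin.Permutation using (Permutation′; _⟨$⟩ʳ_)
open import Data.List using (List; []; _∷_; _++_; tabulate; concat; concatMap; length; filter)
open import Data.Nat.ListAction using (sum)
open import Data.Product using (Σ; _×_; _,_)
open import Relation.Nullary using (yes; no)
open import Function.Bundles using (_⇔_)
open import Relation.Binary.PropositionalEquality using (_≡_)

record Instance : Set where
  field
    n : ℕ                     -- number of clients
    m : ℕ                     -- number of days
    p : Fin n → Fin m → ℕ     -- p i j : processing time of client i on day j
    d : Fin m → ℕ             -- common deadline of day j
    k : Fin (suc m)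

open Instance public

-- A schedule for day j: σ j maps each client to its position (0-based).
Schedules : Instance → Set
Schedules I = Fin (m I) → Permutation′ (n I)

completion : (I : Instance) → Schedules I → Fin (n I) → Fin (m I) → ℕ
completion I σ i j = sum (tabulate λ i₀ → contrib i₀)
  where
  contrib : Fin (n I) → ℕ
  contrib i₀ with (σ j ⟨$⟩ʳ i₀) F.≤? (σ j ⟨$⟩ʳ i)
  ... | yes _ = p I i₀ j
  ... | no  _ = 0

onTimeDays : (I : Instance) → Schedules I → Fin (n I) → ℕ
onTimeDays I σ i =
  length (filter (λ j → completion I σ i j ℕ.≤? d I j) (tabulate (λ j → j)))

ESSD : Instance → Set
ESSD I = Σ (Schedules I) λ σ → (i : Fin (n I)) → toℕ (k I) ≤ onTimeDays I σ i

bitsᵇ : ℕᵇ → List Bool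
bitsᵇ zeroᵇ = []
bitsᵇ 2[1+ x ] = true ∷ bitsᵇ x
bitsᵇ 1+[2 x ] = false ∷ bitsᵇ x

-- self-delimiting binary code of a natural number:
-- each bit doubled, terminated by the pair 0 1
encℕ : ℕ → List Bool
encℕ x = concatMap (λ b → b ∷ b ∷ []) (bitsᵇ (toℕᵇ x)) ++ (false ∷ true ∷ [])

encode : Instance → List Bool
encode I =
  encℕ (n I) ++ encℕ (m I) ++ encℕ (toℕ (k I))
  ++ concat (tabulate (λ j → encℕ (d I j)))
  ++ concat (tabulate (λ i → concat (tabulate (λ j → encℕ (p I i j)))))

-- Machine model: deterministic single-tape Turing machines over the
-- tape alphabet {blank, 0, 1} plus finitely many extra work symbols.

-- Symbol Γ : 0 = blank, 1 = bit 0, 2 = bit 1, ≥ 3 extra symbols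
Symbol : ℕ → Set
Symbol g = Fin (3 + g)

blank : ∀ {g} → Symbol g
blank = F.zero

bitSym : ∀ {g} → Bool → Symbol g
bitSym false = F.suc F.zero
bitSym true  = F.suc (F.suc F.zero)

data Move : Set where
  L R : Move

data Action (q g : ℕ) : Set where
  halt : Bool → Action q g
  go   : Fin q → Symbol g → Move → Action q g

record TM : Set where
  field
    states : ℕ
    extra  : ℕ
    start  : Fin states
    δ      : Fin states → Symbol extra → Action states extra

open TM public

-- configuration: state, reversed tape left of head, symbol under head, tape right
record Config (M : TM) : Set where
  constructor conf
  field
    state : Fin (states M)
    left  : List (Symbol (extra M))
    here  : Symbol (extra M)
    right : List (Symbol (extra M))

data Result : Set where
  halted  : Bool → Result
  running : Result

moveHead : ∀ {M} → Fin (states M) → List (Symbol (extra M)) → Symbol (extra M)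
         → List (Symbol (extra M)) → Move → Config M
moveHead q []      s r L = conf q [] blank (s ∷ r)
moveHead q (a ∷ l) s r L = conf q l a (s ∷ r)
moveHead q l s []      R = conf q (s ∷ l) blank []
moveHead q l s (a ∷ r) R = conf q (s ∷ l) a r

-- run for at most t steps (each executed transition, including halting, costs one step)
exec : (M : TM) → ℕ → Config M → Result
exec M zero    c = running
exec M (suc t) (conf q l s r) with δ M q s
... | halt b      = halted b
... | go q′ s′ mv = exec M t (moveHead {M} q′ l s′ r mv)

initial : (M : TM) → List Bool → Config M
initial M []      = conf (start M) [] blank []
initial M (b ∷ x) = conf (start M) [] (bitSym b) (Data.List.map bitSym x)

HaltsWithin : TM → List Bool → ℕ → Bool → Set
HaltsWithin M x t b = exec M t (initial M x) ≡ halted b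

ESSD-FPT-by-n : Set
ESSD-FPT-by-n =
  Σ (ℕ → ℕ) λ f → Σ ℕ λ c → Σ TM λ M →
    (I : Instance) → Σ Bool λ b →
      HaltsWithin M (encode I) (f (n I) * length (encode I) ^ c) b
      × (b ≡ true ⇔ ESSD I)

{-# OPTIONS --safe #-}

-- A set of clients can be on time on a day iff its processing times sum to at most the
-- deadline, so the task is to choose such a set for every day in which each client
-- occurs at least k times.  Local search solves it: while some client lacks occurrences, exchange
-- the sets of a few days so that the total deficit drops.  Few days suffice.  If a
-- solution exists, consider for every day the vector (new set) − (old set) ∈ {−1,0,1}ⁿ;
-- pairing off sums of opposite sign, one coordinate after the other, distributes the days
-- over blocks whose size is bounded in terms of n and whose sums agree in sign in each
-- coordinate, and exchanging a block that gains in a deficient coordinate is an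
-- improvement.  An exchange is a short sequence of moves (old set, new set), which can be
-- applied greedily in a single pass over the days, so it suffices to try the boundedly
-- many short sequences.
--
-- The algorithm is a program of a first-order language of folds over lists.  Values are
-- prefix-coded on the stacks of a four-stack machine, which a Turing machine simulates
-- on four tracks.  Every fold has a number of rounds bounded by the size of its list, so
-- the running time is polynomial in the size of the accumulated values, and each fold
-- of the search adds only a bounded amount to its accumulator per round.
module Submission where

open import Defs
open import Data.Bool using (Bool; true; false; if_then_else_; _∧_; not)
open import Data.Bool.Properties using (∧-zeroʳ)
open import Data.Empty using (⊥; ⊥-elim)
open import Data.Fin using (Fin; zero; suc; toℕ; splitAt; _↑ˡ_; _↑ʳ_; finToFun; funToFin)
import Data.Fin.Properties as Fin
import Data.Nat as ℕ
open import Data.List using (List; []; _∷_; _++_; length; map; foldr; reverse; _ʳ++_; concat; concatMap; tabulate; zipWith; filter)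
open import Data.List.Properties using (∷-injective; concat-++; reverse-++; map-tabulate; tabulate-cong; length-tabulate; concatMap-++; map-++; reverse-map; foldr-++; unfold-reverse; length-reverse; reverse-involutive; ++-assoc; ++-identityʳ; length-++; length-ʳ++; ʳ++-defn)
open import Data.List.Relation.Unary.All as All using (All; []; _∷_)
import Data.List.Relation.Unary.All.Properties as AllP
open import Data.List.Relation.Binary.Permutation.Propositional as ↭ using (_↭_)
import Data.List.Relation.Binary.Permutation.Propositional.Properties as ↭P
open import Data.Maybe using (Maybe; just; nothing)
open import Data.Nat using (ℕ; zero; suc; _+_; _*_; _∸_; _^_; _≤_; _<_; z≤n; s≤s)
open import Data.Nat.Binary.Base using (2[1+_]; 1+[2_]) renaming (fromℕ to toℕᵇ)
import Data.Nat.Binary as Binary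
import Data.Nat.Binary.Properties as Binary
open import Data.Nat.Properties
open import Data.Nat.Tactic.RingSolver using (solve-∀)
open import Data.Product using (Σ; _×_; _,_; proj₁; proj₂)
open import Data.Sum using (_⊎_; inj₁; inj₂)
open import Data.Unit using (⊤; tt)
open import Data.Vec using (Vec; []; _∷_; lookup; _[_]≔_)
open import Data.Vec.Properties using (lookup∘update; lookup∘update′)
open import Function using (_∘_; id)
open import Function.Bundles using (_⇔_; mk⇔; Equivalence)
open import Relation.Binary.PropositionalEquality using (module ≡-Reasoning; _≡_; _≢_; refl; sym; trans; cong; cong₂; subst; subst₂)
open import Relation.Binary.Definitions using (Tri; tri<; tri≈; tri>)
open import Relation.Nullary using (¬_; Dec; yes; no)
open import Relation.Nullary.Decidable using (⌊_⌋)

-- Programs on four stacks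

-- A move names two sets but no day. The counts of the clients, and with them the deficit, depend
-- only on which moves are executed, so a block of exchanges that is found with the help of a
-- solution may be replayed on whatever days happen to permit its moves; this is why the moves can
-- be enumerated from n alone and the solution need not be known. Each round lowers a positive
-- deficit by at least one if a solution exists, and the deficit is at most n·k, so rounds can be
-- counted in unary. Processing times and deadlines can be exponential in the length of the input;
-- they stay in binary and are compared column by column. The numbers m and k are at most the length
-- of the code, but n is not: without days it occurs in the code only in binary. Therefore n itself,
-- just like the block bound and the list of move sequences, is charged to the parameter function f.
-- No closed form of f is derived: the sizes that arise for n are put into it as they are. The
-- exponent has to be independent of n, so time bounds are syntactic polynomials read off from the
-- program, while the instance enters only through a bound on the sizes of accumulated values.

Stk : Set
Stk = Fin 4

pattern mainˢ = zero
pattern auxˢ  = suc zero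
pattern tmpˢ  = suc (suc zero)
pattern cntˢ  = suc (suc (suc zero))

Stacks : Set
Stacks = Vec (List Bool) 4

height : ∀ {k} → Vec (List Bool) k → ℕ
height []       = 0
height (x ∷ st) = length x + height st

-- branch s pops s and continues with the command for "was empty", false, true.
-- while s z c₀ c₁ pops s repeatedly: it exits on the empty stack, runs c₁ after
-- popping true, and after popping false runs c₀ if z is set and exits otherwise.
data Cmd : Set where
  nop    : Cmd
  push   : Stk → Bool → Cmd
  _⨾_    : Cmd → Cmd → Cmd
  branch : Stk → Cmd → Cmd → Cmd → Cmd
  while  : Stk → Bool → Cmd → Cmd → Cmd

infixr 5 _⨾_

pushed : ∀ {k} → Fin k → Bool → Vec (List Bool) k → Vec (List Bool) k
pushed s b st = st [ s ]≔ (b ∷ lookup st s)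

-- Run c st t st′ : started on st, c ends on st′ within t operations.
data Run : Cmd → Stacks → ℕ → Stacks → Set where
  nop  : ∀ {st} → Run nop st 0 st
  push : ∀ {st} s b → Run (push s b) st 1 (pushed s b st)
  _⨾_  : ∀ {c c′ st st′ st″ t t′} → Run c st t st′ → Run c′ st′ t′ st″ →
         Run (c ⨾ c′) st (t + t′) st″
  branch-∅ : ∀ {s c c₀ c₁ st st′ t} → lookup st s ≡ [] →
             Run c st t st′ → Run (branch s c c₀ c₁) st (1 + t) st′
  branch-0 : ∀ {s c c₀ c₁ st st′ t l} → lookup st s ≡ false ∷ l →
             Run c₀ (st [ s ]≔ l) t st′ → Run (branch s c c₀ c₁) st (1 + t) st′
  branch-1 : ∀ {s c c₀ c₁ st st′ t l} → lookup st s ≡ true ∷ l →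
             Run c₁ (st [ s ]≔ l) t st′ → Run (branch s c c₀ c₁) st (1 + t) st′
  while-∅ : ∀ {s z c₀ c₁ st} → lookup st s ≡ [] → Run (while s z c₀ c₁) st 1 st
  while-end : ∀ {s c₀ c₁ st l} → lookup st s ≡ false ∷ l →
              Run (while s false c₀ c₁) st 1 (st [ s ]≔ l)
  while-0 : ∀ {s c₀ c₁ st st′ st″ t t′ l} → lookup st s ≡ false ∷ l →
            Run c₀ (st [ s ]≔ l) t st′ → Run (while s true c₀ c₁) st′ t′ st″ →
            Run (while s true c₀ c₁) st (1 + t + t′) st″
  while-1 : ∀ {s z c₀ c₁ st st′ st″ t t′ l} → lookup st s ≡ true ∷ l →
            Run c₁ (st [ s ]≔ l) t st′ → Run (while s z c₀ c₁) st′ t′ st″ →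
            Run (while s z c₀ c₁) st (1 + t + t′) st″
  weaken : ∀ {c st st′ t t′} → Run c st t st′ → t ≤ t′ → Run c st t′ st′

height-pushed : ∀ {k} (s : Fin k) b st → height (pushed s b st) ≡ suc (height st)
height-pushed zero    b (x ∷ st) = refl
height-pushed (suc s) b (x ∷ st) =
  trans (cong (length x +_) (height-pushed s b st)) (+-suc (length x) _)

height-popped : ∀ {k} (s : Fin k) st {b l} → lookup st s ≡ b ∷ l → suc (height (st [ s ]≔ l)) ≡ height st
height-popped zero    (x ∷ st) refl = refl
height-popped (suc s) (x ∷ st) eq   =
  trans (sym (+-suc (length x) _)) (cong (length x +_) (height-popped s st eq))

height-popped-≤ : ∀ (s : Stk) st {b l} → lookup st s ≡ b ∷ l → height (st [ s ]≔ l) ≤ height st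
height-popped-≤ s st eq = ≤-trans (n≤1+n _) (≤-reflexive (height-popped s st eq))

loop-height : ∀ (s : Stk) t t′ st {b l h h′} → lookup st s ≡ b ∷ l →
              h ≤ t + height (st [ s ]≔ l) → h′ ≤ t′ + h → h′ ≤ suc (t + t′) + height st
loop-height s t t′ st {l = l} {h} {h′} eq le le′ = begin
  h′                                 ≤⟨ le′ ⟩
  t′ + h                             ≤⟨ +-monoʳ-≤ t′ le ⟩
  t′ + (t + height (st [ s ]≔ l))    ≤⟨ +-monoʳ-≤ t′ (+-monoʳ-≤ t (height-popped-≤ s st eq)) ⟩
  t′ + (t + height st)               ≡⟨ +-assoc t′ t _ ⟨
  t′ + t + height st                 ≡⟨ cong (_+ height st) (+-comm t′ t) ⟩
  t + t′ + height st                 ≤⟨ n≤1+n _ ⟩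
  suc (t + t′) + height st           ∎
  where open ≤-Reasoning

-- An operation adds at most one bit. Bounding the later heights by the elapsed time is what turns
-- an operation count into a step count of the Turing machine.
run-height : ∀ {c st t st′} → Run c st t st′ → height st′ ≤ t + height st
run-height nop = ≤-refl
run-height (push {st} s b) = ≤-reflexive (height-pushed s b st)
run-height {st = st} {st′ = st″} (_⨾_ {st′ = st′} {t = t} {t′ = t′} r r′) = begin
  height st″           ≤⟨ run-height r′ ⟩
  t′ + height st′      ≤⟨ +-monoʳ-≤ t′ (run-height r) ⟩
  t′ + (t + height st) ≡⟨ +-assoc t′ t _ ⟨
  t′ + t + height st   ≡⟨ cong (_+ height st) (+-comm t′ t) ⟩
  t + t′ + height st   ∎
  where open ≤-Reasoning
run-height (branch-∅ eq r) = ≤-trans (run-height r) (n≤1+n _)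
run-height (branch-0 {s} {st = st} {t = t} eq r) =
  ≤-trans (run-height r) (≤-trans (+-monoʳ-≤ t (height-popped-≤ s st eq)) (n≤1+n _))
run-height (branch-1 {s} {st = st} {t = t} eq r) =
  ≤-trans (run-height r) (≤-trans (+-monoʳ-≤ t (height-popped-≤ s st eq)) (n≤1+n _))
run-height (while-∅ eq) = n≤1+n _
run-height (while-end {s} {st = st} eq) = ≤-trans (height-popped-≤ s st eq) (n≤1+n _)
run-height (while-0 {s} {st = st} {st′} {t = t} {t′} eq r r′) =
  loop-height s t t′ st {h = height st′} eq (run-height r) (run-height r′)
run-height (while-1 {s} {st = st} {st′} {t = t} {t′} eq r r′) =
  loop-height s t t′ st {h = height st′} eq (run-height r) (run-height r′)
run-height (weaken {st = st} r le) = ≤-trans (run-height r) (+-monoˡ-≤ (height st) le)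

-- Simulation by a Turing machine

record Finite (A : Set) : Set where
  field
    card    : ℕ
    enc     : A → Fin card
    dec     : Fin card → A
    dec-enc : ∀ a → dec (enc a) ≡ a

open Finite

finite-Fin : ∀ k → Finite (Fin k)
finite-Fin k = record { card = k ; enc = id ; dec = id ; dec-enc = λ _ → refl }

finite-⊎ : ∀ {A B} → Finite A → Finite B → Finite (A ⊎ B)
finite-⊎ {A} {B} FA FB = record
  { card    = card FA + card FB
  ; enc     = enc⊎
  ; dec     = λ i → Data.Sum.map (dec FA) (dec FB) (splitAt (card FA) i)
  ; dec-enc = dec-enc⊎
  }
  where
  enc⊎ : A ⊎ B → Fin (card FA + card FB)
  enc⊎ (inj₁ a) = enc FA a ↑ˡ card FB
  enc⊎ (inj₂ b) = card FA ↑ʳ enc FB b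
  dec-enc⊎ : ∀ x → Data.Sum.map (dec FA) (dec FB) (splitAt (card FA) (enc⊎ x)) ≡ x
  dec-enc⊎ (inj₁ a) rewrite Fin.splitAt-↑ˡ (card FA) (enc FA a) (card FB) = cong inj₁ (dec-enc FA a)
  dec-enc⊎ (inj₂ b) rewrite Fin.splitAt-↑ʳ (card FA) (card FB) (enc FB b) = cong inj₂ (dec-enc FB b)

-- The states of the machine for a command; popping seeks the top (0), reads it (1)
-- and returns to the first cell remembering the symbol (2 and 3), pushing seeks (0)
-- and returns (1).
St : Cmd → Set
St nop               = Fin 0
St (push s b)        = Fin 2
St (c ⨾ c′)          = St c ⊎ St c′
St (branch s c c₀ c₁) = Fin 4 ⊎ (St c ⊎ (St c₀ ⊎ St c₁))
St (while s z c₀ c₁)  = Fin 4 ⊎ (St c₀ ⊎ St c₁)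

finite-St : ∀ c → Finite (St c)
finite-St nop        = finite-Fin 0
finite-St (push s b) = finite-Fin 2
finite-St (c ⨾ c′)   = finite-⊎ (finite-St c) (finite-St c′)
finite-St (branch s c c₀ c₁) =
  finite-⊎ (finite-Fin 4) (finite-⊎ (finite-St c) (finite-⊎ (finite-St c₀) (finite-St c₁)))
finite-St (while s z c₀ c₁) = finite-⊎ (finite-Fin 4) (finite-⊎ (finite-St c₀) (finite-St c₁))

-- Every tape cell holds at most one bit of each of the four stacks.
record Tracks (g : ℕ) : Set where
  field
    get       : Symbol g → Stk → Maybe Bool
    set       : Symbol g → Stk → Maybe Bool → Symbol g
    get-set   : ∀ c s x → get (set c s x) s ≡ x
    get-set-≢ : ∀ c s s′ x → s ≢ s′ → get (set c s x) s′ ≡ get c s′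
    get-blank : ∀ s → get blank s ≡ nothing

vacant : Maybe Bool → Bool
vacant nothing  = true
vacant (just _) = false

module Compile {g : ℕ} (tracks : Tracks g) where
  open Tracks tracks

  Sym : Set
  Sym = Symbol g

  empty? : Sym → Bool
  empty? c = vacant (get c mainˢ) ∧ vacant (get c auxˢ) ∧ vacant (get c tmpˢ) ∧ vacant (get c cntˢ)

  empty?-blank : empty? blank ≡ true
  empty?-blank rewrite get-blank mainˢ | get-blank auxˢ | get-blank tmpˢ | get-blank cntˢ = refl

  empty?-just : ∀ c s {b} → get c s ≡ just b → empty? c ≡ false
  empty?-just c mainˢ eq rewrite eq = refl
  empty?-just c auxˢ  eq rewrite eq = ∧-zeroʳ _
  empty?-just c tmpˢ  eq rewrite eq | ∧-zeroʳ (vacant (get c auxˢ)) = ∧-zeroʳ _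
  empty?-just c cntˢ  eq rewrite eq | ∧-zeroʳ (vacant (get c tmpˢ)) | ∧-zeroʳ (vacant (get c auxˢ)) = ∧-zeroʳ _

  module _ {Q : Set} where

    Step : Set
    Step = Q × Sym × Move

    seekδ : Maybe Bool → Step → Step → Step
    seekδ nothing  a b = a
    seekδ (just _) a b = b

    -- On the way back the head passes only cells below the top of the stack it has sought, and each
    -- of them holds a bit of that stack. Hence the first cell that is empty on all tracks is the
    -- blank one before the first cell of the stacks.
    returnδ : (self exit : Q) → Sym → Step
    returnδ self exit c = if empty? c then (exit , c , R) else (self , c , L)

    pushδ : (Fin 2 → Q) → Q → Stk → Bool → Fin 2 → Sym → Step
    pushδ inj exit s b zero       c = seekδ (get c s) (inj (suc zero) , set c s (just b) , L) (inj zero , c , R)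
    pushδ inj exit s b (suc zero) c = returnδ (inj (suc zero)) exit c

    readδ : (Fin 4 → Q) → Q → Stk → Sym → Maybe Bool → Step
    readδ inj e∅ s c nothing      = e∅ , c , R
    readδ inj e∅ s c (just false) = inj (suc (suc zero)) , set c s nothing , L
    readδ inj e∅ s c (just true)  = inj (suc (suc (suc zero))) , set c s nothing , L

    popδ : (Fin 4 → Q) → (e∅ e₀ e₁ : Q) → Stk → Fin 4 → Sym → Step
    popδ inj e∅ e₀ e₁ s zero                   c = seekδ (get c s) (inj (suc zero) , c , L) (inj zero , c , R)
    popδ inj e∅ e₀ e₁ s (suc zero)             c = readδ inj e∅ s c (get c s)
    popδ inj e∅ e₀ e₁ s (suc (suc zero))       c = returnδ (inj (suc (suc zero))) e₀ c
    popδ inj e∅ e₀ e₁ s (suc (suc (suc zero))) c = returnδ (inj (suc (suc (suc zero)))) e₁ c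

    -- All commands share one state set `Q`, into which `inj` embeds their own states. `nop` has
    -- none, so control passes to `exit` without a step.
    entry : (c : Cmd) → (St c → Q) → Q → Q
    entry nop                inj exit = exit
    entry (push s b)         inj exit = inj zero
    entry (c ⨾ c′)           inj exit = entry c (inj ∘ inj₁) (entry c′ (inj ∘ inj₂) exit)
    entry (branch s c c₀ c₁) inj exit = inj (inj₁ zero)
    entry (while s z c₀ c₁)  inj exit = inj (inj₁ zero)

    stepδ : (c : Cmd) → (St c → Q) → Q → St c → Sym → Step
    stepδ (push s b) inj exit q        x = pushδ inj exit s b q x
    stepδ (c ⨾ c′)   inj exit (inj₁ q) x = stepδ c (inj ∘ inj₁) (entry c′ (inj ∘ inj₂) exit) q x
    stepδ (c ⨾ c′)   inj exit (inj₂ q) x = stepδ c′ (inj ∘ inj₂) exit q x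
    stepδ (branch s c c₀ c₁) inj exit (inj₁ q) x =
      popδ (inj ∘ inj₁) (entry c (inj ∘ inj₂ ∘ inj₁) exit)
        (entry c₀ (inj ∘ inj₂ ∘ inj₂ ∘ inj₁) exit) (entry c₁ (inj ∘ inj₂ ∘ inj₂ ∘ inj₂) exit) s q x
    stepδ (branch s c c₀ c₁) inj exit (inj₂ (inj₁ q))        x = stepδ c (inj ∘ inj₂ ∘ inj₁) exit q x
    stepδ (branch s c c₀ c₁) inj exit (inj₂ (inj₂ (inj₁ q))) x = stepδ c₀ (inj ∘ inj₂ ∘ inj₂ ∘ inj₁) exit q x
    stepδ (branch s c c₀ c₁) inj exit (inj₂ (inj₂ (inj₂ q))) x = stepδ c₁ (inj ∘ inj₂ ∘ inj₂ ∘ inj₂) exit q x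
    stepδ (while s z c₀ c₁) inj exit (inj₁ q) x =
      popδ (inj ∘ inj₁) exit
        (if z then entry c₀ (inj ∘ inj₂ ∘ inj₁) (inj (inj₁ zero)) else exit)
        (entry c₁ (inj ∘ inj₂ ∘ inj₂) (inj (inj₁ zero))) s q x
    stepδ (while s z c₀ c₁) inj exit (inj₂ (inj₁ q)) x = stepδ c₀ (inj ∘ inj₂ ∘ inj₁) (inj (inj₁ zero)) q x
    stepδ (while s z c₀ c₁) inj exit (inj₂ (inj₂ q)) x = stepδ c₁ (inj ∘ inj₂ ∘ inj₂) (inj (inj₁ zero)) q x

  -- The content of stack s, bottom first, is written on track s from the first cell on.
  data Content (s : Stk) : List Bool → List Sym → Set where
    []  : ∀ {r} → All (λ c → get c s ≡ nothing) r → Content s [] r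
    _∷_ : ∀ {c b bs r} → get c s ≡ just b → Content s bs r → Content s (b ∷ bs) (c ∷ r)

  record Tape (st : Stacks) (r : List Sym) : Set where
    field on : ∀ s → Content s (reverse (lookup st s)) r

  open Tape public

  write : Stk → Bool → List Sym → List Sym
  write s b []      = set blank s (just b) ∷ []
  write s b (c ∷ r) with get c s
  ... | nothing = set c s (just b) ∷ r
  ... | just _  = c ∷ write s b r

  -- The blank added at the end is the one under the head when the top was found.
  erase : Stk → Sym → List Sym → List Sym
  erase s a []      = set a s nothing ∷ blank ∷ []
  erase s a (c ∷ r) with get c s
  ... | nothing = set a s nothing ∷ c ∷ r
  ... | just _  = a ∷ erase s c r

  write-same : ∀ s b {bs r} → Content s bs r → Content s (bs ++ b ∷ []) (write s b r)
  write-same s b {r = []}    ([] _)        = get-set blank s (just b) ∷ [] []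
  write-same s b {r = c ∷ r} ([] (eq ∷ r∅)) rewrite eq = get-set c s (just b) ∷ [] r∅
  write-same s b {r = c ∷ r} (eq ∷ con) with get c s in eq′
  ... | just _ = trans eq′ eq ∷ write-same s b con

  write-∅ : ∀ s b s′ → s ≢ s′ → ∀ {r} → All (λ c → get c s′ ≡ nothing) r → All (λ c → get c s′ ≡ nothing) (write s b r)
  write-∅ s b s′ ne []                 = trans (get-set-≢ blank s s′ _ ne) (get-blank s′) ∷ []
  write-∅ s b s′ ne (_∷_ {c} eq r∅) with get c s
  ... | nothing = trans (get-set-≢ c s s′ _ ne) eq ∷ r∅
  ... | just _  = eq ∷ write-∅ s b s′ ne r∅

  write-other : ∀ s b s′ → s ≢ s′ → ∀ {bs r} → Content s′ bs r → Content s′ bs (write s b r)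
  write-other s b s′ ne ([] r∅) = [] (write-∅ s b s′ ne r∅)
  write-other s b s′ ne (_∷_ {c} eq con) with get c s
  ... | nothing = trans (get-set-≢ c s s′ _ ne) eq ∷ con
  ... | just _  = eq ∷ write-other s b s′ ne con

  erase-same : ∀ s b bs a {r} → Content s (bs ++ b ∷ []) (a ∷ r) → Content s bs (erase s a r)
  erase-same s b []       a {[]}    (eq ∷ con)            = [] (get-set a s nothing ∷ get-blank s ∷ [])
  erase-same s b []       a {c ∷ r} (eq ∷ [] (eq′ ∷ r∅)) rewrite eq′ = [] (get-set a s nothing ∷ eq′ ∷ r∅)
  erase-same s b (x ∷ []) a {c ∷ r} (eq ∷ con@(eq′ ∷ _)) rewrite eq′ = eq ∷ erase-same s b [] c con
  erase-same s b (x ∷ bs@(y ∷ _)) a {c ∷ r} (eq ∷ con@(eq′ ∷ _)) rewrite eq′ = eq ∷ erase-same s b bs c con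

  erase-∅ : ∀ s s′ → s ≢ s′ → ∀ a r → All (λ c → get c s′ ≡ nothing) (a ∷ r) → All (λ c → get c s′ ≡ nothing) (erase s a r)
  erase-∅ s s′ ne a [] (eq ∷ _) = trans (get-set-≢ a s s′ _ ne) eq ∷ get-blank s′ ∷ []
  erase-∅ s s′ ne a (c ∷ r) (eq ∷ r∅) with get c s
  ... | nothing = trans (get-set-≢ a s s′ _ ne) eq ∷ r∅
  ... | just _  = eq ∷ erase-∅ s s′ ne c r r∅

  erase-other : ∀ s s′ → s ≢ s′ → ∀ {bs} a r → Content s′ bs (a ∷ r) → Content s′ bs (erase s a r)
  erase-other s s′ ne a r       ([] r∅)       = [] (erase-∅ s s′ ne a r r∅)
  erase-other s s′ ne a []      (eq ∷ [] _)   = trans (get-set-≢ a s s′ _ ne) eq ∷ [] (get-blank s′ ∷ [])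
  erase-other s s′ ne a (c ∷ r) (eq ∷ con) with get c s
  ... | nothing = trans (get-set-≢ a s s′ _ ne) eq ∷ con
  ... | just _  = eq ∷ erase-other s s′ ne c r con

  content-blank : ∀ {s bs} → Content s bs [] → Content s bs (blank ∷ [])
  content-blank {s} ([] []) = [] (get-blank s ∷ [])

-- An operation walks to the top of a stack and back in at most 4 steps plus twice its height, and
-- during `t` operations no height exceeds `t + h`.
simTime : ℕ → ℕ → ℕ
simTime t h = t * (4 + 2 * (t + h))

simTime-mono : ∀ {t t′ h h′} → t ≤ t′ → h ≤ h′ → simTime t h ≤ simTime t′ h′
simTime-mono le le′ = *-mono-≤ le (+-monoʳ-≤ 4 (*-monoʳ-≤ 2 (+-mono-≤ le le′)))

simTime-+ : ∀ t t′ {h h′} → h′ ≤ t + h → simTime t h + simTime t′ h′ ≤ simTime (t + t′) h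
simTime-+ t t′ {h} {h′} le = begin
  t * (4 + 2 * (t + h)) + t′ * (4 + 2 * (t′ + h′))
    ≤⟨ +-mono-≤ (*-monoʳ-≤ t (+-monoʳ-≤ 4 (*-monoʳ-≤ 2 (+-monoˡ-≤ h (m≤m+n t t′)))))
                (*-monoʳ-≤ t′ (+-monoʳ-≤ 4 (*-monoʳ-≤ 2 (≤-trans (+-monoʳ-≤ t′ le) (≤-reflexive (arith t t′ h)))))) ⟩
  t * (4 + 2 * (t + t′ + h)) + t′ * (4 + 2 * (t + t′ + h))
    ≡⟨ *-distribʳ-+ (4 + 2 * (t + t′ + h)) t t′ ⟨
  simTime (t + t′) h ∎
  where
  open ≤-Reasoning
  arith : ∀ t t′ h → t′ + (t + h) ≡ t + t′ + h
  arith = solve-∀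

length-≤-height : ∀ {k} (s : Fin k) st → length (lookup st s) ≤ height st
length-≤-height zero    (x ∷ st) = m≤m+n (length x) (height st)
length-≤-height (suc s) (x ∷ st) = ≤-trans (length-≤-height s st) (m≤n+m (height st) (length x))

pop-time : ∀ (s : Stk) st {b l} → lookup st s ≡ b ∷ l → 4 + 2 * length l ≤ simTime 1 (height st)
pop-time s st {b} {l} eq = ≤-trans
  (+-monoʳ-≤ 4 (*-monoʳ-≤ 2 (≤-trans (n≤1+n (length l)) (≤-trans (subst (λ x → length x ≤ height st) eq (length-≤-height s st)) (n≤1+n (height st))))))
  (m≤m+n _ 0)

module Simulate (M : TM) (tracks : Tracks (extra M)) where
  open Tracks tracks
  open Compile tracks

  Q : Set
  Q = Fin (states M)

  -- `exec` reveals only whether and how the machine halts, never a configuration. A partial run is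
  -- therefore described by its effect on every larger budget, which also makes runs compose.
  record Reach (N : ℕ) (c c′ : Config M) : Set where
    constructor reach
    field
      time  : ℕ
      bound : time ≤ N
      steps : ∀ u → exec M (time + u) c ≡ exec M u c′

  reach-refl : ∀ {c} → Reach 0 c c
  reach-refl = reach 0 z≤n λ u → refl

  reach-trans : ∀ {N N′ c c′ c″} → Reach N c c′ → Reach N′ c′ c″ → Reach (N + N′) c c″
  reach-trans {c = c} (reach t le s) (reach t′ le′ s′) =
    reach (t + t′) (+-mono-≤ le le′)
      λ u → trans (cong (λ v → exec M v c) (+-assoc t t′ u)) (trans (s (t′ + u)) (s′ u))

  reach-≤ : ∀ {N N′ c c′} → N ≤ N′ → Reach N c c′ → Reach N′ c c′
  reach-≤ le (reach t le′ s) = reach t (≤-trans le′ le) s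

  fire : Step → Action (states M) (extra M)
  fire (q , s , mv) = go q s mv

  exec-step : ∀ u {q l s r q′ s′ mv} → δ M q s ≡ go q′ s′ mv →
              exec M (suc u) (conf q l s r) ≡ exec M u (moveHead {M} q′ l s′ r mv)
  exec-step u eq rewrite eq = refl

  reach-step : ∀ {q l s r q′ s′ mv} → δ M q s ≡ go q′ s′ mv →
               Reach 1 (conf q l s r) (moveHead {M} q′ l s′ r mv)
  reach-step eq = reach 1 ≤-refl λ u → exec-step u eq

  at : Q → List Sym → List Sym → Config M
  at q l []      = conf q l blank []
  at q l (c ∷ r) = conf q l c r

  -- The configuration between two commands: the head is on the first cell, and the single blank to
  -- its left is the marker at which the walks back end.
  rest : Q → List Sym → Config M
  rest q r = at q (blank ∷ []) r

  right-step : ∀ {q l s r q′ s′} → δ M q s ≡ go q′ s′ R → Reach 1 (conf q l s r) (at q′ (s′ ∷ l) r)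
  right-step {q} {[]}    {s} {[]}    eq = reach-step eq
  right-step {q} {[]}    {s} {c ∷ r} eq = reach-step eq
  right-step {q} {a ∷ l} {s} {[]}    eq = reach-step eq
  right-step {q} {a ∷ l} {s} {c ∷ r} eq = reach-step eq

  Implements : (c : Cmd) → (St c → Q) → Q → Set
  Implements c inj exit = ∀ q x → δ M (inj q) x ≡ fire (stepδ c inj exit q x)

  go-home : ∀ {self exit} → (∀ x → δ M self x ≡ fire (returnδ self exit x)) →
            ∀ l s r → All (λ c → empty? c ≡ false) l →
            Reach (1 + length l) (moveHead {M} self (l ++ blank ∷ []) s r L) (rest exit (l ʳ++ s ∷ r))
  go-home {self} {exit} H [] s r [] = right-step (trans (H blank) blank-case)
    where
    blank-case : fire (returnδ self exit blank) ≡ go exit blank R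
    blank-case rewrite empty?-blank = refl
  go-home {self} {exit} H (a ∷ l) s r (ne ∷ nes) =
    reach-trans (reach-step (trans (H a) a-case)) (go-home H l a (s ∷ r) nes)
    where
    a-case : fire (returnδ self exit a) ≡ go self a L
    a-case rewrite ne = refl

  push-reach : ∀ {s b inj exit} → Implements (push s b) inj exit →
               ∀ {bs r} → Content s bs r → ∀ l → All (λ c → empty? c ≡ false) l →
               Reach (2 + (length l + 2 * length bs)) (at (inj zero) (l ++ blank ∷ []) r) (rest exit (l ʳ++ write s b r))
  push-reach {s} {b} {inj} {exit} H {r = []} ([] r∅) l ne =
    reach-≤ (s≤s (s≤s (m≤m+n _ _))) (reach-trans (reach-step (trans (H zero blank) here-eq)) (go-home (H (suc zero)) l _ [] ne))
    where
    here-eq : fire (stepδ (push s b) inj exit zero blank) ≡ go (inj (suc zero)) (set blank s (just b)) L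
    here-eq rewrite get-blank s = refl
  push-reach {s} {b} {inj} {exit} H {r = c ∷ r} ([] (eq ∷ r∅)) l ne rewrite eq =
    reach-≤ (s≤s (s≤s (m≤m+n _ _))) (reach-trans (reach-step (trans (H zero c) here-eq)) (go-home (H (suc zero)) l _ r ne))
    where
    here-eq : fire (stepδ (push s b) inj exit zero c) ≡ go (inj (suc zero)) (set c s (just b)) L
    here-eq rewrite eq = refl
  push-reach {s} {b} {inj} {exit} H {bs = _ ∷ bs} {c ∷ r} (eq ∷ con) l ne rewrite eq =
    reach-≤ (≤-reflexive (arith (length l) (length bs)))
      (reach-trans (right-step (trans (H zero c) here-eq))
        (push-reach {s} {b} {inj} {exit} H con (c ∷ l) (empty?-just c s eq ∷ ne)))
    where
    here-eq : fire (stepδ (push s b) inj exit zero c) ≡ go (inj zero) c R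
    here-eq rewrite eq = refl
    arith : ∀ x y → suc (suc (suc (suc x + 2 * y))) ≡ 2 + (x + 2 * suc y)
    arith = solve-∀

  popped : List Bool → (e∅ e₀ e₁ : Q) → Q
  popped []          e∅ e₀ e₁ = e∅
  popped (false ∷ _) e∅ e₀ e₁ = e₀
  popped (true ∷ _)  e∅ e₀ e₁ = e₁

  PopImplements : (Fin 4 → Q) → (e∅ e₀ e₁ : Q) → Stk → Set
  PopImplements inj e∅ e₀ e₁ s = ∀ q x → δ M (inj q) x ≡ fire (popδ inj e∅ e₀ e₁ s q x)

  module _ {s inj e∅ e₀ e₁} (H : PopImplements inj e∅ e₀ e₁ s) where

    erase-top : ∀ a b l r → get a s ≡ just b → All (λ c → empty? c ≡ false) l →
                Reach (2 + length l) (conf (inj (suc zero)) (l ++ blank ∷ []) a r)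
                  (rest (popped (b ∷ []) e∅ e₀ e₁) (l ʳ++ set a s nothing ∷ r))
    erase-top a false l r eq ne = reach-trans (reach-step (trans (H (suc zero) a) here-eq)) (go-home (H _) l _ r ne)
      where
      here-eq : fire (popδ inj e∅ e₀ e₁ s (suc zero) a) ≡ go (inj (suc (suc zero))) (set a s nothing) L
      here-eq rewrite eq = refl
    erase-top a true l r eq ne = reach-trans (reach-step (trans (H (suc zero) a) here-eq)) (go-home (H _) l _ r ne)
      where
      here-eq : fire (popδ inj e∅ e₀ e₁ s (suc zero) a) ≡ go (inj (suc (suc (suc zero)))) (set a s nothing) L
      here-eq rewrite eq = refl

    seek-over : ∀ c {b} → get c s ≡ just b → δ M (inj zero) c ≡ go (inj zero) c R
    seek-over c eq = trans (H zero c) here-eq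
      where
      here-eq : fire (popδ inj e∅ e₀ e₁ s zero c) ≡ go (inj zero) c R
      here-eq rewrite eq = refl

    seek-end : ∀ c → get c s ≡ nothing → δ M (inj zero) c ≡ go (inj (suc zero)) c L
    seek-end c eq = trans (H zero c) here-eq
      where
      here-eq : fire (popδ inj e∅ e₀ e₁ s zero c) ≡ go (inj (suc zero)) c L
      here-eq rewrite eq = refl

    pop-from : ∀ bs b a r l → Content s (bs ++ b ∷ []) (a ∷ r) → All (λ c → empty? c ≡ false) l →
               Reach (4 + (length l + 2 * length bs)) (at (inj zero) (l ++ blank ∷ []) (a ∷ r))
                 (rest (popped (b ∷ []) e∅ e₀ e₁) (l ʳ++ erase s a r))
    pop-from [] b a [] l (eq ∷ con) ne =
      reach-≤ (s≤s (s≤s (s≤s (s≤s (m≤m+n _ _)))))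
        (reach-trans (right-step (seek-over a eq))
          (reach-trans (reach-step (seek-end blank (get-blank s))) (erase-top a b l _ eq ne)))
    pop-from [] b a (c ∷ r) l (eq ∷ [] (eq′ ∷ _)) ne rewrite eq′ =
      reach-≤ (s≤s (s≤s (s≤s (s≤s (m≤m+n _ _)))))
        (reach-trans (right-step (seek-over a eq))
          (reach-trans (reach-step (seek-end c eq′)) (erase-top a b l _ eq ne)))
    pop-from (x ∷ bs) b a [] l (eq ∷ con) ne = ⊥-elim (impossible bs con)
      where
      impossible : ∀ bs → ¬ Content s (bs ++ b ∷ []) []
      impossible []       ()
      impossible (_ ∷ bs) ()
    pop-from (x ∷ bs) b a (c ∷ r) l (eq ∷ con) ne =
      subst (λ e → Reach _ _ (rest _ (l ʳ++ e))) (sym (skip bs con))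
        (reach-≤ (≤-reflexive (arith (length l) (length bs)))
          (reach-trans (right-step (seek-over a eq))
            (pop-from bs b c r (a ∷ l) con (empty?-just a s eq ∷ ne))))
      where
      skip : ∀ bs → Content s (bs ++ b ∷ []) (c ∷ r) → erase s a (c ∷ r) ≡ a ∷ erase s c r
      skip []      (eq′ ∷ _) rewrite eq′ = refl
      skip (_ ∷ _) (eq′ ∷ _) rewrite eq′ = refl
      arith : ∀ x y → suc (4 + (suc x + 2 * y)) ≡ 4 + (x + 2 * suc y)
      arith = solve-∀


  pop-cons : ∀ {s inj e∅ e₀ e₁} → PopImplements inj e∅ e₀ e₁ s →
             ∀ {st b l} → lookup st s ≡ b ∷ l → ∀ {r} → Tape st r →
             Σ (List Sym) λ r′ → Tape (st [ s ]≔ l) r′ ×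
               Reach (4 + 2 * length l) (rest (inj zero) r) (rest (popped (b ∷ []) e∅ e₀ e₁) r′)
  pop-cons {s} {inj} {e∅} {e₀} {e₁} H {st} {b} {l} eq {r} tape =
    go-pop r tape (subst (λ bs → Content s bs r) (trans (cong reverse eq) (unfold-reverse b l)) (on tape s))
    where
    go-pop : ∀ r → Tape st r → Content s (reverse l ++ b ∷ []) r →
             Σ (List Sym) λ r′ → Tape (st [ s ]≔ l) r′ ×
               Reach (4 + 2 * length l) (rest (inj zero) r) (rest (popped (b ∷ []) e∅ e₀ e₁) r′)
    go-pop [] tape con = ⊥-elim (nonempty (reverse l) con)
      where
      nonempty : ∀ bs → ¬ Content s (bs ++ b ∷ []) []
      nonempty []       ()
      nonempty (_ ∷ bs) ()
    go-pop (a ∷ r) tape con = erase s a r , tape′ ,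
      subst (λ k → Reach (4 + 2 * k) _ _) (length-reverse l) (pop-from H (reverse l) b a r [] con [])
      where
      tape′ : Tape (st [ s ]≔ l) (erase s a r)
      on tape′ s′ with s Fin.≟ s′
      ... | yes refl rewrite lookup∘update s st l = erase-same s b (reverse l) a con
      ... | no ne rewrite lookup∘update′ (ne ∘ sym) st l = erase-other s s′ ne a r (on tape s′)

  pop-nil : ∀ {s inj e∅ e₀ e₁} → PopImplements inj e∅ e₀ e₁ s →
            ∀ {st} → lookup st s ≡ [] → ∀ {r} → Tape st r →
            Σ (List Sym) λ r′ → Tape st r′ × Reach 2 (rest (inj zero) r) (rest e∅ r′)
  pop-nil {s} {inj} {e∅} {e₀} {e₁} H {st} eq {r} tape =
    go-pop r tape (subst (λ bs → Content s bs r) (cong reverse eq) (on tape s))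
    where
    read-blank : δ M (inj (suc zero)) blank ≡ go e∅ blank R
    read-blank = trans (H (suc zero) blank) here-eq
      where
      here-eq : fire (popδ inj e∅ e₀ e₁ s (suc zero) blank) ≡ go e∅ blank R
      here-eq rewrite get-blank s = refl
    go-pop : ∀ r → Tape st r → Content s [] r →
             Σ (List Sym) λ r′ → Tape st r′ × Reach 2 (rest (inj zero) r) (rest e∅ r′)
    go-pop [] tape con = blank ∷ [] , record { on = λ s′ → content-blank (on tape s′) } ,
      reach-trans (reach-step (seek-end H blank (get-blank s))) (right-step read-blank)
    go-pop (c ∷ r) tape ([] (eq′ ∷ _)) = c ∷ r , tape ,
      reach-trans (reach-step (seek-end H c eq′)) (right-step read-blank)

  -- By induction on the derivation of the run. After the body of a `while` the machine is in the
  -- entry state of the same `while`, where the remaining, shorter derivation applies.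
  simulate : ∀ {c st t st′ inj exit} → Run c st t st′ → Implements c inj exit → ∀ {r} → Tape st r →
             Σ (List Sym) λ r′ → Tape st′ r′ × Reach (simTime t (height st)) (rest (entry c inj exit) r) (rest exit r′)

  simulate-pop : ∀ {s inj e∅ e₀ e₁ st b l t st′ exit r} → PopImplements inj e∅ e₀ e₁ s →
    lookup st s ≡ b ∷ l → Tape st r →
    (∀ {r} → Tape (st [ s ]≔ l) r → Σ (List Sym) λ r′ → Tape st′ r′ ×
       Reach (simTime t (height (st [ s ]≔ l))) (rest (popped (b ∷ []) e∅ e₀ e₁) r) (rest exit r′)) →
    Σ (List Sym) λ r′ → Tape st′ r′ × Reach (simTime (1 + t) (height st)) (rest (inj zero) r) (rest exit r′)
  simulate-pop {s} {st = st} {t = t} H eq tape k =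
    let r₁ , tape₁ , go₁ = pop-cons H {st = st} eq tape
        r₂ , tape₂ , go₂ = k tape₁
    in r₂ , tape₂ , reach-≤ (simTime-+ 1 t (≤-trans (height-popped-≤ s st eq) (n≤1+n _)))
                      (reach-trans (reach-≤ (pop-time s st eq) go₁) go₂)

  simulate-seq : ∀ {t t′ h h′ st′ st″ c c′ q} → h′ ≤ t + h →
    (Σ (List Sym) λ r′ → Tape st′ r′ × Reach (simTime t h) c (rest c′ r′)) →
    (∀ {r} → Tape st′ r → Σ (List Sym) λ r′ → Tape st″ r′ × Reach (simTime t′ h′) (rest c′ r) (rest q r′)) →
    Σ (List Sym) λ r′ → Tape st″ r′ × Reach (simTime (t + t′) h) c (rest q r′)
  simulate-seq {t} {t′} le (r₁ , tape₁ , go₁) k =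
    let r₂ , tape₂ , go₂ = k tape₁ in r₂ , tape₂ , reach-≤ (simTime-+ t t′ le) (reach-trans go₁ go₂)

  simulate nop H {r} tape = r , tape , reach-refl
  simulate {inj = inj} {exit} (push {st} s b) H {r} tape = write s b r , tape′ ,
    reach-≤ bound (push-reach {s} {b} {inj} {exit} H (on tape s) [] [])
    where
    tape′ : Tape (pushed s b st) (write s b r)
    on tape′ s′ with s Fin.≟ s′
    ... | yes refl rewrite lookup∘update s st (b ∷ lookup st s) | unfold-reverse b (lookup st s) = write-same s b (on tape s)
    ... | no ne rewrite lookup∘update′ (ne ∘ sym) st (b ∷ lookup st s) = write-other s b s′ ne (on tape s′)
    bound : 2 + 2 * length (reverse (lookup st s)) ≤ simTime 1 (height st)
    bound rewrite length-reverse (lookup st s) =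
      ≤-trans (+-mono-≤ {2} {4} (s≤s (s≤s z≤n)) (*-monoʳ-≤ 2 (≤-trans (length-≤-height s st) (n≤1+n _)))) (m≤m+n _ 0)
  simulate {inj = inj} {exit} (_⨾_ {c} {c′} {st} {t = t} {t′} ρ ρ′) H tape =
    simulate-seq {t} {t′} (run-height ρ)
      (simulate {inj = inj ∘ inj₁} ρ (λ q → H (inj₁ q)) tape)
      (simulate {inj = inj ∘ inj₂} {exit} ρ′ (λ q → H (inj₂ q)))
  simulate {inj = inj} {exit} (branch-∅ {s} {st = st} {t = t} eq ρ) H tape =
    let r₁ , tape₁ , go₁ = pop-nil (λ q → H (inj₁ q)) {st} eq tape
        r₂ , tape₂ , go₂ = simulate {inj = inj ∘ inj₂ ∘ inj₁} ρ (λ q → H (inj₂ (inj₁ q))) tape₁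
    in r₂ , tape₂ , reach-≤ (simTime-+ 1 t (n≤1+n _))
         (reach-trans (reach-≤ (≤-trans (s≤s (s≤s z≤n)) (m≤m+n _ 0)) go₁) go₂)
  simulate {inj = inj} {exit} (branch-0 {s} {t = t} eq ρ) H tape =
    simulate-pop {t = t} (λ q → H (inj₁ q)) eq tape
      (simulate {inj = inj ∘ inj₂ ∘ inj₂ ∘ inj₁} ρ (λ q → H (inj₂ (inj₂ (inj₁ q)))))
  simulate {inj = inj} {exit} (branch-1 {s} {t = t} eq ρ) H tape =
    simulate-pop {t = t} (λ q → H (inj₁ q)) eq tape
      (simulate {inj = inj ∘ inj₂ ∘ inj₂ ∘ inj₂} ρ (λ q → H (inj₂ (inj₂ (inj₂ q)))))
  simulate {inj = inj} {exit} (while-∅ {st = st} eq) H tape =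
    let r₁ , tape₁ , go₁ = pop-nil (λ q → H (inj₁ q)) {st} eq tape
    in r₁ , tape₁ , reach-≤ (≤-trans (s≤s (s≤s z≤n)) (m≤m+n _ 0)) go₁
  simulate {inj = inj} {exit} (while-end {s} {st = st} eq) H tape =
    let r₁ , tape₁ , go₁ = pop-cons (λ q → H (inj₁ q)) {st} eq tape
    in r₁ , tape₁ , reach-≤ (pop-time s st eq) go₁
  simulate {inj = inj} {exit} (while-0 {s} {st = st} {t = t} {t′} eq ρ ρ′) H tape =
    simulate-seq {suc t} {t′} {st′ = _} (≤-trans (run-height ρ) (≤-trans (+-monoʳ-≤ t (height-popped-≤ s st eq)) (n≤1+n _)))
      (simulate-pop {t = t} (λ q → H (inj₁ q)) eq tape
        (simulate {inj = inj ∘ inj₂ ∘ inj₁} ρ (λ q → H (inj₂ (inj₁ q)))))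
      (simulate {inj = inj} {exit} ρ′ H)
  simulate {inj = inj} {exit} (while-1 {s} {st = st} {t = t} {t′} eq ρ ρ′) H tape =
    simulate-seq {suc t} {t′} {st′ = _} (≤-trans (run-height ρ) (≤-trans (+-monoʳ-≤ t (height-popped-≤ s st eq)) (n≤1+n _)))
      (simulate-pop {t = t} (λ q → H (inj₁ q)) eq tape
        (simulate {inj = inj ∘ inj₂ ∘ inj₂} ρ (λ q → H (inj₂ (inj₂ q)))))
      (simulate {inj = inj} {exit} ρ′ H)
  simulate {st = st} (weaken ρ le) H tape =
    let r₁ , tape₁ , go₁ = simulate ρ H tape
    in r₁ , tape₁ , reach-≤ (simTime-mono le (≤-refl {height st})) go₁

-- The tape alphabet and the machine of a command

private
  cellOf : Fin 3 ⊎ Fin (3 ^ 4) → Stk → Fin 3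
  cellOf (inj₁ zero)          s    = zero
  cellOf (inj₁ x@(suc _))     auxˢ = x
  cellOf (inj₁ (suc _))       s    = zero
  cellOf (inj₂ i)             s    = finToFun i s

  toBit : Fin 3 → Maybe Bool
  toBit zero             = nothing
  toBit (suc zero)       = just false
  toBit (suc (suc zero)) = just true

  fromBit : Maybe Bool → Fin 3
  fromBit nothing      = zero
  fromBit (just false) = suc zero
  fromBit (just true)  = suc (suc zero)

  toBit-fromBit : ∀ x → toBit (fromBit x) ≡ x
  toBit-fromBit nothing      = refl
  toBit-fromBit (just false) = refl
  toBit-fromBit (just true)  = refl

  update : (Stk → Fin 3) → Stk → Fin 3 → Stk → Fin 3
  update f s x s′ with s Fin.≟ s′
  ... | yes _ = x
  ... | no  _ = f s′

  update-same : ∀ f s x → update f s x s ≡ x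
  update-same f s x with s Fin.≟ s
  ... | yes _ = refl
  ... | no ne = ⊥-elim (ne refl)

  update-other : ∀ f s s′ x → s ≢ s′ → update f s x s′ ≡ f s′
  update-other f s s′ x ne with s Fin.≟ s′
  ... | yes eq = ⊥-elim (ne eq)
  ... | no _   = refl

  fieldOf : Symbol (3 ^ 4) → Stk → Fin 3
  fieldOf c = cellOf (splitAt 3 c)

  -- The result is always one of the `3 ^ 4` packed symbols, so a raw input bit is converted when
  -- its cell is first changed. A packed symbol with four vacant fields differs from `blank` but is
  -- read in the same way.
  assign : Symbol (3 ^ 4) → Stk → Fin 3 → Symbol (3 ^ 4)
  assign c s x = 3 ↑ʳ funToFin (update (fieldOf c) s x)

  fieldOf-assign : ∀ c s x s′ → fieldOf (assign c s x) s′ ≡ update (fieldOf c) s x s′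
  fieldOf-assign c s x s′ =
    trans (cong (λ y → cellOf y s′) (Fin.splitAt-↑ʳ 3 (3 ^ 4) (funToFin (update (fieldOf c) s x))))
          (Fin.finToFun-funToFin (update (fieldOf c) s x) s′)

-- A raw input bit is read as a cell in which only the auxiliary stack is present, so
-- the input tape holds the input on that stack.
tracks : Tracks (3 ^ 4)
tracks = record
  { get       = λ c s → toBit (fieldOf c s)
  ; set       = λ c s x → assign c s (fromBit x)
  ; get-set   = λ c s x → trans (cong toBit (trans (fieldOf-assign c s (fromBit x) s) (update-same (fieldOf c) s (fromBit x)))) (toBit-fromBit x)
  ; get-set-≢ = λ c s s′ x ne → cong toBit (trans (fieldOf-assign c s (fromBit x) s′) (update-other (fieldOf c) s s′ (fromBit x) ne))
  ; get-blank = λ s → refl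
  }

inputStacks : List Bool → Stacks
inputStacks x = [] ∷ reverse x ∷ [] ∷ [] ∷ []

nonEmpty : List Bool → Bool
nonEmpty []      = false
nonEmpty (_ ∷ _) = true

module Machine (c : Cmd) where
  open Compile tracks
  open Tracks tracks

  private
    F = finite-St c

  numStates : ℕ
  numStates = 3 + card F

  inject : St c → Fin numStates
  inject q = 3 ↑ʳ enc F q

  toAction : Fin numStates × Symbol (3 ^ 4) × Move → Action numStates (3 ^ 4)
  toAction (q , s , mv) = go q s mv

  -- The first two states step to the left and back, which creates the blank marker before the
  -- input. The third one inspects the first cell, where the bottom of the auxiliary stack is, so
  -- the answer is whether that stack is non-empty.
  delta : Fin numStates → Symbol (3 ^ 4) → Action numStates (3 ^ 4)
  delta zero                   s = go (suc zero) s L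
  delta (suc zero)             s = go (entry c inject (suc (suc zero))) s R
  delta (suc (suc zero))       s = halt (not (vacant (get s auxˢ)))
  delta (suc (suc (suc q)))    s = toAction (stepδ c inject (suc (suc zero)) (dec F q) s)

  machine : TM
  machine = record { states = numStates ; extra = 3 ^ 4 ; start = zero ; δ = delta }

  open Simulate machine tracks

  implements : Implements c inject (suc (suc zero))
  implements q x rewrite dec-enc F q = refl

  bit-empty : ∀ s b → s ≢ auxˢ → get (bitSym b) s ≡ nothing
  bit-empty mainˢ false ne = refl
  bit-empty mainˢ true  ne = refl
  bit-empty auxˢ  b     ne = ⊥-elim (ne refl)
  bit-empty tmpˢ  false ne = refl
  bit-empty tmpˢ  true  ne = refl
  bit-empty cntˢ  false ne = refl
  bit-empty cntˢ  true  ne = refl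

  bit-aux : ∀ b → get (bitSym b) auxˢ ≡ just b
  bit-aux false = refl
  bit-aux true  = refl

  bits-empty : ∀ s x → s ≢ auxˢ → All (λ c → get c s ≡ nothing) (map bitSym x)
  bits-empty s []      ne = []
  bits-empty s (b ∷ x) ne = bit-empty s b ne ∷ bits-empty s x ne

  bits-aux : ∀ x → Content auxˢ x (map bitSym x)
  bits-aux []      = [] []
  bits-aux (b ∷ x) = bit-aux b ∷ bits-aux x

  input-tape : ∀ x → Tape (inputStacks x) (map bitSym x)
  on (input-tape x) mainˢ = [] (bits-empty mainˢ x λ ())
  on (input-tape x) auxˢ rewrite reverse-involutive x = bits-aux x
  on (input-tape x) tmpˢ  = [] (bits-empty tmpˢ x λ ())
  on (input-tape x) cntˢ  = [] (bits-empty cntˢ x λ ())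

  start-up : ∀ x → Σ (List Sym) λ r → Tape (inputStacks x) r ×
             Reach 2 (initial machine x) (rest (entry c inject (suc (suc zero))) r)
  start-up [] = blank ∷ [] , record { on = λ s → content-blank (on (input-tape []) s) } ,
    reach-trans (reach-step refl) (reach-step refl)
  start-up (b ∷ x) = bitSym b ∷ map bitSym x , input-tape (b ∷ x) ,
    reach-trans (reach-step refl) (reach-step refl)

  answer : ∀ st r u → Tape st r → exec machine (suc u) (rest (suc (suc zero)) r) ≡ halted (nonEmpty (lookup st auxˢ))
  answer st r u tape = trans (verdict r (on tape auxˢ)) (cong halted (nonEmpty-reverse (lookup st auxˢ)))
    where
    verdict : ∀ {bs} r → Content auxˢ bs r → exec machine (suc u) (rest (suc (suc zero)) r) ≡ halted (nonEmpty bs)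
    verdict []      ([] _)         = refl
    verdict (c ∷ r) ([] (eq ∷ _))  rewrite eq = refl
    verdict (c ∷ r) (eq ∷ _)       rewrite eq = refl
    nonEmpty-snoc : ∀ xs b → nonEmpty (xs ++ b ∷ []) ≡ true
    nonEmpty-snoc []       b = refl
    nonEmpty-snoc (_ ∷ xs) b = refl
    nonEmpty-reverse : ∀ xs → nonEmpty (reverse xs) ≡ nonEmpty xs
    nonEmpty-reverse []       = refl
    nonEmpty-reverse (b ∷ xs) = trans (cong nonEmpty (unfold-reverse b xs)) (nonEmpty-snoc (reverse xs) b)

  -- The 3 consists of the two steps of `start-up` and the halting step.
  machine-halts : ∀ {x t st′} → Run c (inputStacks x) t st′ → ∀ {N} → 3 + simTime t (length x) ≤ N →
                  HaltsWithin machine x N (nonEmpty (lookup st′ auxˢ))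
  machine-halts {x} {t} {st′} ρ {N} le =
    let r₀ , tape₀ , go₀ = start-up x
        r₁ , tape₁ , go₁ = simulate ρ implements tape₀
    in finish r₁ tape₁ (reach-trans go₀ go₁)
    where
    height-input : height (inputStacks x) ≡ length x
    height-input = trans (+-identityʳ _) (length-reverse x)
    finish : ∀ r → Tape st′ r → Reach (2 + simTime t (height (inputStacks x))) (initial machine x) (rest (suc (suc zero)) r) →
             HaltsWithin machine x N (nonEmpty (lookup st′ auxˢ))
    finish r tape (reach time bound steps) =
      let time<N = ≤-trans (s≤s bound) (subst (λ h → 3 + simTime t h ≤ N) (sym height-input) le)
          split : time + suc (N ∸ suc time) ≡ N
          split = trans (+-suc time _) (m+[n∸m]≡n time<N)
      in trans (cong (λ v → exec machine v (initial machine x)) (sym split))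
           (trans (steps (suc (N ∸ suc time))) (answer st′ r _ tape))

-- Trees on the main stack

data Tree : Set where
  leaf : Tree
  node : Tree → Tree → Tree

size : Tree → ℕ
size leaf       = 1
size (node a b) = suc (size a + size b)

code : Tree → List Bool → List Bool
code leaf       r = false ∷ r
code (node a b) r = true ∷ code a (code b r)

codes : List Tree → List Bool
codes = foldr code []

sizes : List Tree → ℕ
sizes []       = 0
sizes (t ∷ ts) = size t + sizes ts

length-code : ∀ t r → length (code t r) ≡ size t + length r
length-code leaf       r = refl
length-code (node a b) r = cong suc (trans (length-code a (code b r))
  (trans (cong (size a +_) (length-code b r)) (sym (+-assoc (size a) (size b) (length r)))))

length-codes : ∀ ts → length (codes ts) ≡ sizes ts
length-codes []       = refl
length-codes (t ∷ ts) = trans (length-code t (codes ts)) (cong (size t +_) (length-codes ts))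

-- The prefix code in reverse, as it accumulates on a stack that receives it bit by bit.
rcode : Tree → List Bool → List Bool
rcode leaf       a = false ∷ a
rcode (node x y) a = rcode y (rcode x (true ∷ a))

rcode-ʳ++ : ∀ t a r → rcode t a ʳ++ r ≡ a ʳ++ code t r
rcode-ʳ++ leaf       a r = refl
rcode-ʳ++ (node x y) a r = trans (rcode-ʳ++ y (rcode x (true ∷ a)) r) (rcode-ʳ++ x (true ∷ a) (code y r))

rcode-ʳ++-tail : ∀ t r → rcode t [] ʳ++ r ≡ code t r
rcode-ʳ++-tail t r = rcode-ʳ++ t [] r

code-++ : ∀ t s r → code t s ++ r ≡ code t (s ++ r)
code-++ leaf       s r = refl
code-++ (node x y) s r = cong (true ∷_) (trans (code-++ x (code y s) r) (cong (code x) (code-++ y s r)))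

length-rcode : ∀ t a → length (rcode t a) ≡ size t + length a
length-rcode leaf       a = refl
length-rcode (node x y) a = trans (length-rcode y _) (trans (cong (size y +_) (length-rcode x _)) (arith (size y) (size x) (length a)))
  where
  arith : ∀ y x a → y + (x + suc a) ≡ suc (x + y + a)
  arith = solve-∀

data Target : Set where
  toAux toTmp discard : Target

put : Target → Bool → Cmd
put toAux   b = push auxˢ b
put toTmp   b = push tmpˢ b
put discard b = nop

-- Moves the top tree of the main stack, reversing it; the counter stack holds one
-- token for every subtree still expected.
moveTree : Target → Cmd
moveTree d = push cntˢ true ⨾ while cntˢ false nop
  (branch mainˢ nop (put d false) (put d true ⨾ push cntˢ true ⨾ push cntˢ true))

give : Target → Bool → List Bool × List Bool → List Bool × List Bool
give toAux   x (a , b) = x ∷ a , b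
give toTmp   x (a , b) = a , x ∷ b
give discard x ab      = ab

received : Target → Tree → List Bool × List Bool → List Bool × List Bool
received d leaf       ab = give d false ab
received d (node x y) ab = received d y (received d x (give d true ab))

stacks : List Bool → List Bool × List Bool → List Bool → Stacks
stacks m (a , b) c = m ∷ a ∷ b ∷ c ∷ []

run-to : ∀ {c st t m ab ab′ k} → ab ≡ ab′ → Run c st t (stacks m ab k) → Run c st t (stacks m ab′ k)
run-to refl ρ = ρ

put-run : ∀ d x m ab c → Run (put d x) (stacks m ab c) 1 (stacks m (give d x ab) c)
put-run toAux   x m ab c = push auxˢ x
put-run toTmp   x m ab c = push tmpˢ x
put-run discard x m ab c = weaken nop z≤n

-- Stated for an arbitrary continuation of the loop, since both subtrees of a node are moved by
-- consecutive rounds of one and the same loop.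
moveLoop-run : ∀ d t {r ab c T st} →
  Run (while cntˢ false nop (branch mainˢ nop (put d false) (put d true ⨾ push cntˢ true ⨾ push cntˢ true)))
      (stacks r (received d t ab) c) T st →
  Run (while cntˢ false nop (branch mainˢ nop (put d false) (put d true ⨾ push cntˢ true ⨾ push cntˢ true)))
      (stacks (code t r) ab (true ∷ c)) (6 * size t + T) st
moveLoop-run d leaf       {r} {ab} {c} {T} ρ =
  weaken (while-1 refl (branch-0 refl (put-run d false r ab c)) ρ) (m≤n+m (3 + T) 3)
moveLoop-run d (node x y) {r} {ab} {c} {T} ρ =
  weaken (while-1 refl (branch-1 refl (put-run d true _ ab c ⨾ push cntˢ true ⨾ push cntˢ true))
            (moveLoop-run d x (moveLoop-run d y ρ)))
         (≤-trans (n≤1+n _) (≤-reflexive (arith (size x) (size y) T)))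
  where
  arith : ∀ x y T → 6 + (6 * x + (6 * y + T)) ≡ 6 * suc (x + y) + T
  arith = solve-∀

moveTree-run : ∀ d t {r ab} → Run (moveTree d) (stacks (code t r) ab []) (2 + 6 * size t) (stacks r (received d t ab) [])
moveTree-run d t = weaken (push cntˢ true ⨾ moveLoop-run d t (while-∅ refl)) (s≤s (≤-reflexive (+-comm _ 1)))

moveTrees : Target → ℕ → Cmd
moveTrees d zero    = nop
moveTrees d (suc k) = moveTree d ⨾ moveTrees d k

receiveds : Target → List Tree → List Bool × List Bool → List Bool × List Bool
receiveds d []       ab = ab
receiveds d (t ∷ ts) ab = receiveds d ts (received d t ab)

size≥1 : ∀ t → 1 ≤ size t
size≥1 leaf       = s≤s z≤n
size≥1 (node a b) = s≤s z≤n

moveTrees-run : ∀ d ts {r ab} → Run (moveTrees d (length ts)) (stacks (foldr code r ts) ab []) (8 * sizes ts) (stacks r (receiveds d ts ab) [])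
moveTrees-run d []       = nop
moveTrees-run d (t ∷ ts) = weaken (moveTree-run d t ⨾ moveTrees-run d ts)
  (≤-trans (+-monoˡ-≤ (8 * sizes ts) (+-monoˡ-≤ (6 * size t) (*-monoʳ-≤ 2 (size≥1 t)))) (≤-reflexive (arith (size t) (sizes ts))))
  where
  arith : ∀ t ts → 2 * t + 6 * t + 8 * ts ≡ 8 * (t + ts)
  arith = solve-∀

received-toAux : ∀ t a b → received toAux t (a , b) ≡ (rcode t a , b)
received-toAux leaf       a b = refl
received-toAux (node x y) a b rewrite received-toAux x (true ∷ a) b = received-toAux y _ b

received-toTmp : ∀ t a b → received toTmp t (a , b) ≡ (a , rcode t b)
received-toTmp leaf       a b = refl
received-toTmp (node x y) a b rewrite received-toTmp x a (true ∷ b) = received-toTmp y a _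

received-discard : ∀ t ab → received discard t ab ≡ ab
received-discard leaf       ab = refl
received-discard (node x y) ab rewrite received-discard x ab = received-discard y ab

receiveds-discard : ∀ ts ab → receiveds discard ts ab ≡ ab
receiveds-discard []       ab = refl
receiveds-discard (t ∷ ts) ab rewrite received-discard t ab = receiveds-discard ts ab

rcodes : List Tree → List Bool → List Bool
rcodes []       a = a
rcodes (t ∷ ts) a = rcodes ts (rcode t a)

receiveds-toAux : ∀ ts a b → receiveds toAux ts (a , b) ≡ (rcodes ts a , b)
receiveds-toAux []       a b = refl
receiveds-toAux (t ∷ ts) a b rewrite received-toAux t a b = receiveds-toAux ts (rcode t a) b

rcodes-ʳ++ : ∀ ts a r → rcodes ts a ʳ++ r ≡ a ʳ++ foldr code r ts
rcodes-ʳ++ []       a r = refl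
rcodes-ʳ++ (t ∷ ts) a r = trans (rcodes-ʳ++ ts (rcode t a) r) (rcode-ʳ++ t a (foldr code r ts))

length-rcodes : ∀ ts a → length (rcodes ts a) ≡ sizes ts + length a
length-rcodes []       a = refl
length-rcodes (t ∷ ts) a = trans (length-rcodes ts (rcode t a))
  (trans (cong (sizes ts +_) (length-rcode t a)) (arith (sizes ts) (size t) (length a)))
  where
  arith : ∀ x y z → x + (y + z) ≡ y + x + z
  arith = solve-∀

drain : Stk → (Bool → Cmd) → Cmd
drain s f = while s true (f false) (f true)

drain-aux : ∀ a {m b c} → Run (drain auxˢ (push mainˢ)) (stacks m (a , b) c) (1 + 2 * length a) (stacks (a ʳ++ m) ([] , b) c)
drain-aux []          = while-∅ refl
drain-aux (false ∷ a) = weaken (while-0 refl (push mainˢ false) (drain-aux a)) (≤-reflexive (cong suc (sym (*-suc 2 (length a)))))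
drain-aux (true ∷ a)  = weaken (while-1 refl (push mainˢ true) (drain-aux a)) (≤-reflexive (cong suc (sym (*-suc 2 (length a)))))

drain-cnt : ∀ c {m a b} → Run (drain cntˢ (push auxˢ)) (stacks m (a , b) c) (1 + 2 * length c) (stacks m (c ʳ++ a , b) [])
drain-cnt []          = while-∅ refl
drain-cnt (false ∷ c) = weaken (while-0 refl (push auxˢ false) (drain-cnt c)) (≤-reflexive (cong suc (sym (*-suc 2 (length c)))))
drain-cnt (true ∷ c)  = weaken (while-1 refl (push auxˢ true) (drain-cnt c)) (≤-reflexive (cong suc (sym (*-suc 2 (length c)))))

drain-tmp : ∀ b {m a c} → Run (drain tmpˢ (λ x → push mainˢ x ⨾ push cntˢ x)) (stacks m (a , b) c) (1 + 3 * length b)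
            (stacks (b ʳ++ m) (a , []) (b ʳ++ c))
drain-tmp []          = while-∅ refl
drain-tmp (false ∷ b) = weaken (while-0 refl (push mainˢ false ⨾ push cntˢ false) (drain-tmp b)) (≤-reflexive (cong suc (sym (*-suc 3 (length b)))))
drain-tmp (true ∷ b)  = weaken (while-1 refl (push mainˢ true ⨾ push cntˢ true) (drain-tmp b)) (≤-reflexive (cong suc (sym (*-suc 3 (length b)))))

onMain : List Bool → Stacks
onMain m = stacks m ([] , []) []

-- While the `k` trees above are put back, the second copy waits on the counter stack, which is free
-- outside `moveTree`. The detour over the auxiliary stack compensates for the reversal caused by
-- draining.
pick : ℕ → Cmd
pick k = moveTrees toAux k ⨾ moveTree toTmp ⨾ drain tmpˢ (λ x → push mainˢ x ⨾ push cntˢ x)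
       ⨾ drain auxˢ (push mainˢ) ⨾ drain cntˢ (push auxˢ) ⨾ drain auxˢ (push mainˢ)

slide : ℕ → Cmd
slide k = moveTree toAux ⨾ moveTrees discard k ⨾ drain auxˢ (push mainˢ)

sizes-++ : ∀ us vs → sizes (us ++ vs) ≡ sizes us + sizes vs
sizes-++ []       vs = refl
sizes-++ (u ∷ us) vs = trans (cong (size u +_) (sizes-++ us vs)) (sym (+-assoc (size u) (sizes us) (sizes vs)))

pick-run : ∀ us t vs → Run (pick (length us)) (onMain (codes (us ++ t ∷ vs))) (20 * sizes (us ++ t ∷ vs)) (onMain (codes (t ∷ us ++ t ∷ vs)))
pick-run us t vs = subst₂ (λ m m′ → Run (pick (length us)) (onMain m) (20 * sizes (us ++ t ∷ vs)) (onMain m′))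
  (sym (foldr-++ code [] us (t ∷ vs))) result
  (weaken (step₁ ⨾ step₂ ⨾ drain-tmp (rcode t []) ⨾ drain-aux (rcodes us []) ⨾ drain-cnt (rcode t [] ʳ++ []) ⨾ drain-aux ((rcode t [] ʳ++ []) ʳ++ [])) bound)
  where
  M : List Bool
  M = codes vs
  step₁ : Run (moveTrees toAux (length us)) (onMain (foldr code (code t M) us)) (8 * sizes us) (stacks (code t M) (rcodes us [] , []) [])
  step₁ = run-to (receiveds-toAux us [] []) (moveTrees-run toAux us)
  step₂ : Run (moveTree toTmp) (stacks (code t M) (rcodes us [] , []) []) (2 + 6 * size t) (stacks M (rcodes us [] , rcode t []) [])
  step₂ = run-to (received-toTmp t _ []) (moveTree-run toTmp t)
  result : ((rcode t [] ʳ++ []) ʳ++ []) ʳ++ (rcodes us [] ʳ++ (rcode t [] ʳ++ M)) ≡ codes (t ∷ us ++ t ∷ vs)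
  result rewrite rcode-ʳ++-tail t [] | rcode-ʳ++-tail t M | rcodes-ʳ++ us [] (code t M) | foldr-++ code [] us (t ∷ vs) =
    trans (cong (_ʳ++ N) (trans (ʳ++-defn (code t [])) (++-identityʳ (reverse (code t [])))))
      (trans (ʳ++-defn (reverse (code t []))) (trans (cong (_++ N) (reverse-involutive (code t []))) (code-++ t [] N)))
    where
    N : List Bool
    N = foldr code (code t M) us
  bound : 8 * sizes us + (2 + 6 * size t + (1 + 3 * length (rcode t []) + (1 + 2 * length (rcodes us [])
          + (1 + 2 * length (rcode t [] ʳ++ []) + (1 + 2 * length ((rcode t [] ʳ++ []) ʳ++ []))))))
          ≤ 20 * sizes (us ++ t ∷ vs)
  bound rewrite length-ʳ++ (rcode t [] ʳ++ []) {[]} | length-ʳ++ (rcode t []) {[]} | length-rcode t [] | length-rcodes us [] | sizes-++ us (t ∷ vs)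
    = ≤-trans (≤-reflexive (arith (sizes us) (size t)))
       (≤-trans (+-monoʳ-≤ (13 * size t + 10 * sizes us) (*-monoʳ-≤ 6 (size≥1 t)))
         (≤-trans (m≤m+n _ (size t + 10 * sizes us + 20 * sizes vs)) (≤-reflexive (arith′ (sizes us) (size t) (sizes vs)))))
    where
    arith : ∀ u t → 8 * u + (2 + 6 * t + (1 + 3 * (t + 0) + (1 + 2 * (u + 0) + (1 + 2 * (t + 0 + 0) + (1 + 2 * (t + 0 + 0 + 0)))))) ≡ 13 * t + 10 * u + 6
    arith = solve-∀
    arith′ : ∀ u t v → 13 * t + 10 * u + 6 * t + (t + 10 * u + 20 * v) ≡ 20 * (u + (t + v))
    arith′ = solve-∀

slide-run : ∀ t us vs → Run (slide (length us)) (onMain (codes (t ∷ us ++ vs))) (20 * sizes (t ∷ us ++ vs)) (onMain (codes (t ∷ vs)))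
slide-run t us vs = subst₂ (λ m m′ → Run (slide (length us)) (onMain m) (20 * sizes (t ∷ us ++ vs)) (onMain m′))
  (cong (code t) (sym (foldr-++ code [] us vs))) (rcode-ʳ++-tail t (codes vs))
  (weaken (step₁ ⨾ step₂ ⨾ drain-aux (rcode t [])) bound)
  where
  step₁ : Run (moveTree toAux) (onMain (code t (foldr code (codes vs) us))) (2 + 6 * size t) (stacks (foldr code (codes vs) us) (rcode t [] , []) [])
  step₁ = run-to (received-toAux t [] []) (moveTree-run toAux t)
  step₂ : Run (moveTrees discard (length us)) (stacks (foldr code (codes vs) us) (rcode t [] , []) []) (8 * sizes us) (stacks (codes vs) (rcode t [] , []) [])
  step₂ = run-to (receiveds-discard us _) (moveTrees-run discard us)
  bound : 2 + 6 * size t + (8 * sizes us + (1 + 2 * length (rcode t []))) ≤ 20 * sizes (t ∷ us ++ vs)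
  bound rewrite length-rcode t [] | sizes-++ us vs =
    ≤-trans (≤-reflexive (arith (sizes us) (size t)))
       (≤-trans (+-monoʳ-≤ (8 * size t + 8 * sizes us) (*-monoʳ-≤ 3 (size≥1 t)))
         (≤-trans (m≤m+n _ (9 * size t + 12 * sizes us + 20 * sizes vs)) (≤-reflexive (arith′ (sizes us) (size t) (sizes vs)))))
    where
    arith : ∀ u t → 2 + 6 * t + (8 * u + (1 + 2 * (t + 0))) ≡ 8 * t + 8 * u + 3
    arith = solve-∀
    arith′ : ∀ u t v → 8 * t + 8 * u + 3 * t + (9 * t + 12 * u + 20 * v) ≡ 20 * (t + (u + v))
    arith′ = solve-∀

-- A language of folds

infixr 6 _⊗_
data Ty : Set where
  𝟙 𝔹 : Ty
  _⊗_ : Ty → Ty → Ty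
  𝕃   : Ty → Ty

⟦_⟧ : Ty → Set
⟦ 𝟙 ⟧     = ⊤
⟦ 𝔹 ⟧     = Bool
⟦ σ ⊗ τ ⟧ = ⟦ σ ⟧ × ⟦ τ ⟧
⟦ 𝕃 τ ⟧   = List ⟦ τ ⟧

listTree : List Tree → Tree
listTree = foldr node leaf

-- `false` and the empty list are leaves, whereas `true`, pairs and non-empty lists are nodes.
-- Popping one bit thus decides every case distinction and leaves the components as the next trees
-- on the stack.
tree : ∀ τ → ⟦ τ ⟧ → Tree
tree 𝟙       _       = leaf
tree 𝔹       false   = leaf
tree 𝔹       true    = node leaf leaf
tree (σ ⊗ τ) (a , b) = node (tree σ a) (tree τ b)
tree (𝕃 τ)   xs      = listTree (map (tree τ) xs)

sz : ∀ τ → ⟦ τ ⟧ → ℕ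
sz τ a = size (tree τ a)

infixr 5 _∷_
data Env : List Ty → Set where
  []  : Env []
  _∷_ : ∀ {σ Γ} → ⟦ σ ⟧ → Env Γ → Env (σ ∷ Γ)

data Var : List Ty → Ty → Set where
  zᵛ : ∀ {σ Γ} → Var (σ ∷ Γ) σ
  sᵛ : ∀ {σ τ Γ} → Var Γ τ → Var (σ ∷ Γ) τ

get : ∀ {Γ τ} → Env Γ → Var Γ τ → ⟦ τ ⟧
get (a ∷ ρ) zᵛ     = a
get (a ∷ ρ) (sᵛ x) = get ρ x

-- In split, caseL and fold the last argument binds two variables: the components, the
-- head and the tail, and the element and the value of the fold on the remaining list.
mutual
  data Exp (Γ : List Ty) : Ty → Set where
    var   : ∀ {τ} → Var Γ τ → Exp Γ τ
    unit  : Exp Γ 𝟙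
    bit   : Bool → Exp Γ 𝔹
    cond  : ∀ {τ} → Exp Γ 𝔹 → Exp Γ τ → Exp Γ τ → Exp Γ τ
    pair  : ∀ {σ τ} → Exp Γ σ → Exp Γ τ → Exp Γ (σ ⊗ τ)
    split : ∀ {σ₁ σ₂ τ} → Exp Γ (σ₁ ⊗ σ₂) → Exp (σ₁ ∷ σ₂ ∷ Γ) τ → Exp Γ τ
    nil   : ∀ {τ} → Exp Γ (𝕃 τ)
    cons  : ∀ {τ} → Exp Γ τ → Exp Γ (𝕃 τ) → Exp Γ (𝕃 τ)
    caseL : ∀ {σ τ} → Exp Γ (𝕃 σ) → Exp Γ τ → Exp (σ ∷ 𝕃 σ ∷ Γ) τ → Exp Γ τ
    rev   : ∀ {τ} → Exp Γ (𝕃 τ) → Exp Γ (𝕃 τ)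
    fold  : ∀ {σ τ} → Exp Γ (𝕃 σ) → Exp Γ τ → Exp (σ ∷ τ ∷ Γ) τ → Exp Γ τ
    letE  : ∀ {σ τ} → Exp Γ σ → Exp (σ ∷ Γ) τ → Exp Γ τ
    call  : ∀ {Δ τ} → Exp Δ τ → Args Γ Δ → Exp Γ τ

  data Args (Γ : List Ty) : List Ty → Set where
    []  : Args Γ []
    _∷_ : ∀ {σ Δ} → Exp Γ σ → Args Γ Δ → Args Γ (σ ∷ Δ)

caseList : ∀ {a b} {A : Set a} {B : Set b} → List A → B → (A → List A → B) → B
caseList []       n c = n
caseList (x ∷ xs) n c = c x xs

mutual
  eval : ∀ {Γ τ} → Exp Γ τ → Env Γ → ⟦ τ ⟧
  eval (var x)       ρ = get ρ x
  eval unit          ρ = tt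
  eval (bit b)       ρ = b
  eval (cond e a b)  ρ = if eval e ρ then eval a ρ else eval b ρ
  eval (pair a b)    ρ = eval a ρ , eval b ρ
  eval (split e b)   ρ = eval b (proj₁ (eval e ρ) ∷ proj₂ (eval e ρ) ∷ ρ)
  eval nil           ρ = []
  eval (cons a b)    ρ = eval a ρ ∷ eval b ρ
  eval (caseL e a b) ρ = caseList (eval e ρ) (eval a ρ) (λ x xs → eval b (x ∷ xs ∷ ρ))
  eval (rev e)       ρ = reverse (eval e ρ)
  eval (fold l i b)  ρ = foldr (λ x acc → eval b (x ∷ acc ∷ ρ)) (eval i ρ) (eval l ρ)
  eval (letE e b)    ρ = eval b (eval e ρ ∷ ρ)
  eval (call f as)   ρ = eval f (evals as ρ)

  evals : ∀ {Γ Δ} → Args Γ Δ → Env Γ → Env Δ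
  evals []       ρ = []
  evals (a ∷ as) ρ = eval a ρ ∷ evals as ρ

mutual
  -- All values accumulated by the folds met in the evaluation have size at most N.
  Fits : ∀ {Γ τ} → ℕ → Exp Γ τ → Env Γ → Set
  Fits N (cond e a b)  ρ = Fits N e ρ × Fits N a ρ × Fits N b ρ
  Fits N (pair a b)    ρ = Fits N a ρ × Fits N b ρ
  Fits N (split e b)   ρ = Fits N e ρ × Fits N b (proj₁ (eval e ρ) ∷ proj₂ (eval e ρ) ∷ ρ)
  Fits N (cons a b)    ρ = Fits N a ρ × Fits N b ρ
  Fits N (caseL e a b) ρ = Fits N e ρ × Fits N a ρ × caseList (eval e ρ) ⊤ (λ x xs → Fits N b (x ∷ xs ∷ ρ))
  Fits N (rev e)       ρ = Fits N e ρ
  Fits N (fold l i b)  ρ = Fits N l ρ × Fits N i ρ × FitsFold N b ρ (eval i ρ) (eval l ρ)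
  Fits N (letE e b)    ρ = Fits N e ρ × Fits N b (eval e ρ ∷ ρ)
  Fits N (call f as)   ρ = FitsArgs N as ρ × Fits N f (evals as ρ)
  Fits N _             ρ = ⊤

  FitsArgs : ∀ {Γ Δ} → ℕ → Args Γ Δ → Env Γ → Set
  FitsArgs N []       ρ = ⊤
  FitsArgs N (a ∷ as) ρ = Fits N a ρ × FitsArgs N as ρ

  -- The accumulators bounded here are those from which a round starts, one for each proper suffix
  -- of the list; the cost of a round depends on these.
  FitsFold : ∀ {Γ σ τ} → ℕ → Exp (σ ∷ τ ∷ Γ) τ → Env Γ → ⟦ τ ⟧ → List ⟦ σ ⟧ → Set
  FitsFold {τ = τ} N b ρ i []       = ⊤
  FitsFold {τ = τ} N b ρ i (x ∷ xs) =
    let acc = foldr (λ x acc → eval b (x ∷ acc ∷ ρ)) i xs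
    in sz τ acc ≤ N × Fits N b (x ∷ acc ∷ ρ) × FitsFold N b ρ i xs

-- Compilation of expressions into stack programs

data At : List Tree → ℕ → Tree → Set where
  here  : ∀ {t ts} → At (t ∷ ts) 0 t
  there : ∀ {u t ts k} → At ts k t → At (u ∷ ts) (suc k) t

at-split : ∀ {ts k t} → At ts k t → Σ (List Tree) λ us → Σ (List Tree) λ vs → ts ≡ us ++ t ∷ vs × length us ≡ k
at-split {t ∷ ts} here = [] , ts , refl , refl
at-split {u ∷ ts} (there a) = let us , vs , eq , len = at-split a in u ∷ us , vs , cong (u ∷_) eq , cong suc len

onTrees : List Tree → Stacks
onTrees ts = onMain (codes ts)

pick-at : ∀ {ts k t} → At ts k t → Run (pick k) (onTrees ts) (20 * sizes ts) (onTrees (t ∷ ts))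
pick-at a with at-split a
... | us , vs , refl , refl = pick-run us _ vs

Layout : List Ty → Set
Layout Γ = ∀ {σ} → Var Γ σ → ℕ

shift : ∀ {Γ} → ℕ → Layout Γ → Layout Γ
shift k lay x = k + lay x

ext : ∀ {Γ σ} → Layout Γ → Layout (σ ∷ Γ)
ext lay zᵛ     = 0
ext lay (sᵛ x) = suc (lay x)

position : ∀ {Γ} → Layout Γ
position zᵛ     = 0
position (sᵛ x) = suc (position x)

-- In the loop below the tail of the list lies between the element and the accumulator.
loopLayout : ∀ {Γ σ τ} → Layout Γ → Layout (σ ∷ τ ∷ Γ)
loopLayout lay zᵛ         = 0
loopLayout lay (sᵛ zᵛ)     = 2
loopLayout lay (sᵛ (sᵛ x)) = 3 + lay x

-- The test of `while` pops the first bit of the list and so exposes head and tail. After `c` has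
-- computed the new accumulator, it is joined with a copy of the tail into a single tree, because
-- `slide` saves only one tree from above the discarded ones; the final `branch` takes the two apart
-- again.
listLoop : Cmd → Cmd
listLoop c = while mainˢ false nop (c ⨾ pick 2 ⨾ push mainˢ true ⨾ slide 3 ⨾ branch mainˢ nop nop nop)

consLoop : Cmd
consLoop = pick 2 ⨾ pick 1 ⨾ push mainˢ true

mutual
  comp : ∀ {Γ τ} → Exp Γ τ → Layout Γ → Cmd
  comp (var x)       lay = pick (lay x)
  comp unit          lay = push mainˢ false
  comp (bit false)   lay = push mainˢ false
  comp (bit true)    lay = push mainˢ false ⨾ push mainˢ false ⨾ push mainˢ true
  -- Popping the first bit of `true` leaves its two leaves on the stack. They shift the layout for
  -- `a` and are removed afterwards.
  comp (cond e a b)  lay = comp e lay ⨾ branch mainˢ nop (comp b lay) (comp a (shift 2 lay) ⨾ slide 2)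
  comp (pair a b)    lay = comp b lay ⨾ comp a (shift 1 lay) ⨾ push mainˢ true
  comp (split e b)   lay = comp e lay ⨾ branch mainˢ nop nop (comp b (ext (ext lay)) ⨾ slide 2)
  comp nil           lay = push mainˢ false
  comp (cons a b)    lay = comp b lay ⨾ comp a (shift 1 lay) ⨾ push mainˢ true
  comp (caseL e a b) lay = comp e lay ⨾ branch mainˢ nop (comp a lay) (comp b (ext (ext lay)) ⨾ slide 2)
  comp (rev e)       lay = push mainˢ false ⨾ comp e (shift 1 lay) ⨾ listLoop consLoop
  -- `foldr` needs the last element first, but `listLoop` takes elements from the front. So the list
  -- is reversed by a first loop.
  comp (fold l i b)  lay = comp i lay ⨾ (push mainˢ false ⨾ comp l (shift 1 (shift 1 lay)) ⨾ listLoop consLoop)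
                           ⨾ listLoop (comp b (loopLayout lay))
  comp (letE e b)    lay = comp e lay ⨾ comp b (ext lay) ⨾ slide 1
  comp (call {Δ} f as) lay = comps as lay ⨾ comp f position ⨾ slide (length Δ)

  comps : ∀ {Γ Δ} → Args Γ Δ → Layout Γ → Cmd
  comps []                 lay = nop
  comps (_∷_ {Δ = Δ} a as) lay = comps as lay ⨾ comp a (shift (length Δ) lay)

-- Polynomial bounds and the time of compiled expressions

infixl 6 _⊕_
infixl 7 _⊙_
infixr 8 _∘ᵖ_

-- Without subtraction every polynomial is monotone. Composition is a constructor because a command
-- runs on a stack whose size is itself bounded by a polynomial.
data Poly : Set where
  X   : Poly
  K   : ℕ → Poly
  _⊕_ _⊙_ _∘ᵖ_ : Poly → Poly → Poly

⟪_⟫ : Poly → ℕ → ℕ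
⟪ X ⟫      x = x
⟪ K k ⟫    x = k
⟪ p ⊕ q ⟫  x = ⟪ p ⟫ x + ⟪ q ⟫ x
⟪ p ⊙ q ⟫  x = ⟪ p ⟫ x * ⟪ q ⟫ x
⟪ p ∘ᵖ q ⟫ x = ⟪ p ⟫ (⟪ q ⟫ x)

poly-mono : ∀ p {x y} → x ≤ y → ⟪ p ⟫ x ≤ ⟪ p ⟫ y
poly-mono X        le = le
poly-mono (K k)    le = ≤-refl
poly-mono (p ⊕ q)  le = +-mono-≤ (poly-mono p le) (poly-mono q le)
poly-mono (p ⊙ q)  le = *-mono-≤ (poly-mono p le) (poly-mono q le)
poly-mono (p ∘ᵖ q) le = poly-mono p (poly-mono q le)

-- Not the degree proper but an exponent that also absorbs coefficients for arguments from 2 on: a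
-- constant k is at most `x ^ k`, the `suc` of a sum pays for the factor 2, and the `suc` of a
-- composition keeps the inner bound at least 2.
degree : Poly → ℕ
degree X        = 1
degree (K k)    = k
degree (p ⊕ q)  = suc (degree p + degree q)
degree (p ⊙ q)  = degree p + degree q
degree (p ∘ᵖ q) = suc (degree q) * degree p

n≤x^n : ∀ n {x} → 2 ≤ x → n ≤ x ^ n
n≤x^n n {x} 2≤x = ≤-trans (n≤2^n n) (^-monoˡ-≤ n 2≤x)
  where
  n≤2^n : ∀ n → n ≤ 2 ^ n
  n≤2^n zero    = z≤n
  n≤2^n (suc n) = +-mono-≤ (m^n>0 2 n) (≤-trans (n≤2^n n) (m≤m+n _ 0))

poly-bound : ∀ p {x} → 2 ≤ x → ⟪ p ⟫ x ≤ x ^ degree p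
poly-bound X {x} 2≤x = ≤-reflexive (sym (*-identityʳ x))
poly-bound (K k) 2≤x = n≤x^n k 2≤x
poly-bound (p ⊕ q) {x} 2≤x = begin
  ⟪ p ⟫ x + ⟪ q ⟫ x           ≤⟨ +-mono-≤ (poly-bound p 2≤x) (poly-bound q 2≤x) ⟩
  x ^ degree p + x ^ degree q ≤⟨ +-mono-≤ (^-monoʳ-≤ x ⦃ nz ⦄ (m≤m+n (degree p) (degree q))) (^-monoʳ-≤ x ⦃ nz ⦄ (m≤n+m (degree q) (degree p))) ⟩
  y + y                       ≡⟨ cong (y +_) (sym (+-identityʳ y)) ⟩
  2 * y                       ≤⟨ *-monoˡ-≤ y 2≤x ⟩
  x * y                       ∎
  where
  open ≤-Reasoning
  y = x ^ (degree p + degree q)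
  nz = ℕ.>-nonZero (≤-trans (s≤s z≤n) 2≤x)
poly-bound (p ⊙ q) {x} 2≤x = ≤-trans (*-mono-≤ (poly-bound p 2≤x) (poly-bound q 2≤x))
  (≤-reflexive (sym (^-distribˡ-+-* x (degree p) (degree q))))
poly-bound (p ∘ᵖ q) {x} 2≤x = ≤-trans (poly-mono p (≤-trans (poly-bound q 2≤x) (m≤n*m _ x ⦃ nz ⦄)))
  (≤-trans (poly-bound p (≤-trans 2≤x (m≤m*n x _ ⦃ ℕ.>-nonZero (m^n>0 x ⦃ nz ⦄ (degree q)) ⦄)))
    (≤-reflexive (^-*-assoc x (suc (degree q)) (degree p))))
  where
  nz = ℕ.>-nonZero (≤-trans (s≤s z≤n) 2≤x)

run-sizes : ∀ {c t ts ts′} → Run c (onTrees ts) t (onTrees ts′) → sizes ts′ ≤ t + sizes ts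
run-sizes {t = t} {ts} {ts′} ρ = subst₂ (λ a b → a ≤ t + b) (height-onTrees ts′) (height-onTrees ts) (run-height ρ)
  where
  height-onTrees : ∀ ts → height (onTrees ts) ≡ sizes ts
  height-onTrees ts = trans (+-identityʳ _) (length-codes ts)

-- `P` is to depend on the program only. Everything about the particular data is condensed into `x`,
-- which dominates the bound `N` on accumulators and the current stack.
record Does (N : ℕ) (c : Cmd) (P : Poly) (ts ts′ : List Tree) : Set where
  constructor does
  field run : ∀ x → N ≤ x → sizes ts ≤ x → Run c (onTrees ts) (⟪ P ⟫ x) (onTrees ts′)

open Does

-- The second command finds a stack that has grown by at most the time of the first; hence the
-- argument `P ⊕ X`.
_⨾ᵖ_ : Poly → Poly → Poly
P ⨾ᵖ Q = P ⊕ Q ∘ᵖ (P ⊕ X)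

infixr 5 _⨾ᵖ_ _⨾ᵈ_

_⨾ᵈ_ : ∀ {N c c′ P Q ts ts′ ts″} → Does N c P ts ts′ → Does N c′ Q ts′ ts″ → Does N (c ⨾ c′) (P ⨾ᵖ Q) ts ts″
_⨾ᵈ_ {P = P} {ts = ts} {ts′} D D′ = does λ x N≤x ts≤x → run D x N≤x ts≤x ⨾
  run D′ (⟪ P ⟫ x + x) (≤-trans N≤x (m≤n+m x _))
     (≤-trans (run-sizes {ts = ts} {ts′} (run D x N≤x ts≤x)) (+-monoʳ-≤ (⟪ P ⟫ x) ts≤x))

nopᵈ : ∀ {N ts} → Does N nop (K 0) ts ts
nopᵈ = does λ x _ _ → nop

leafᵈ : ∀ {N ts} → Does N (push mainˢ false) (K 1) ts (leaf ∷ ts)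
leafᵈ = does λ x _ _ → push mainˢ false

nodeᵈ : ∀ {N a b ts} → Does N (push mainˢ true) (K 1) (a ∷ b ∷ ts) (node a b ∷ ts)
nodeᵈ = does λ x _ _ → push mainˢ true

moveᵖ : Poly
moveᵖ = K 20 ⊙ X

pickᵈ : ∀ {N ts k t} → At ts k t → Does N (pick k) moveᵖ ts (t ∷ ts)
pickᵈ a = does λ x _ le → weaken (pick-at a) (*-monoʳ-≤ 20 le)

slideᵈ : ∀ {N k t} us {vs} → length us ≡ k → Does N (slide k) moveᵖ (t ∷ us ++ vs) (t ∷ vs)
slideᵈ us refl = does λ x _ le → weaken (slide-run _ us _) (*-monoʳ-≤ 20 le)

resultᵈ : ∀ {N c P ts t t′ us} → t ≡ t′ → Does N c P ts (t ∷ us) → Does N c P ts (t′ ∷ us)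
resultᵈ refl D = D

branch-leafᵈ : ∀ {N c c₀ c₁ P ts ts′} → Does N c₀ P ts ts′ → Does N (branch mainˢ c c₀ c₁) (K 1 ⊕ P) (leaf ∷ ts) ts′
branch-leafᵈ D = does λ x N≤x le → branch-0 refl (run D x N≤x (≤-trans (n≤1+n _) le))

branch-nodeᵈ : ∀ {N c c₀ c₁ P a b ts ts′} → Does N c₁ P (a ∷ b ∷ ts) ts′ →
               Does N (branch mainˢ c c₀ c₁) (K 1 ⊕ P) (node a b ∷ ts) ts′
branch-nodeᵈ {a = a} {b} {ts} D = does λ x N≤x le → branch-1 refl
  (run D x N≤x (≤-trans (≤-reflexive (sym (+-assoc (size a) (size b) (sizes ts)))) (≤-trans (n≤1+n _) le)))

leftᵈ : ∀ {N c P Q ts ts′} → Does N c P ts ts′ → Does N c (P ⊕ Q) ts ts′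
leftᵈ D = does λ x N≤x le → weaken (run D x N≤x le) (m≤m+n _ _)

rightᵈ : ∀ {N c P Q ts ts′} → Does N c Q ts ts′ → Does N c (P ⊕ Q) ts ts′
rightᵈ D = does λ x N≤x le → weaken (run D x N≤x le) (m≤n+m _ _)

iterᵖ : Poly → Poly
iterᵖ P = P ⨾ᵖ moveᵖ ⨾ᵖ K 1 ⨾ᵖ moveᵖ ⨾ᵖ (K 1 ⊕ K 0)

-- In a fold, a round starts from a suffix of the list and its context, at most `x` in size, and an
-- accumulator, at most `N` and hence at most `x`; this explains `X ⊕ X`. The factor `X` bounds the
-- number of rounds by the size of the list.
loopᵖ : Poly → Poly
loopᵖ P = K 1 ⊕ X ⊙ (K 1 ⊕ iterᵖ P ∘ᵖ (X ⊕ X))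

data Iter (N y : ℕ) (c : Cmd) (P : Poly) (ts : List Tree) : List Tree → Tree → Tree → Set where
  []   : ∀ {a} → Iter N y c P ts [] a a
  step : ∀ {v vs a a′ a″} → Does N c P (v ∷ listTree vs ∷ a ∷ ts) (a′ ∷ v ∷ listTree vs ∷ a ∷ ts) →
         sizes (v ∷ listTree vs ∷ a ∷ ts) ≤ y → Iter N y c P ts vs a′ a″ → Iter N y c P ts (v ∷ vs) a a″

length≤size : ∀ vs → length vs ≤ size (listTree vs)
length≤size []       = z≤n
length≤size (v ∷ vs) = s≤s (≤-trans (length≤size vs) (m≤n+m _ (size v)))

iter-run : ∀ {N y c P ts vs a a′} → N ≤ y → Iter N y c P ts vs a a′ →
           Run (listLoop c) (onTrees (listTree vs ∷ a ∷ ts)) (1 + length vs * (1 + ⟪ iterᵖ P ⟫ y)) (onTrees (a′ ∷ ts))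
iter-run N≤y [] = while-end refl
iter-run {N} {y} {c} {P} {ts} N≤y (step {v} {vs} {a} {a′} D le it) =
  weaken (while-1 refl (run pass y N≤y le) (iter-run N≤y it))
    (≤-reflexive (arith (⟪ iterᵖ P ⟫ y) (length vs * (1 + ⟪ iterᵖ P ⟫ y))))
  where
  pass : Does N _ (iterᵖ P) (v ∷ listTree vs ∷ a ∷ ts) (listTree vs ∷ a′ ∷ ts)
  pass = D ⨾ᵈ pickᵈ (there (there here)) ⨾ᵈ nodeᵈ ⨾ᵈ slideᵈ (v ∷ listTree vs ∷ a ∷ []) refl ⨾ᵈ branch-nodeᵈ nopᵈ
  arith : ∀ i r → 1 + i + (1 + r) ≡ 1 + (1 + i + r)
  arith = solve-∀

iterᵈ : ∀ {N c P ts vs a a′} → (∀ x → N ≤ x → sizes (listTree vs ∷ a ∷ ts) ≤ x → Iter N (x + x) c P ts vs a a′) →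
        Does N (listLoop c) (loopᵖ P) (listTree vs ∷ a ∷ ts) (a′ ∷ ts)
iterᵈ {P = P} {vs = vs} it = does λ x N≤x le → weaken (iter-run (≤-trans N≤x (m≤m+n x x)) (it x N≤x le))
  (s≤s (*-monoˡ-≤ (1 + ⟪ iterᵖ P ⟫ (x + x)) (≤-trans (length≤size vs) (≤-trans (m≤m+n _ _) le))))

consᵖ : Poly
consᵖ = moveᵖ ⨾ᵖ moveᵖ ⨾ᵖ K 1

consLoopᵈ : ∀ {N v l a ts} → Does N consLoop consᵖ (v ∷ l ∷ a ∷ ts) (node v a ∷ v ∷ l ∷ a ∷ ts)
consLoopᵈ = pickᵈ (there (there here)) ⨾ᵈ pickᵈ (there here) ⨾ᵈ nodeᵈ

cons-iter : ∀ {N y ts} vs us → sizes (listTree vs ∷ listTree us ∷ ts) ≤ y →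
            Iter N y consLoop consᵖ ts vs (listTree us) (listTree (vs ʳ++ us))
cons-iter []       us le = []
cons-iter {ts = ts} (v ∷ vs) us le =
  step consLoopᵈ (≤-trans (≤-trans (n≤1+n _) (≤-reflexive (arith (size v) (size (listTree vs)) _))) le)
    (cons-iter vs (v ∷ us) (≤-trans (≤-reflexive (arith′ (size v) (size (listTree vs)) (size (listTree us)) (sizes ts))) le))
  where
  arith : ∀ v l r → 1 + (v + (l + r)) ≡ 1 + (v + l) + r
  arith = solve-∀
  arith′ : ∀ v l u r → l + (1 + (v + u) + r) ≡ 1 + (v + l) + (u + r)
  arith′ = solve-∀

reverseᵈ : ∀ {N ts} vs → Does N (listLoop consLoop) (loopᵖ consᵖ) (listTree vs ∷ leaf ∷ ts) (listTree (reverse vs) ∷ ts)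
reverseᵈ vs = iterᵈ λ x N≤x le → cons-iter vs [] (≤-trans le (m≤m+n x x))

mutual
  timeᵖ : ∀ {Γ τ} → Exp Γ τ → Poly
  timeᵖ (var x)       = moveᵖ
  timeᵖ unit          = K 1
  timeᵖ (bit false)   = K 1
  timeᵖ (bit true)    = K 1 ⨾ᵖ K 1 ⨾ᵖ K 1
  timeᵖ (cond e a b)  = timeᵖ e ⨾ᵖ ((K 1 ⊕ timeᵖ b) ⊕ (K 1 ⊕ (timeᵖ a ⨾ᵖ moveᵖ)))
  timeᵖ (pair a b)    = timeᵖ b ⨾ᵖ timeᵖ a ⨾ᵖ K 1
  timeᵖ (split e b)   = timeᵖ e ⨾ᵖ (K 1 ⊕ (timeᵖ b ⨾ᵖ moveᵖ))
  timeᵖ nil           = K 1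
  timeᵖ (cons a b)    = timeᵖ b ⨾ᵖ timeᵖ a ⨾ᵖ K 1
  timeᵖ (caseL e a b) = timeᵖ e ⨾ᵖ ((K 1 ⊕ timeᵖ a) ⊕ (K 1 ⊕ (timeᵖ b ⨾ᵖ moveᵖ)))
  timeᵖ (rev e)       = K 1 ⨾ᵖ timeᵖ e ⨾ᵖ loopᵖ consᵖ
  timeᵖ (fold l i b)  = timeᵖ i ⨾ᵖ (K 1 ⨾ᵖ timeᵖ l ⨾ᵖ loopᵖ consᵖ) ⨾ᵖ loopᵖ (timeᵖ b)
  timeᵖ (letE e b)    = timeᵖ e ⨾ᵖ timeᵖ b ⨾ᵖ moveᵖ
  timeᵖ (call f as)   = timesᵖ as ⨾ᵖ timeᵖ f ⨾ᵖ moveᵖ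

  timesᵖ : ∀ {Γ Δ} → Args Γ Δ → Poly
  timesᵖ []       = K 0
  timesᵖ (a ∷ as) = timesᵖ as ⨾ᵖ timeᵖ a

record Agree {Γ} (lay : Layout Γ) (ρ : Env Γ) (ts : List Tree) : Set where
  field placed : ∀ {σ} (x : Var Γ σ) → At ts (lay x) (tree σ (get ρ x))

open Agree

agree-shift : ∀ {Γ} {lay : Layout Γ} {ρ ts} us → Agree lay ρ ts → Agree (shift (length us) lay) ρ (us ++ ts)
agree-shift []       ag = ag
placed (agree-shift (u ∷ us) ag) x = there (placed (agree-shift us ag) x)

agree-ext : ∀ {Γ σ} {lay : Layout Γ} {ρ ts} (a : ⟦ σ ⟧) → Agree lay ρ ts → Agree (ext lay) (a ∷ ρ) (tree σ a ∷ ts)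
placed (agree-ext a ag) zᵛ     = here
placed (agree-ext a ag) (sᵛ x) = there (placed ag x)

agree-loop : ∀ {Γ σ τ} {lay : Layout Γ} {ρ ts l} (a : ⟦ σ ⟧) (b : ⟦ τ ⟧) → Agree lay ρ ts →
             Agree (loopLayout lay) (a ∷ b ∷ ρ) (tree σ a ∷ l ∷ tree τ b ∷ ts)
placed (agree-loop a b ag) zᵛ         = here
placed (agree-loop a b ag) (sᵛ zᵛ)     = there (there here)
placed (agree-loop a b ag) (sᵛ (sᵛ x)) = there (there (there (placed ag x)))

trees : ∀ {Γ} → Env Γ → List Tree
trees []              = []
trees (_∷_ {σ} a ρ) = tree σ a ∷ trees ρ

length-trees : ∀ {Γ} (ρ : Env Γ) → length (trees ρ) ≡ length Γ
length-trees []      = refl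
length-trees (a ∷ ρ) = cong suc (length-trees ρ)

agree-position : ∀ {Γ} (ρ : Env Γ) ts → Agree position ρ (trees ρ ++ ts)
placed (agree-position (a ∷ ρ) ts) zᵛ     = here
placed (agree-position (a ∷ ρ) ts) (sᵛ x) = there (placed (agree-position ρ ts) x)

suffix-size : ∀ {A : Set} (f : A → Tree) xs ws → size (listTree (map f ws)) ≤ size (listTree (map f (xs ʳ++ ws)))
suffix-size f []       ws = ≤-refl
suffix-size f (x ∷ xs) ws = ≤-trans (≤-trans (m≤n+m _ (size (f x))) (n≤1+n _)) (suffix-size f xs (x ∷ ws))

mutual
  compᵈ : ∀ {N Γ τ} (e : Exp Γ τ) {lay : Layout Γ} {ρ ts} → Agree lay ρ ts → Fits N e ρ →
          Does N (comp e lay) (timeᵖ e) ts (tree τ (eval e ρ) ∷ ts)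
  compᵈ (var x)     ag fits = pickᵈ (placed ag x)
  compᵈ unit        ag fits = leafᵈ
  compᵈ (bit false) ag fits = leafᵈ
  compᵈ (bit true)  ag fits = leafᵈ ⨾ᵈ leafᵈ ⨾ᵈ nodeᵈ
  compᵈ (cond e a b) {ρ = ρ} ag (fe , fa , fb) with eval e ρ | compᵈ e ag fe
  ... | true  | D = D ⨾ᵈ rightᵈ (branch-nodeᵈ (compᵈ a (agree-shift (leaf ∷ leaf ∷ []) ag) fa ⨾ᵈ slideᵈ (leaf ∷ leaf ∷ []) refl))
  ... | false | D = D ⨾ᵈ leftᵈ (branch-leafᵈ (compᵈ b ag fb))
  compᵈ (pair {τ = τ} a b) {ρ = ρ} ag (fa , fb) =
    compᵈ b ag fb ⨾ᵈ compᵈ a (agree-shift (tree τ (eval b ρ) ∷ []) ag) fa ⨾ᵈ nodeᵈ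
  compᵈ (split {σ₁} {σ₂} e b) {ρ = ρ} ag (fe , fb) =
    compᵈ e ag fe ⨾ᵈ branch-nodeᵈ
      (compᵈ b (agree-ext {σ = σ₁} (proj₁ (eval e ρ)) (agree-ext {σ = σ₂} (proj₂ (eval e ρ)) ag)) fb
       ⨾ᵈ slideᵈ (tree σ₁ (proj₁ (eval e ρ)) ∷ tree σ₂ (proj₂ (eval e ρ)) ∷ []) refl)
  compᵈ nil          ag fits = leafᵈ
  compᵈ (cons {τ} a b) {ρ = ρ} ag (fa , fb) =
    compᵈ b ag fb ⨾ᵈ compᵈ a (agree-shift (tree (𝕃 τ) (eval b ρ) ∷ []) ag) fa ⨾ᵈ nodeᵈ
  compᵈ (caseL {σ} e a b) {ρ = ρ} ag (fe , fa , fb) with eval e ρ | compᵈ e ag fe | fb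
  ... | []     | D | _   = D ⨾ᵈ leftᵈ (branch-leafᵈ (compᵈ a ag fa))
  ... | x ∷ xs | D | fb′ = D ⨾ᵈ rightᵈ (branch-nodeᵈ
        (compᵈ b (agree-ext {σ = σ} x (agree-ext {σ = 𝕃 σ} xs ag)) fb′ ⨾ᵈ slideᵈ (tree σ x ∷ tree (𝕃 σ) xs ∷ []) refl))
  compᵈ (rev {τ} e) {ρ = ρ} {ts} ag fe = compRevᵈ e ag fe
  compᵈ {N} (fold {σ} {τ} l i b) {lay} {ρ} {ts} ag (fl , fi , fb) =
    compᵈ i ag fi ⨾ᵈ compRevᵈ l (agree-shift (tree τ (eval i ρ) ∷ []) ag) fl ⨾ᵈ iterᵈ iterations
    where
    xs : List ⟦ σ ⟧
    xs = eval l ρ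
    iterations : ∀ x → N ≤ x → sizes (tree (𝕃 σ) (reverse xs) ∷ tree τ (eval i ρ) ∷ ts) ≤ x →
                 Iter N (x + x) (comp b (loopLayout lay)) (timeᵖ b) ts (map (tree σ) (reverse xs)) (tree τ (eval i ρ))
                   (tree τ (eval (fold l i b) ρ))
    iterations x N≤x le = fold-iter b ag (eval i ρ) xs [] bound fb []
      where
      bound : size (tree (𝕃 σ) (reverse xs)) + (N + sizes ts) ≤ x + x
      bound = ≤-trans (≤-reflexive (arith (size (tree (𝕃 σ) (reverse xs))) N (sizes ts)))
        (+-mono-≤ N≤x (≤-trans (+-monoʳ-≤ (size (tree (𝕃 σ) (reverse xs))) (m≤n+m (sizes ts) (size (tree τ (eval i ρ))))) le))
        where
        arith : ∀ a b c → a + (b + c) ≡ b + (a + c)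
        arith = solve-∀
  compᵈ (letE {σ} e b) {ρ = ρ} ag (fe , fb) =
    compᵈ e ag fe ⨾ᵈ compᵈ b (agree-ext {σ = σ} (eval e ρ) ag) fb ⨾ᵈ slideᵈ (tree σ (eval e ρ) ∷ []) refl
  compᵈ (call {Δ} f as) {ρ = ρ} {ts} ag (fas , ff) =
    compsᵈ as ag fas ⨾ᵈ compᵈ f (agree-position (evals as ρ) ts) ff
      ⨾ᵈ slideᵈ (trees (evals as ρ)) (length-trees (evals as ρ))

  compRevᵈ : ∀ {N Γ τ} (e : Exp Γ (𝕃 τ)) {lay : Layout Γ} {ρ ts} → Agree lay ρ ts → Fits N e ρ →
             Does N (push mainˢ false ⨾ comp e (shift 1 lay) ⨾ listLoop consLoop) (K 1 ⨾ᵖ timeᵖ e ⨾ᵖ loopᵖ consᵖ)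
               ts (tree (𝕃 τ) (reverse (eval e ρ)) ∷ ts)
  compRevᵈ {N} {τ = τ} e {ρ = ρ} {ts} ag fe =
    leafᵈ ⨾ᵈ compᵈ e (agree-shift (leaf ∷ []) ag) fe ⨾ᵈ
      resultᵈ (cong listTree (sym (reverse-map (tree τ) (eval e ρ)))) (reverseᵈ (map (tree τ) (eval e ρ)))

  -- The loop runs through the reversed list: it has consumed `xs` and still faces `ws`. Going down
  -- `xs` prepends rounds to those already described, from the last one back to the first.
  fold-iter : ∀ {N Γ σ τ} (b : Exp (σ ∷ τ ∷ Γ) τ) {lay : Layout Γ} {ρ ts y} → Agree lay ρ ts → ∀ i xs ws →
              size (tree (𝕃 σ) (xs ʳ++ ws)) + (N + sizes ts) ≤ y → FitsFold N b ρ i xs → ∀ {r} →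
              Iter N y (comp b (loopLayout lay)) (timeᵖ b) ts (map (tree σ) ws) (tree τ (foldr (λ x acc → eval b (x ∷ acc ∷ ρ)) i xs)) r →
              Iter N y (comp b (loopLayout lay)) (timeᵖ b) ts (map (tree σ) (xs ʳ++ ws)) (tree τ i) r
  fold-iter b ag i [] ws le fits it = it
  fold-iter {N} {σ = σ} {τ} b {ρ = ρ} {ts} ag i (x ∷ xs) ws le (acc≤N , fx , fits) it =
    fold-iter b ag i xs (x ∷ ws) le fits
      (step (compᵈ b (agree-loop {σ = σ} {τ} x acc ag) fx) bound it)
    where
    acc : ⟦ τ ⟧
    acc = foldr (λ x acc → eval b (x ∷ acc ∷ ρ)) i xs
    bound : sizes (tree σ x ∷ tree (𝕃 σ) ws ∷ tree τ acc ∷ ts) ≤ _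
    bound = ≤-trans (≤-reflexive (sym (+-assoc (size (tree σ x)) _ _)))
      (≤-trans (+-mono-≤ (≤-trans (n≤1+n _) (suffix-size (tree σ) xs (x ∷ ws))) (+-monoˡ-≤ (sizes ts) acc≤N)) le)

  compsᵈ : ∀ {N Γ Δ} (as : Args Γ Δ) {lay : Layout Γ} {ρ ts} → Agree lay ρ ts → FitsArgs N as ρ →
           Does N (comps as lay) (timesᵖ as) ts (trees (evals as ρ) ++ ts)
  compsᵈ []       ag fits = nopᵈ
  compsᵈ (_∷_ {Δ = Δ} a as) {lay} {ρ} {ts} ag (fa , fas) = compsᵈ as ag fas ⨾ᵈ compᵈ a ag′ fa
    where
    ag′ : Agree (shift (length Δ) lay) ρ (trees (evals as ρ) ++ ts)
    ag′ = subst (λ k → Agree (shift k lay) ρ (trees (evals as ρ) ++ ts)) (length-trees (evals as ρ)) (agree-shift (trees (evals as ρ)) ag)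

-- From the input tape to the answer

loadBit : Bool → Cmd
loadBit false = push mainˢ false ⨾ push mainˢ true
loadBit true  = push mainˢ false ⨾ push mainˢ false ⨾ push mainˢ true ⨾ push mainˢ true

-- The last input bit is on top of the auxiliary stack, so consing bit by bit yields the list in its
-- original order.
load : Cmd
load = push mainˢ false ⨾ drain auxˢ loadBit

loadLoop-run : ∀ ys zs → Run (drain auxˢ loadBit) (stacks (codes (tree (𝕃 𝔹) zs ∷ [])) (ys , []) []) (1 + 5 * length ys)
               (onTrees (tree (𝕃 𝔹) (ys ʳ++ zs) ∷ []))
loadLoop-run []           zs = while-∅ refl
loadLoop-run (false ∷ ys) zs = weaken
  (while-0 refl (push mainˢ false ⨾ push mainˢ true) (loadLoop-run ys (false ∷ zs)))
  (≤-trans (≤-reflexive (+-comm 3 (1 + 5 * length ys))) (≤-trans (+-monoʳ-≤ (1 + 5 * length ys) (s≤s (s≤s (s≤s z≤n)))) (≤-reflexive (arith (length ys)))))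
  where
  arith : ∀ l → 1 + 5 * l + 5 ≡ 1 + 5 * suc l
  arith = solve-∀
loadLoop-run (true ∷ ys)  zs = weaken
  (while-1 refl (push mainˢ false ⨾ push mainˢ false ⨾ push mainˢ true ⨾ push mainˢ true) (loadLoop-run ys (true ∷ zs)))
  (≤-reflexive (arith (length ys)))
  where
  arith : ∀ l → 1 + (1 + (1 + (1 + 1))) + (1 + 5 * l) ≡ 1 + 5 * suc l
  arith = solve-∀

load-run : ∀ x → Run load (inputStacks x) (2 + 5 * length x) (onTrees (tree (𝕃 𝔹) x ∷ []))
load-run x = subst₂ (λ k y → Run load (inputStacks x) (2 + 5 * k) (onTrees (tree (𝕃 𝔹) y ∷ [])))
  (length-reverse x) (trans (ʳ++-defn (reverse x)) (trans (++-identityʳ _) (reverse-involutive x)))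
  (push mainˢ false ⨾ loadLoop-run (reverse x) [])

size-bits : ∀ x → size (tree (𝕃 𝔹) x) ≤ 1 + 4 * length x
size-bits []      = ≤-refl
size-bits (b ∷ x) = s≤s (≤-trans (+-mono-≤ (bit-size b) (size-bits x)) (≤-reflexive (arith (length x))))
  where
  bit-size : ∀ b → size (tree 𝔹 b) ≤ 3
  bit-size false = s≤s z≤n
  bit-size true  = ≤-refl
  arith : ∀ l → 3 + (1 + 4 * l) ≡ 4 * suc l
  arith = solve-∀

module Decide (main : Exp (𝕃 𝔹 ∷ []) 𝔹) where

  -- Loading empties the auxiliary stack, so the bit pushed onto it for the result `true` is all
  -- that the halting state can find there.
  command : Cmd
  command = load ⨾ comp main position ⨾ branch mainˢ nop nop (push auxˢ true)

  opsᵖ : Poly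
  opsᵖ = (K 2 ⊕ K 5 ⊙ X) ⊕ (timeᵖ main ∘ᵖ (K 1 ⊕ K 4 ⊙ X) ⊕ K 2)

  stepsᵖ : Poly
  stepsᵖ = K 3 ⊕ opsᵖ ⊙ (K 4 ⊕ K 2 ⊙ (opsᵖ ⊕ X))

  open Machine command using (machine; machine-halts)

  decides : ∀ {N T} x → Fits N main (x ∷ []) → ⟪ stepsᵖ ⟫ (N + length x) ≤ T →
            HaltsWithin machine x T (eval main (x ∷ []))
  decides {N} {T} x fits le = finish (eval main (x ∷ [])) refl
    where
    y : ℕ
    y = N + length x
    main-run : Run (comp main position) (onTrees (tree (𝕃 𝔹) x ∷ [])) (⟪ timeᵖ main ⟫ (1 + 4 * y))
               (onTrees (tree 𝔹 (eval main (x ∷ [])) ∷ tree (𝕃 𝔹) x ∷ []))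
    main-run = run (compᵈ main (agree-position (x ∷ []) []) fits) (1 + 4 * y)
      (≤-trans (≤-trans (m≤m+n N (length x)) (m≤n*m y 4)) (n≤1+n _))
      (≤-trans (≤-reflexive (+-identityʳ _)) (≤-trans (size-bits x) (s≤s (*-monoʳ-≤ 4 (m≤n+m (length x) N)))))
    ops-run : ∀ {c st st′} → Run c st 2 st′ →
              onTrees (tree 𝔹 (eval main (x ∷ [])) ∷ tree (𝕃 𝔹) x ∷ []) ≡ st →
              Run (load ⨾ comp main position ⨾ c) (inputStacks x) (⟪ opsᵖ ⟫ y) st′
    ops-run ρ refl = weaken (load-run x ⨾ main-run ⨾ ρ) (+-monoˡ-≤ _ (+-monoʳ-≤ 2 (*-monoʳ-≤ 5 (m≤n+m (length x) N))))
    enough : 3 + simTime (⟪ opsᵖ ⟫ y) (length x) ≤ T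
    enough = ≤-trans (+-monoʳ-≤ 3 (simTime-mono (≤-refl {⟪ opsᵖ ⟫ y}) (m≤n+m (length x) N))) le
    finish : ∀ b → eval main (x ∷ []) ≡ b → HaltsWithin machine x T (eval main (x ∷ []))
    finish false eq = trans (machine-halts {x} (ops-run (weaken (branch-0 refl nop) (s≤s z≤n)) (cong (λ b → onTrees (tree 𝔹 b ∷ tree (𝕃 𝔹) x ∷ [])) eq)) enough) (cong halted (sym eq))
    finish true  eq = trans (machine-halts {x} (ops-run (branch-1 refl (push auxˢ true)) (cong (λ b → onTrees (tree 𝔹 b ∷ tree (𝕃 𝔹) x ∷ [])) eq)) enough) (cong halted (sym eq))

-- The algorithm

ℕᵗ Bits Day : Ty
ℕᵗ   = 𝕃 𝟙
Bits = 𝕃 𝔹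
-- The numbers of a day (last client first, the deadline at the end) and a set of clients.
Day  = 𝕃 Bits ⊗ Bits

#0 : ∀ {a Γ} → Exp (a ∷ Γ) a
#0 = var zᵛ
#1 : ∀ {a b Γ} → Exp (a ∷ b ∷ Γ) b
#1 = var (sᵛ zᵛ)
#2 : ∀ {a b c Γ} → Exp (a ∷ b ∷ c ∷ Γ) c
#2 = var (sᵛ (sᵛ zᵛ))
#3 : ∀ {a b c d Γ} → Exp (a ∷ b ∷ c ∷ d ∷ Γ) d
#3 = var (sᵛ (sᵛ (sᵛ zᵛ)))
#4 : ∀ {a b c d e Γ} → Exp (a ∷ b ∷ c ∷ d ∷ e ∷ Γ) e
#4 = var (sᵛ (sᵛ (sᵛ (sᵛ zᵛ))))
#5 : ∀ {a b c d e f Γ} → Exp (a ∷ b ∷ c ∷ d ∷ e ∷ f ∷ Γ) f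
#5 = var (sᵛ (sᵛ (sᵛ (sᵛ (sᵛ zᵛ)))))
#6 : ∀ {a b c d e f g Γ} → Exp (a ∷ b ∷ c ∷ d ∷ e ∷ f ∷ g ∷ Γ) g
#6 = var (sᵛ (sᵛ (sᵛ (sᵛ (sᵛ (sᵛ zᵛ))))))
#7 : ∀ {a b c d e f g h Γ} → Exp (a ∷ b ∷ c ∷ d ∷ e ∷ f ∷ g ∷ h ∷ Γ) h
#7 = var (sᵛ (sᵛ (sᵛ (sᵛ (sᵛ (sᵛ (sᵛ zᵛ)))))))
#8 : ∀ {a b c d e f g h i Γ} → Exp (a ∷ b ∷ c ∷ d ∷ e ∷ f ∷ g ∷ h ∷ i ∷ Γ) i
#8 = var (sᵛ (sᵛ (sᵛ (sᵛ (sᵛ (sᵛ (sᵛ (sᵛ zᵛ))))))))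

sucᵉ : ∀ {Γ} → Exp Γ ℕᵗ → Exp Γ ℕᵗ
sucᵉ = cons unit

-- The state of the parser holds the second bit of an incomplete pair (if the flag is
-- set) and the items read; the input is read from the right.
ParserState : Ty
ParserState = 𝔹 ⊗ 𝔹 ⊗ 𝕃 Bits

parseData : ∀ {Γ} → Bool → Exp (𝔹 ∷ 𝕃 Bits ∷ Γ) ParserState
parseData x = pair (bit false) (pair (bit false) (caseL #1 nil (cons (cons (bit x) #0) #1)))

-- Read from the right, the pair 01 precedes the digits it terminates, so it opens a new item. The
-- digits are then consed onto this item, which restores their order with the least significant one
-- in front.
parseStep : ∀ {Γ} → Exp (𝔹 ∷ ParserState ∷ Γ) ParserState
parseStep = split #1 (split #1 (cond #2
  (cond #0 (cond #4 (parseData true) (pair (bit false) (pair (bit false) (cons nil #1)))) (parseData false))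
  (pair (bit true) (pair #4 #1))))

parse : Exp (Bits ∷ []) (𝕃 Bits)
parse = split (fold #0 (pair (bit false) (pair (bit false) nil)) parseStep) (split #1 #1)

doubleBody : Exp (𝟙 ∷ ℕᵗ ∷ ℕᵗ ∷ []) ℕᵗ
doubleBody = sucᵉ (sucᵉ #1)

double : Exp (ℕᵗ ∷ []) ℕᵗ
double = fold #0 nil doubleBody

toUnaryBody : Exp (𝔹 ∷ ℕᵗ ∷ Bits ∷ []) ℕᵗ
toUnaryBody = cond #0 (sucᵉ (sucᵉ (call double (#1 ∷ [])))) (sucᵉ (call double (#1 ∷ [])))

toUnary : Exp (Bits ∷ []) ℕᵗ
toUnary = fold #0 nil toUnaryBody

appendBody : ∀ {τ} → Exp (τ ∷ 𝕃 τ ∷ 𝕃 τ ∷ 𝕃 τ ∷ []) (𝕃 τ)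
appendBody = cons #0 #1

append : ∀ {τ} → Exp (𝕃 τ ∷ 𝕃 τ ∷ []) (𝕃 τ)
append = fold #0 #1 appendBody

-- The days form a queue: the front one receives the number and moves to the back. The code lists
-- the deadlines of all days and then, client by client, the times of all days, so each such row is
-- one full turn of the queue. In this way the matrix is transposed.
rotate : Exp (Bits ∷ 𝕃 Day ∷ []) (𝕃 Day)
rotate = caseL #1 nil (call append (#1 ∷ cons (split #0 (pair (cons #4 #0) #1)) nil ∷ []))

emptyDayBody : Exp (𝟙 ∷ 𝕃 Day ∷ ℕᵗ ∷ 𝕃 Bits ∷ []) (𝕃 Day)
emptyDayBody = cons (pair nil nil) #1

rotateBody : Exp (Bits ∷ 𝕃 Day ∷ ℕᵗ ∷ 𝕃 Bits ∷ []) (𝕃 Day)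
rotateBody = call rotate (#0 ∷ #1 ∷ [])

buildDays : Exp (ℕᵗ ∷ 𝕃 Bits ∷ []) (𝕃 Day)
buildDays = fold (rev #1) (fold #0 nil emptyDayBody) rotateBody

consAll : ∀ {τ} → Exp (𝕃 τ ∷ 𝕃 (𝕃 τ) ∷ []) (𝕃 (𝕃 τ))
consAll = fold #0 nil (fold #3 #1 (cons (cons #2 #0) #1))

allLists : ∀ {τ} → Exp (𝕃 τ ∷ ℕᵗ ∷ []) (𝕃 (𝕃 τ))
allLists = fold #1 (cons nil nil) (cons nil (call consAll (#2 ∷ #1 ∷ [])))

blockBound : Exp (ℕᵗ ∷ []) ℕᵗ
blockBound = fold #0 (sucᵉ nil) (fold #1 #1 (call double (call double (#1 ∷ []) ∷ [])))

-- A sequence of moves lists the old and the new set of each move in turn.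
moveSeqs : Exp (ℕᵗ ∷ []) (𝕃 (𝕃 Bits))
moveSeqs = call allLists (call allLists (cons (bit false) (cons (bit true) nil) ∷ #0 ∷ [])
                          ∷ call double (call blockBound (#0 ∷ []) ∷ []) ∷ [])

popHeadsBody : Exp (Bits ∷ (Bits ⊗ 𝕃 Bits) ∷ 𝕃 Bits ∷ []) (Bits ⊗ 𝕃 Bits)
popHeadsBody = split #1 (caseL #2 (pair #0 #1) (pair (cons #0 #2) (cons #1 #3)))

popHeads : Exp (𝕃 Bits ∷ []) (Bits ⊗ 𝕃 Bits)
popHeads = fold #0 (pair nil nil) popHeadsBody

selectBody : Exp (𝔹 ∷ (𝕃 Bits ⊗ 𝕃 Bits) ∷ Bits ∷ 𝕃 Bits ∷ []) (𝕃 Bits ⊗ 𝕃 Bits)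
selectBody = split #1 (caseL #0 (pair nil #1) (pair #1 (cond #4 (cons #0 #3) #3)))

-- The fold works from the right, and reversing the set lets it advance through the numbers from the
-- front in step with the bits.
select : Exp (Bits ∷ 𝕃 Bits ∷ []) (𝕃 Bits)
select = split (fold (rev #0) (pair #1 nil) selectBody) #1

addDigitsBody : Exp (𝔹 ∷ ℕᵗ ∷ Bits ∷ ℕᵗ ∷ []) ℕᵗ
addDigitsBody = cond #0 (sucᵉ (sucᵉ #1)) (sucᵉ #1)

addDigits : Exp (Bits ∷ ℕᵗ ∷ []) ℕᵗ
addDigits = fold #0 #1 addDigitsBody

halfBody : Exp (𝟙 ∷ (𝔹 ⊗ ℕᵗ) ∷ ℕᵗ ∷ []) (𝔹 ⊗ ℕᵗ)
halfBody = split #1 (cond #0 (pair (bit false) (sucᵉ #1)) (pair (bit true) #1))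

half : Exp (ℕᵗ ∷ []) ℕᵗ
half = split (fold #0 (pair (bit false) nil) halfBody) #1

SumState : Ty
SumState = ℕᵗ ⊗ Bits ⊗ 𝕃 Bits

-- One column of the comparison, from the least significant digit on. Instead of subtracting the
-- digit d of the bound, 2 - d is added to the carry, which so remains a natural number; an
-- exhausted bound has the digit 0.
sumStep : Exp (SumState ∷ []) SumState
sumStep = split #0 (split #1 (split (call popHeads (#1 ∷ []))
  (caseL #2
    (pair (call half (call addDigits (#0 ∷ sucᵉ (sucᵉ #4) ∷ []) ∷ [])) (pair nil #1))
    (pair (call half (call addDigits (#2 ∷ cond #0 #6 (sucᵉ #6) ∷ []) ∷ [])) (pair #1 #3)))))

sumBody : Exp (𝔹 ∷ SumState ∷ Bits ∷ 𝕃 Bits ∷ Bits ∷ Bits ∷ 𝕃 Bits ∷ []) SumState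
sumBody = call sumStep (#1 ∷ [])

-- `fuel` counts the columns. It is the encoded input, which is at least as long as any number it
-- contains. The carry starts at 1 to match the `suc` in the invariant `Below`, so at the end a
-- carry of at most 1 means that the set fits.
feasible : Exp (Bits ∷ Bits ∷ 𝕃 Bits ∷ []) 𝔹
feasible = caseL (rev #2) (bit true)
  (split (fold #2 (pair (sucᵉ nil) (pair #0 (call select (#3 ∷ #1 ∷ [])))) sumBody)
    (caseL #0 (bit true) (caseL #1 (bit true) (bit false))))

tailᵉ : Exp (ℕᵗ ∷ []) ℕᵗ
tailᵉ = caseL #0 nil #1

dropOnesBody : Exp (𝔹 ∷ ℕᵗ ∷ Bits ∷ ℕᵗ ∷ []) ℕᵗ
dropOnesBody = cond #0 (call tailᵉ (#1 ∷ [])) #1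

dropOnes : Exp (Bits ∷ ℕᵗ ∷ []) ℕᵗ
dropOnes = fold #0 #1 dropOnesBody

columnBody : Exp (Day ∷ 𝕃 Bits ∷ ℕᵗ ∷ ℕᵗ ∷ 𝕃 Day ∷ []) (𝕃 Bits)
columnBody = cons (split #0 #1) #1

deficitBody : Exp (𝟙 ∷ (𝕃 Bits ⊗ ℕᵗ) ∷ ℕᵗ ∷ ℕᵗ ∷ 𝕃 Day ∷ []) (𝕃 Bits ⊗ ℕᵗ)
deficitBody = split #1 (split (call popHeads (#0 ∷ []))
  (pair #1 (call append (call dropOnes (#0 ∷ #7 ∷ []) ∷ #3 ∷ []))))

deficit : Exp (ℕᵗ ∷ ℕᵗ ∷ 𝕃 Day ∷ []) ℕᵗ
deficit = split (fold #0 (pair (fold #2 nil columnBody) nil) deficitBody) #1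

equalBody : Exp (𝔹 ∷ (Bits ⊗ 𝔹) ∷ Bits ∷ Bits ∷ []) (Bits ⊗ 𝔹)
equalBody = split #1 (caseL #0 (pair nil (bit false))
  (pair #1 (cond #4 (cond #0 #3 (bit false)) (cond #0 (bit false) #3))))

equal : Exp (Bits ∷ Bits ∷ []) 𝔹
equal = split (fold (rev #0) (pair #1 (bit true)) equalBody) (caseL #0 #1 (bit false))

lessBody : Exp (𝟙 ∷ ℕᵗ ∷ ℕᵗ ∷ ℕᵗ ∷ []) ℕᵗ
lessBody = call tailᵉ (#1 ∷ [])

less : Exp (ℕᵗ ∷ ℕᵗ ∷ []) 𝔹
less = caseL (fold #0 #1 lessBody) (bit false) (bit true)

applyStep : Exp (Bits ∷ Day ∷ 𝕃 Bits ⊗ 𝕃 Day ∷ []) (𝕃 Bits ⊗ 𝕃 Day)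
applyStep = split #2 (caseL #0 (pair nil (cons #3 #1)) (caseL #1 (pair #2 (cons #5 #3))
  (split #7 (cond (cond (call equal (#4 ∷ #1 ∷ [])) (call feasible (#8 ∷ #2 ∷ #0 ∷ [])) (bit false))
    (pair #3 (cons (pair #0 #2) #7))
    (pair #6 (cons (pair #0 #1) #7))))))

applyBody : Exp (Day ∷ (𝕃 Bits ⊗ 𝕃 Day) ∷ Bits ∷ 𝕃 Bits ∷ 𝕃 Day ∷ []) (𝕃 Bits ⊗ 𝕃 Day)
applyBody = call applyStep (#2 ∷ #0 ∷ #1 ∷ [])

applyMoves : Exp (Bits ∷ 𝕃 Bits ∷ 𝕃 Day ∷ []) (𝕃 Day)
applyMoves = split (fold #2 (pair #1 nil) applyBody) #1

improveStep : Exp (Bits ∷ ℕᵗ ∷ ℕᵗ ∷ 𝕃 Bits ∷ 𝕃 Day ∷ []) (𝕃 Day)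
improveStep = letE (call applyMoves (#0 ∷ #3 ∷ #4 ∷ []))
  (cond (call less (call deficit (#2 ∷ #3 ∷ #0 ∷ []) ∷ call deficit (#2 ∷ #3 ∷ #5 ∷ []) ∷ [])) #0 #5)

improveBody : Exp (𝕃 Bits ∷ 𝕃 Day ∷ Bits ∷ ℕᵗ ∷ ℕᵗ ∷ 𝕃 (𝕃 Bits) ∷ 𝕃 Day ∷ []) (𝕃 Day)
improveBody = call improveStep (#2 ∷ #3 ∷ #4 ∷ #0 ∷ #1 ∷ [])

improve : Exp (Bits ∷ ℕᵗ ∷ ℕᵗ ∷ 𝕃 (𝕃 Bits) ∷ 𝕃 Day ∷ []) (𝕃 Day)
improve = fold #3 #4 improveBody

searchBody : Exp (𝟙 ∷ 𝕃 Day ∷ Bits ∷ ℕᵗ ∷ ℕᵗ ∷ 𝕃 (𝕃 Bits) ∷ 𝕃 Day ∷ []) (𝕃 Day)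
searchBody = call improve (#2 ∷ #3 ∷ #4 ∷ #5 ∷ #1 ∷ [])

-- The initial deficit, a unary number, doubles as the counter of rounds: if a solution exists, each
-- round lowers a positive deficit.
search : Exp (Bits ∷ ℕᵗ ∷ ℕᵗ ∷ 𝕃 (𝕃 Bits) ∷ 𝕃 Day ∷ []) 𝔹
search = caseL (call deficit (#1 ∷ #2 ∷ fold (call deficit (#1 ∷ #2 ∷ #4 ∷ [])) #4 searchBody ∷ []))
  (bit true) (bit false)

decideESSD : Exp (Bits ∷ []) 𝔹
decideESSD = caseL (call parse (#0 ∷ [])) (bit false) (caseL #1 (bit false) (caseL #1 (bit false)
  (letE (call toUnary (#4 ∷ []))
    (call search (#7 ∷ #0 ∷ call toUnary (#1 ∷ []) ∷ call moveSeqs (#0 ∷ [])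
      ∷ call buildDays (call toUnary (#3 ∷ []) ∷ #2 ∷ []) ∷ [])))))

-- Bijective base 2, least significant digit first: false stands for 1 and true for 2.
digit : Bool → ℕ
digit false = 1
digit true  = 2

value : List Bool → ℕ
value []       = 0
value (b ∷ bs) = digit b + 2 * value bs

flag : Bool → ℕ
flag false = 0
flag true  = 1

bitAt : List Bool → ℕ → ℕ
bitAt []      i       = 0
bitAt (b ∷ S) zero    = flag b
bitAt (b ∷ S) (suc i) = bitAt S i

weight : List Bool → List (List Bool) → ℕ
weight (b ∷ S) (p ∷ ps) = flag b * value p + weight S ps
weight _       _        = 0

total : List (List Bool) → ℕ
total []       = 0
total (p ∷ ps) = value p + total ps

foldr-reverse : ∀ {A B : Set} (f : A → B → B) i xs ys → foldr f i (xs ʳ++ ys) ≡ foldr f (foldr f i ys) (reverse xs)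
foldr-reverse f i xs ys = trans (cong (foldr f i) (ʳ++-defn xs)) (foldr-++ f i (reverse xs) ys)

foldr-reverse-∷ : ∀ {A B : Set} (f : A → B → B) i x xs → foldr f i (reverse (x ∷ xs)) ≡ foldr f (f x i) (reverse xs)
foldr-reverse-∷ f i x xs = foldr-reverse f i xs (x ∷ [])

append-eval : ∀ {τ} (xs ys : List ⟦ τ ⟧) → eval (append {τ}) (xs ∷ ys ∷ []) ≡ xs ++ ys
append-eval []       ys = refl
append-eval {τ} (x ∷ xs) ys = cong (x ∷_) (append-eval {τ} xs ys)

double-length : ∀ xs → length (eval double (xs ∷ [])) ≡ 2 * length xs
double-length []       = refl
double-length (x ∷ xs) = trans (cong (2 +_) (double-length xs)) (sym (*-suc 2 (length xs)))

toUnary-length : ∀ bs → length (eval toUnary (bs ∷ [])) ≡ value bs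
toUnary-length []           = refl
toUnary-length (false ∷ bs) = cong suc (trans (double-length (eval toUnary (bs ∷ []))) (cong (2 *_) (toUnary-length bs)))
toUnary-length (true ∷ bs)  = cong (2 +_) (trans (double-length (eval toUnary (bs ∷ []))) (cong (2 *_) (toUnary-length bs)))

-- Addition and comparison of numbers

addDigits-length : ∀ hs r → length (eval addDigits (hs ∷ r ∷ [])) ≡ foldr (λ b → digit b +_) 0 hs + length r
addDigits-length []           r = refl
addDigits-length (false ∷ hs) r = cong suc (addDigits-length hs r)
addDigits-length (true ∷ hs)  r = cong (2 +_) (addDigits-length hs r)

half-length : ∀ xs → Σ Bool λ odd → flag odd + 2 * length (eval half (xs ∷ [])) ≡ length xs
half-length xs = proj₁ (halves xs) , halved xs
  where
  halves : ∀ xs → Bool × List ⊤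
  halves = foldr (λ _ st → if proj₁ st then (false , tt ∷ proj₂ st) else (true , proj₂ st)) (false , [])
  halved : ∀ xs → flag (proj₁ (halves xs)) + 2 * length (proj₂ (halves xs)) ≡ length xs
  halved []       = refl
  halved (x ∷ xs) with halves xs | halved xs
  ... | false , h | eq = cong suc eq
  ... | true  , h | eq = trans (*-suc 2 (length h)) (cong suc eq)

popHeads-total : ∀ ps → total ps ≡ foldr (λ b → digit b +_) 0 (proj₁ (eval popHeads (ps ∷ []))) + 2 * total (proj₂ (eval popHeads (ps ∷ [])))
popHeads-total []             = refl
popHeads-total ([] ∷ ps)      = popHeads-total ps
popHeads-total ((b ∷ p) ∷ ps) = trans (cong (value (b ∷ p) +_) (popHeads-total ps)) (arith (digit b) (value p) _ _)
  where
  arith : ∀ d v h t → d + 2 * v + (h + 2 * t) ≡ d + h + 2 * (v + t)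
  arith = solve-∀

popHeads-short : ∀ {k} ps → All (λ p → length p ≤ suc k) ps → All (λ p → length p ≤ k) (proj₂ (eval popHeads (ps ∷ [])))
popHeads-short []             []            = []
popHeads-short ([] ∷ ps)      (_ ∷ short)   = popHeads-short ps short
popHeads-short ((b ∷ p) ∷ ps) (s≤s le ∷ short) = le ∷ popHeads-short ps short

-- The invariant of the column-wise comparison, on the carry, the right-hand side and the summands.
Below : ⟦ SumState ⟧ → Set
Below (r , D , ps) = total ps + length r ≤ suc (value D)

≤-+⇔ : ∀ k {x y} → x ≤ y ⇔ (k + x ≤ k + y)
≤-+⇔ k = mk⇔ (+-monoʳ-≤ k) (+-cancelˡ-≤ k _ _)

⇔-trans : ∀ {A B C : Set} → A ⇔ B → B ⇔ C → A ⇔ C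
⇔-trans f g = mk⇔ (Equivalence.to g ∘ Equivalence.to f) (Equivalence.from f ∘ Equivalence.from g)

⇔-sym : ∀ {A B : Set} → A ⇔ B → B ⇔ A
⇔-sym f = mk⇔ (Equivalence.from f) (Equivalence.to f)

≤-cong⇔ : ∀ {x x′ y y′} → x ≡ x′ → y ≡ y′ → x ≤ y ⇔ x′ ≤ y′
≤-cong⇔ refl refl = mk⇔ id id

halve-≤ : ∀ e {x y} → 2 * x + flag e ≤ suc (2 * y) ⇔ x ≤ y
halve-≤ e {x} {y} = mk⇔ (down e) (λ le → ≤-trans (+-mono-≤ (*-monoʳ-≤ 2 le) (flag≤1 e)) (≤-reflexive (+-comm (2 * y) 1)))
  where
  flag≤1 : ∀ e → flag e ≤ 1
  flag≤1 false = z≤n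
  flag≤1 true  = ≤-refl
  down : ∀ e → 2 * x + flag e ≤ suc (2 * y) → x ≤ y
  down e le = ≮⇒≥ λ y<x → <-irrefl refl (≤-trans (≤-trans (≤-reflexive (sym (*-suc 2 y))) (*-monoʳ-≤ 2 y<x)) (≤-trans (m≤m+n _ _) le))

-- Here `c` is 2 minus the digit of the bound. Adding it makes the right-hand side odd, so the
-- parity that halving discards on the left cannot affect the comparison.
carry-below : ∀ c ps (r r′ : List ⊤) v D′ → length r′ ≡ c + length r → c + suc v ≡ suc (2 * suc (value D′)) →
  total ps + length r ≤ suc v ⇔
  Below (eval half (eval addDigits (proj₁ (eval popHeads (ps ∷ [])) ∷ r′ ∷ []) ∷ []) , D′ , proj₂ (eval popHeads (ps ∷ [])))
carry-below c ps r r′ v D′ len eq = ⇔-trans (≤-+⇔ c {total ps + length r} {suc v})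
  (⇔-trans (≤-cong⇔ sums eq) (halve-≤ odd {total ts + h/2} {suc (value D′)}))
  where
  open ≡-Reasoning
  hs = proj₁ (eval popHeads (ps ∷ []))
  ts = proj₂ (eval popHeads (ps ∷ []))
  H  = foldr (λ b → digit b +_) 0 hs
  sum  = eval addDigits (hs ∷ r′ ∷ [])
  odd  = proj₁ (half-length sum)
  h/2  = length (eval half (sum ∷ []))
  sums : c + (total ps + length r) ≡ 2 * (total ts + h/2) + flag odd
  sums = begin
    c + (total ps + length r)           ≡⟨ cong (λ t → c + (t + length r)) (popHeads-total ps) ⟩
    c + (H + 2 * total ts + length r)   ≡⟨ arith c H (2 * total ts) (length r) ⟩
    2 * total ts + (H + (c + length r)) ≡⟨ cong (λ l → 2 * total ts + (H + l)) len ⟨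
    2 * total ts + (H + length r′)      ≡⟨ cong (2 * total ts +_) (addDigits-length hs r′) ⟨
    2 * total ts + length sum           ≡⟨ cong (2 * total ts +_) (proj₂ (half-length sum)) ⟨
    2 * total ts + (flag odd + 2 * h/2) ≡⟨ arith′ (total ts) (flag odd) h/2 ⟩
    2 * (total ts + h/2) + flag odd     ∎
    where
    arith : ∀ c h t r → c + (h + t + r) ≡ t + (h + (c + r))
    arith = solve-∀
    arith′ : ∀ t f h → 2 * t + (f + 2 * h) ≡ 2 * (t + h) + f
    arith′ = solve-∀

sumStep-below : ∀ r D ps → Below (r , D , ps) ⇔ Below (eval sumStep ((r , D , ps) ∷ []))
sumStep-below r []          ps = carry-below 2 ps r (tt ∷ tt ∷ r) 0 [] refl refl
sumStep-below r (false ∷ D) ps = carry-below 1 ps r (tt ∷ r) (value (false ∷ D)) D refl (cong suc (sym (*-suc 2 (value D))))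
sumStep-below r (true ∷ D)  ps = carry-below 0 ps r r (value (true ∷ D)) D refl (cong suc (sym (*-suc 2 (value D))))

Short : ℕ → ⟦ SumState ⟧ → Set
Short k (r , D , ps) = length D ≤ k × All (λ p → length p ≤ k) ps

sumStep-short : ∀ {k} r D ps → Short (suc k) (r , D , ps) → Short k (eval sumStep ((r , D , ps) ∷ []))
sumStep-short r []      ps (_ , short)      = z≤n , popHeads-short ps short
sumStep-short r (b ∷ D) ps (s≤s le , short) = le , popHeads-short ps short

sumLoop : List Bool → ⟦ SumState ⟧ → ⟦ SumState ⟧
sumLoop fuel st = foldr (λ _ acc → eval sumStep (acc ∷ [])) st fuel

sumLoop-below : ∀ fuel st → Below st ⇔ Below (sumLoop fuel st)
sumLoop-below []         st = mk⇔ id id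
sumLoop-below (x ∷ fuel) st = ⇔-trans (sumLoop-below fuel st) (let r , D , ps = sumLoop fuel st in sumStep-below r D ps)

sumLoop-short : ∀ fuel k st → Short (length fuel + k) st → Short k (sumLoop fuel st)
sumLoop-short []         k st short = short
sumLoop-short (x ∷ fuel) k st short =
  sumStep-short (proj₁ acc) (proj₁ (proj₂ acc)) (proj₂ (proj₂ acc)) (sumLoop-short fuel (suc k) st (subst (λ l → Short l st) (sym (+-suc (length fuel) k)) short))
  where
  acc = sumLoop fuel st

below-end : ∀ st → Short 0 st → Below st ⇔ length (proj₁ st) ≤ 1
below-end (r , [] , ps) (_ , short) = ≤-cong⇔ (cong (_+ length r) (total-empty ps short)) refl
  where
  total-empty : ∀ ps → All (λ p → length p ≤ 0) ps → total ps ≡ 0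
  total-empty []        []         = refl
  total-empty ([] ∷ ps) (_ ∷ short) = total-empty ps short

selectStep : Bool → List (List Bool) × List (List Bool) → List (List Bool) × List (List Bool)
selectStep b (rem , out) = caseList rem ([] , out) (λ p rem′ → rem′ , (if b then p ∷ out else out))

select-total : ∀ S ps → total (eval select (S ∷ ps ∷ [])) ≡ weight S ps
select-total S ps = trans (select-fold S ps []) (+-identityʳ _)
  where
  select-fold : ∀ S ps out → total (proj₂ (foldr selectStep (ps , out) (reverse S))) ≡ weight S ps + total out
  select-fold []      ps       out = refl
  select-fold (b ∷ S) []       out rewrite foldr-reverse-∷ selectStep ([] , out) b S =
    trans (select-fold S [] out) (cong (_+ total out) (weight-[] S))
    where
    weight-[] : ∀ S → weight S [] ≡ 0
    weight-[] []      = refl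
    weight-[] (_ ∷ _) = refl
  select-fold (false ∷ S) (p ∷ ps) out rewrite foldr-reverse-∷ selectStep (p ∷ ps , out) false S = select-fold S ps out
  select-fold (true ∷ S)  (p ∷ ps) out rewrite foldr-reverse-∷ selectStep (p ∷ ps , out) true S =
    trans (select-fold S ps (p ∷ out)) (arith (weight S ps) (value p) (total out))
    where
    arith : ∀ w v t → w + (v + t) ≡ v + 0 + w + t
    arith = solve-∀

select-short : ∀ k S ps → All (λ p → length p ≤ k) ps → All (λ p → length p ≤ k) (eval select (S ∷ ps ∷ []))
select-short k S ps short = select-fold S ps [] short []
  where
  select-fold : ∀ S ps out → All (λ p → length p ≤ k) ps → All (λ p → length p ≤ k) out →
                All (λ p → length p ≤ k) (proj₂ (foldr selectStep (ps , out) (reverse S)))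
  select-fold []      ps       out sh sh′ = sh′
  select-fold (b ∷ S) []       out sh sh′ rewrite foldr-reverse-∷ selectStep ([] , out) b S = select-fold S [] out sh sh′
  select-fold (false ∷ S) (p ∷ ps) out (_ ∷ sh) sh′ rewrite foldr-reverse-∷ selectStep (p ∷ ps , out) false S = select-fold S ps out sh sh′
  select-fold (true ∷ S)  (p ∷ ps) out (le ∷ sh) sh′ rewrite foldr-reverse-∷ selectStep (p ∷ ps , out) true S = select-fold S ps (p ∷ out) sh (le ∷ sh′)

-- A row lists the deadline and the processing times of a day.
FitsDay : List Bool → List (List Bool) → Set
FitsDay S []       = ⊤
FitsDay S (D ∷ ps) = weight S ps ≤ value D

feasible-correct : ∀ fuel S static → All (λ p → length p ≤ length fuel) (reverse static) →
                   eval feasible (fuel ∷ S ∷ static ∷ []) ≡ true ⇔ FitsDay S (reverse static)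
feasible-correct fuel S static short = cases (reverse static) short
  where
  verdict : ∀ (r : List ⊤) → caseList r true (λ _ r′ → caseList r′ true (λ _ _ → false)) ≡ true ⇔ length r ≤ 1
  verdict []          = mk⇔ (λ _ → z≤n) (λ _ → refl)
  verdict (_ ∷ [])    = mk⇔ (λ _ → ≤-refl) (λ _ → refl)
  verdict (_ ∷ _ ∷ r) = mk⇔ (λ ()) (λ { (s≤s ()) })
  cases : ∀ row → All (λ p → length p ≤ length fuel) row →
          caseList row true (λ D ps → caseList (proj₁ (sumLoop fuel (tt ∷ [] , D , eval select (S ∷ ps ∷ [])))) true
            (λ _ r′ → caseList r′ true (λ _ _ → false))) ≡ true ⇔ FitsDay S row
  cases []       sh = mk⇔ (λ _ → tt) (λ _ → refl)
  cases (D ∷ ps) (le ∷ sh) =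
    ⇔-trans (verdict (proj₁ (sumLoop fuel st))) (⇔-trans (⇔-sym (below-end (sumLoop fuel st) (sumLoop-short fuel 0 st short₀)))
      (⇔-trans (⇔-sym (sumLoop-below fuel st)) (⇔-trans (≤-cong⇔ {total (eval select (S ∷ ps ∷ [])) + 1} {suc (weight S ps)} {suc (value D)} (trans (+-comm (total (eval select (S ∷ ps ∷ []))) 1) (cong suc (select-total S ps))) refl) (⇔-sym (≤-+⇔ 1 {weight S ps} {value D})))))
    where
    st : ⟦ SumState ⟧
    st = tt ∷ [] , D , eval select (S ∷ ps ∷ [])
    short₀ : Short (length fuel + 0) st
    short₀ rewrite +-identityʳ (length fuel) = le , select-short (length fuel) S ps sh

-- Deficits

sumTo : ℕ → (ℕ → ℕ) → ℕ
sumTo zero    f = 0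
sumTo (suc j) f = f j + sumTo j f

sumTo-cong : ∀ j {f g} → (∀ i → f i ≡ g i) → sumTo j f ≡ sumTo j g
sumTo-cong zero    eq = refl
sumTo-cong (suc j) eq = cong₂ _+_ (eq j) (sumTo-cong j eq)

colCount : List (List Bool) → ℕ → ℕ
colCount []         i = 0
colCount (S ∷ cols) i = bitAt S i + colCount cols i

DayV : Set
DayV = List (List Bool) × List Bool

countAt : List DayV → ℕ → ℕ
countAt days = colCount (map proj₂ days)

deficitOf : ℕ → ℕ → List DayV → ℕ
deficitOf n k days = sumTo n (λ i → k ∸ countAt days i)

popHeads-tails : ∀ cols i → colCount (proj₂ (eval popHeads (cols ∷ []))) i ≡ colCount cols (suc i)
popHeads-tails []               i = refl
popHeads-tails ([] ∷ cols)      i = popHeads-tails cols i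
popHeads-tails ((b ∷ S) ∷ cols) i = cong (bitAt S i +_) (popHeads-tails cols i)

popHeads-heads : ∀ cols → foldr (λ b → flag b +_) 0 (proj₁ (eval popHeads (cols ∷ []))) ≡ colCount cols 0
popHeads-heads []               = refl
popHeads-heads ([] ∷ cols)      = popHeads-heads cols
popHeads-heads ((b ∷ S) ∷ cols) = cong (flag b +_) (popHeads-heads cols)

tail-length : ∀ xs → length (eval tailᵉ (xs ∷ [])) ≡ length xs ∸ 1
tail-length []       = refl
tail-length (x ∷ xs) = refl

dropOnes-length : ∀ hs k → length (eval dropOnes (hs ∷ k ∷ [])) ≡ length k ∸ foldr (λ b → flag b +_) 0 hs
dropOnes-length []           k = refl
dropOnes-length (false ∷ hs) k = dropOnes-length hs k
dropOnes-length (true ∷ hs)  k = trans (tail-length (eval dropOnes (hs ∷ k ∷ [])))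
  (trans (cong (_∸ 1) (dropOnes-length hs k)) (trans (∸-+-assoc (length k) ones 1) (cong (length k ∸_) (+-comm ones 1))))
  where ones = foldr (λ b → flag b +_) 0 hs

deficitStep : List ⊤ → List (List Bool) × List ⊤ → List (List Bool) × List ⊤
deficitStep k (cols , acc) =
  proj₂ (eval popHeads (cols ∷ [])) ,
  eval append (eval dropOnes (proj₁ (eval popHeads (cols ∷ [])) ∷ k ∷ []) ∷ acc ∷ [])

deficitLoop : List ⊤ → List ⊤ → List (List Bool) → List (List Bool) × List ⊤
deficitLoop n k cols = foldr (λ _ → deficitStep k) (cols , []) n

deficitLoop-cols : ∀ n k cols i → colCount (proj₁ (deficitLoop n k cols)) i ≡ colCount cols (length n + i)
deficitLoop-cols []      k cols i = refl
deficitLoop-cols (_ ∷ n) k cols i = trans (popHeads-tails (proj₁ (deficitLoop n k cols)) i)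
  (trans (deficitLoop-cols n k cols (suc i)) (cong (colCount cols) (+-suc (length n) i)))

deficitLoop-length : ∀ n k cols → length (proj₂ (deficitLoop n k cols)) ≡ sumTo (length n) (λ i → length k ∸ colCount cols i)
deficitLoop-length []      k cols = refl
deficitLoop-length (_ ∷ n) k cols = begin
  length (eval append (eval dropOnes (hs ∷ k ∷ []) ∷ acc ∷ []))
    ≡⟨ cong length (append-eval {𝟙} (eval dropOnes (hs ∷ k ∷ [])) acc) ⟩
  length (eval dropOnes (hs ∷ k ∷ []) ++ acc)
    ≡⟨ length-++ (eval dropOnes (hs ∷ k ∷ [])) ⟩
  length (eval dropOnes (hs ∷ k ∷ [])) + length acc
    ≡⟨ cong₂ _+_ (trans (dropOnes-length hs k) (cong (length k ∸_) heads)) (deficitLoop-length n k cols) ⟩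
  sumTo (suc (length n)) (λ i → length k ∸ colCount cols i) ∎
  where
  open ≡-Reasoning
  rest = proj₁ (deficitLoop n k cols)
  hs   = proj₁ (eval popHeads (rest ∷ []))
  acc  = proj₂ (deficitLoop n k cols)
  heads : foldr (λ b → flag b +_) 0 hs ≡ colCount cols (length n)
  heads = trans (popHeads-heads rest) (trans (deficitLoop-cols n k cols 0) (cong (colCount cols) (+-identityʳ (length n))))

map-fold : ∀ (days : List DayV) → foldr (λ x acc → proj₂ x ∷ acc) [] days ≡ map proj₂ days
map-fold []       = refl
map-fold (x ∷ xs) = cong (proj₂ x ∷_) (map-fold xs)

deficit-length : ∀ n k (days : List DayV) → length (eval deficit (n ∷ k ∷ days ∷ [])) ≡ deficitOf (length n) (length k) days
deficit-length n k days = trans (cong (λ cols → length (proj₂ (deficitLoop n k cols))) (map-fold days))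
  (deficitLoop-length n k (map proj₂ days))

-- Comparisons

equalStep : Bool → List Bool × Bool → List Bool × Bool
equalStep x (rem , ok) = caseList rem ([] , false)
  (λ y rem′ → rem′ , (if x then (if y then ok else false) else (if y then false else ok)))

equalEnd : List Bool × Bool → Bool
equalEnd (rem , ok) = caseList rem ok (λ _ _ → false)

equal-correct : ∀ xs ys → eval equal (xs ∷ ys ∷ []) ≡ true ⇔ xs ≡ ys
equal-correct xs ys = mk⇔ (λ eq → proj₂ (sound xs ys true eq)) (λ { refl → complete xs })
  where
  false-end : ∀ xs ys → equalEnd (foldr equalStep (ys , false) (reverse xs)) ≡ false
  false-end []       []       = refl
  false-end []       (_ ∷ _)  = refl
  false-end (x ∷ xs) [] rewrite foldr-reverse-∷ equalStep ([] , false) x xs = false-end xs []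
  false-end (true ∷ xs)  (true ∷ ys)  rewrite foldr-reverse-∷ equalStep (true ∷ ys , false) true xs = false-end xs ys
  false-end (true ∷ xs)  (false ∷ ys) rewrite foldr-reverse-∷ equalStep (false ∷ ys , false) true xs = false-end xs ys
  false-end (false ∷ xs) (true ∷ ys)  rewrite foldr-reverse-∷ equalStep (true ∷ ys , false) false xs = false-end xs ys
  false-end (false ∷ xs) (false ∷ ys) rewrite foldr-reverse-∷ equalStep (false ∷ ys , false) false xs = false-end xs ys
  absurd : ∀ xs ys → equalEnd (foldr equalStep (ys , false) (reverse xs)) ≡ true → ⊥
  absurd xs ys eq with trans (sym (false-end xs ys)) eq
  ... | ()
  sound : ∀ xs ys ok → equalEnd (foldr equalStep (ys , ok) (reverse xs)) ≡ true → ok ≡ true × xs ≡ ys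
  sound []       []      ok eq = eq , refl
  sound (x ∷ xs) []      ok eq rewrite foldr-reverse-∷ equalStep ([] , ok) x xs = ⊥-elim (absurd xs [] eq)
  sound (true ∷ xs)  (true ∷ ys)  ok eq rewrite foldr-reverse-∷ equalStep (true ∷ ys , ok) true xs =
    let ok′ , eq′ = sound xs ys ok eq in ok′ , cong (true ∷_) eq′
  sound (true ∷ xs)  (false ∷ ys) ok eq rewrite foldr-reverse-∷ equalStep (false ∷ ys , ok) true xs = ⊥-elim (absurd xs ys eq)
  sound (false ∷ xs) (true ∷ ys)  ok eq rewrite foldr-reverse-∷ equalStep (true ∷ ys , ok) false xs = ⊥-elim (absurd xs ys eq)
  sound (false ∷ xs) (false ∷ ys) ok eq rewrite foldr-reverse-∷ equalStep (false ∷ ys , ok) false xs =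
    let ok′ , eq′ = sound xs ys ok eq in ok′ , cong (false ∷_) eq′
  complete : ∀ xs → equalEnd (foldr equalStep (xs , true) (reverse xs)) ≡ true
  complete []           = refl
  complete (true ∷ xs)  rewrite foldr-reverse-∷ equalStep (true ∷ xs , true) true xs = complete xs
  complete (false ∷ xs) rewrite foldr-reverse-∷ equalStep (false ∷ xs , true) false xs = complete xs

less-correct : ∀ xs ys → eval less (xs ∷ ys ∷ []) ≡ true ⇔ length xs < length ys
less-correct xs ys = ⇔-trans (positive (foldr (λ _ acc → eval tailᵉ (acc ∷ [])) ys xs))
  (⇔-trans (≤-cong⇔ {1} refl (dropped xs)) (mk⇔ (m∸n≢0⇒n<m ∘ pos) m<n⇒0<n∸m))
  where
  positive : ∀ (r : List ⊤) → caseList r false (λ _ _ → true) ≡ true ⇔ 1 ≤ length r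
  positive []      = mk⇔ (λ ()) (λ ())
  positive (_ ∷ _) = mk⇔ (λ _ → s≤s z≤n) (λ _ → refl)
  dropped : ∀ xs → length (foldr (λ _ acc → eval tailᵉ (acc ∷ [])) ys xs) ≡ length ys ∸ length xs
  dropped []       = refl
  dropped (x ∷ xs) = trans (tail-length (foldr (λ _ acc → eval tailᵉ (acc ∷ [])) ys xs))
    (trans (cong (_∸ 1) (dropped xs)) (trans (∸-+-assoc (length ys) (length xs) 1) (cong (length ys ∸_) (+-comm (length xs) 1))))
  pos : ∀ {k} → 1 ≤ k → k ≢ 0
  pos (s≤s _) ()

-- Enumeration

module _ {τ : Ty} where
  open import Data.List.Membership.Propositional using (_∈_)
  open import Data.List.Membership.Propositional.Properties using (∈-++⁺ˡ; ∈-++⁺ʳ)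
  open import Data.List.Relation.Unary.Any using (here; there)

  consAll-∋ : ∀ {x : ⟦ τ ⟧} {xs as ls} → x ∈ as → xs ∈ ls → (x ∷ xs) ∈ eval consAll (as ∷ ls ∷ [])
  consAll-∋ {x} {xs} {a ∷ as} {ls} (here refl) xs∈ = inner ls xs∈
    where
    inner : ∀ ls′ {out} → xs ∈ ls′ → (x ∷ xs) ∈ foldr (λ l acc → (x ∷ l) ∷ acc) out ls′
    inner (_ ∷ ls′) (here refl) = here refl
    inner (_ ∷ ls′) (there p)   = there (inner ls′ p)
  consAll-∋ {x} {xs} {a ∷ as} {ls} (there x∈) xs∈ = outer ls (consAll-∋ x∈ xs∈)
    where
    outer : ∀ ls′ {out} → (x ∷ xs) ∈ out → (x ∷ xs) ∈ foldr (λ l acc → (a ∷ l) ∷ acc) out ls′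
    outer []        p = p
    outer (_ ∷ ls′) p = there (outer ls′ p)

  allLists-∋ : ∀ {as} t xs → length xs ≤ length t → All (_∈ as) xs → xs ∈ eval (allLists {τ}) (as ∷ t ∷ [])
  allLists-∋ []      []       le        all       = here refl
  allLists-∋ (_ ∷ t) []       le        all       = here refl
  allLists-∋ (_ ∷ t) (x ∷ xs) (s≤s le) (x∈ ∷ xs∈) = there (consAll-∋ x∈ (allLists-∋ t xs le xs∈))

-- Let b bound the blocks for the first n coordinates. Their sums in the next coordinate lie between
-- -b and b. Narrowing this interval by one unit at most doubles the number of blocks put together,
-- and 2b units give `2 ^ (b + b)`, that is `4 ^ b`, blocks of length at most b.
blockSize : ℕ → ℕ
blockSize zero    = 1
blockSize (suc n) = 4 ^ blockSize n * blockSize n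

blockBound-length : ∀ n → length (eval blockBound (n ∷ [])) ≡ blockSize (length n)
blockBound-length []      = refl
blockBound-length (_ ∷ n) = trans (quadruple b) (cong (λ l → 4 ^ l * l) (blockBound-length n))
  where
  b = eval blockBound (n ∷ [])
  quadruple : ∀ c → length (foldr (λ _ acc → eval double (eval double (acc ∷ []) ∷ [])) b c) ≡ 4 ^ length c * length b
  quadruple []      = sym (+-identityʳ _)
  quadruple (_ ∷ c) = trans (double-length (eval double (acc ∷ []))) (trans (cong (2 *_) (double-length acc))
    (trans (cong (λ l → 2 * (2 * l)) (quadruple c)) (arith (4 ^ length c) (length b))))
    where
    acc = foldr (λ _ acc → eval double (eval double (acc ∷ []) ∷ [])) b c
    arith : ∀ x y → 2 * (2 * (x * y)) ≡ 4 * x * y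
    arith = solve-∀

module _ where
  open import Data.List.Membership.Propositional using (_∈_)
  open import Data.List.Relation.Unary.Any using (here; there)

  moveSeqs-∋ : ∀ n seq → length seq ≤ 2 * blockSize (length n) → All (λ S → length S ≤ length n) seq →
               seq ∈ eval moveSeqs (n ∷ [])
  moveSeqs-∋ n seq le short = allLists-∋ (eval double (eval blockBound (n ∷ []) ∷ [])) seq
    (≤-trans le (≤-reflexive (sym (trans (double-length (eval blockBound (n ∷ []))) (cong (2 *_) (blockBound-length n))))))
    (sets seq short)
    where
    bits : ∀ S → All (_∈ (false ∷ true ∷ [])) S
    bits []          = []
    bits (false ∷ S) = here refl ∷ bits S
    bits (true ∷ S)  = there (here refl) ∷ bits S
    sets : ∀ seq → All (λ S → length S ≤ length n) seq → All (_∈ eval allLists ((false ∷ true ∷ []) ∷ n ∷ [])) seq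
    sets []        []         = []
    sets (S ∷ seq) (le ∷ les) = allLists-∋ n S le (bits S) ∷ sets seq les

bin : ℕ → List Bool
bin x = bitsᵇ (toℕᵇ x)

value-bits : ∀ x → value (bitsᵇ x) ≡ Binary.toℕ x
value-bits Binary.zero = refl
value-bits 2[1+ x ] = trans (cong (λ v → 2 + 2 * v) (value-bits x)) (sym (*-suc 2 (Binary.toℕ x)))
value-bits 1+[2 x ] = cong (λ v → 1 + 2 * v) (value-bits x)

value-bin : ∀ x → value (bin x) ≡ x
value-bin x = trans (value-bits (toℕᵇ x)) (Binary.toℕ-fromℕ x)

-- The input

parserStep : Bool → ⟦ ParserState ⟧ → ⟦ ParserState ⟧
parserStep b st = eval parseStep (b ∷ st ∷ [])

parser : List Bool → ⟦ ParserState ⟧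
parser = foldr parserStep (false , false , [])

parse-number : ∀ x ys {its} → parser ys ≡ (false , false , its) → parser (encℕ x ++ ys) ≡ (false , false , bin x ∷ its)
parse-number x ys {its} eq = trans (cong parser (++-assoc (concatMap (λ b → b ∷ b ∷ []) (bin x)) _ ys)) (digits (bin x))
  where
  digits : ∀ bs → parser (concatMap (λ b → b ∷ b ∷ []) bs ++ false ∷ true ∷ ys) ≡ (false , false , bs ∷ its)
  digits []           rewrite eq = refl
  digits (false ∷ bs) rewrite digits bs = refl
  digits (true ∷ bs)  rewrite digits bs = refl

parse-numbers : ∀ xs → eval parse (concatMap encℕ xs ∷ []) ≡ map bin xs
parse-numbers xs = cong (proj₂ ∘ proj₂) (parser-numbers xs)
  where
  parser-numbers : ∀ xs → parser (concatMap encℕ xs) ≡ (false , false , map bin xs)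
  parser-numbers []       = refl
  parser-numbers (x ∷ xs) = parse-number x (concatMap encℕ xs) (parser-numbers xs)

entries : Instance → List ℕ
entries I = tabulate (d I) ++ concat (tabulate λ i → tabulate λ j → p I i j)

encode-entries : ∀ I → encode I ≡ concatMap encℕ (n I ∷ m I ∷ toℕ (k I) ∷ entries I)
encode-entries I = cong (λ x → encℕ (n I) ++ encℕ (m I) ++ encℕ (toℕ (k I)) ++ x) (sym (begin
  concatMap encℕ (entries I)
    ≡⟨ concatMap-++ encℕ (tabulate (d I)) _ ⟩
  concatMap encℕ (tabulate (d I)) ++ concatMap encℕ (concat (tabulate λ i → tabulate (p I i)))
    ≡⟨ cong₂ _++_ (cong concat (map-tabulate (d I) encℕ)) (rows (λ i → p I i)) ⟩
  concat (tabulate λ j → encℕ (d I j)) ++ concat (tabulate λ i → concat (tabulate λ j → encℕ (p I i j))) ∎))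
  where
  open ≡-Reasoning
  rows : ∀ {r} (q : Fin r → Fin (m I) → ℕ) → concatMap encℕ (concat (tabulate λ i → tabulate (q i)))
         ≡ concat (tabulate λ i → concat (tabulate λ j → encℕ (q i j)))
  rows {zero}  q = refl
  rows {suc r} q = trans (concatMap-++ encℕ (tabulate (q zero)) _)
    (cong₂ _++_ (cong concat (map-tabulate (q zero) encℕ)) (rows (q ∘ suc)))

-- Distribution of the numbers over the days

addTo : List Bool → DayV → DayV
addTo x (static , S) = x ∷ static , S

rotateV : List Bool → List DayV → List DayV
rotateV x q = eval rotate (x ∷ q ∷ [])

-- In the midst of a turn `q₁` are the days still to be served and `q₂` those already served.
rotate-row : ∀ xs q₁ q₂ → length xs ≡ length q₁ →
             foldr rotateV (q₁ ++ q₂) (reverse xs) ≡ q₂ ++ zipWith addTo xs q₁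
rotate-row []       []         q₂ eq = sym (++-identityʳ q₂)
rotate-row (x ∷ xs) (day ∷ q₁) q₂ eq = begin
  foldr rotateV (day ∷ q₁ ++ q₂) (reverse (x ∷ xs))
    ≡⟨ foldr-reverse-∷ rotateV (day ∷ q₁ ++ q₂) x xs ⟩
  foldr rotateV (eval append ((q₁ ++ q₂) ∷ (addTo x day ∷ []) ∷ [])) (reverse xs)
    ≡⟨ cong (λ q → foldr rotateV q (reverse xs)) (trans (append-eval {Day} (q₁ ++ q₂) (addTo x day ∷ [])) (++-assoc q₁ q₂ _)) ⟩
  foldr rotateV (q₁ ++ q₂ ++ addTo x day ∷ []) (reverse xs)
    ≡⟨ rotate-row xs q₁ (q₂ ++ addTo x day ∷ []) (suc-injective eq) ⟩
  (q₂ ++ addTo x day ∷ []) ++ zipWith addTo xs q₁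
    ≡⟨ ++-assoc q₂ _ _ ⟩
  q₂ ++ zipWith addTo (x ∷ xs) (day ∷ q₁) ∎
  where open ≡-Reasoning

zipWith-tabulate : ∀ {A B C : Set} (f : A → B → C) {r} (g : Fin r → A) (h : Fin r → B) →
                   zipWith f (tabulate g) (tabulate h) ≡ tabulate (λ j → f (g j) (h j))
zipWith-tabulate f {zero}  g h = refl
zipWith-tabulate f {suc r} g h = cong (_ ∷_) (zipWith-tabulate f (g ∘ suc) (h ∘ suc))

rotate-rows : ∀ {r} (rows : List (Fin r → List Bool)) (st : Fin r → List (List Bool)) →
              foldr rotateV (tabulate λ j → st j , []) (reverse (concat (map tabulate rows)))
              ≡ tabulate (λ j → map (λ row → row j) rows ʳ++ st j , [])
rotate-rows []           st = refl
rotate-rows (row ∷ rows) st = begin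
  foldr rotateV Q (reverse (tabulate row ++ concat (map tabulate rows)))
    ≡⟨ cong (foldr rotateV Q) (reverse-++ (tabulate row) _) ⟩
  foldr rotateV Q (reverse (concat (map tabulate rows)) ++ reverse (tabulate row))
    ≡⟨ foldr-++ rotateV Q (reverse (concat (map tabulate rows))) _ ⟩
  foldr rotateV (foldr rotateV Q (reverse (tabulate row))) (reverse (concat (map tabulate rows)))
    ≡⟨ cong (λ q → foldr rotateV q (reverse (concat (map tabulate rows)))) one ⟩
  foldr rotateV (tabulate λ j → row j ∷ st j , []) (reverse (concat (map tabulate rows)))
    ≡⟨ rotate-rows rows (λ j → row j ∷ st j) ⟩
  tabulate (λ j → map (λ r → r j) (row ∷ rows) ʳ++ st j , []) ∎
  where
  open ≡-Reasoning
  Q = tabulate λ j → st j , []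
  one : foldr rotateV Q (reverse (tabulate row)) ≡ tabulate (λ j → row j ∷ st j , [])
  one = trans (cong (λ q → foldr rotateV q (reverse (tabulate row))) (sym (++-identityʳ Q)))
    (trans (rotate-row (tabulate row) Q [] (trans (length-tabulate row) (sym (length-tabulate (λ j → st j , [])))))
      (zipWith-tabulate addTo row (λ j → st j , [])))

dayRow : (I : Instance) → Fin (m I) → List (List Bool)
dayRow I j = bin (d I j) ∷ tabulate (λ i → bin (p I i j))

days₀ : Instance → List DayV
days₀ I = tabulate λ j → reverse (dayRow I j) , []

buildDays-eval : ∀ I u → length u ≡ m I → eval buildDays (u ∷ map bin (entries I) ∷ []) ≡ days₀ I
buildDays-eval I u len = begin
  foldr rotateV (foldr (λ _ acc → ([] , []) ∷ acc) [] u) (reverse (map bin (entries I)))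
    ≡⟨ cong₂ (λ q xs → foldr rotateV q (reverse xs)) (empty-days u (m I) len) entries-rows ⟩
  foldr rotateV (tabulate λ j → [] , []) (reverse (concat (map tabulate rows)))
    ≡⟨ rotate-rows rows (λ _ → []) ⟩
  tabulate (λ j → reverse (map (λ row → row j) rows) , [])
    ≡⟨ tabulate-cong (λ j → cong (λ x → reverse (bin (d I j) ∷ x) , []) (map-tabulate (λ i j → bin (p I i j)) (λ row → row j))) ⟩
  days₀ I ∎
  where
  open ≡-Reasoning
  rows : List (Fin (m I) → List Bool)
  rows = (bin ∘ d I) ∷ tabulate (λ i j → bin (p I i j))
  empty-days : ∀ u r → length u ≡ r → foldr (λ _ acc → ([] , []) ∷ acc) [] u ≡ tabulate {n = r} (λ j → [] , [])
  empty-days []      zero    eq = refl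
  empty-days (_ ∷ u) (suc r) eq = cong (_ ∷_) (empty-days u r (suc-injective eq))
  matrix : ∀ {r} (q : Fin r → Fin (m I) → ℕ) → map bin (concat (tabulate λ i → tabulate (q i)))
           ≡ concat (map tabulate (tabulate (λ i j → bin (q i j))))
  matrix {zero}  q = refl
  matrix {suc r} q = trans (map-++ bin (tabulate (q zero)) _) (cong₂ _++_ (map-tabulate (q zero) bin) (matrix (q ∘ suc)))
  entries-rows : map bin (entries I) ≡ concat (map tabulate rows)
  entries-rows = trans (map-++ bin (tabulate (d I)) _) (cong₂ _++_ (map-tabulate (d I) bin) (matrix (p I)))

encoded-length : ∀ xs → All (λ x → length (bin x) ≤ length (concatMap encℕ xs)) xs
encoded-length []       = []
encoded-length (x ∷ xs) =
  ≤-trans (number x) (≤-trans (m≤m+n _ _) (≤-reflexive (sym (length-++ (encℕ x))))) ∷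
  All.map (λ le → ≤-trans le (≤-trans (m≤n+m _ (length (encℕ x))) (≤-reflexive (sym (length-++ (encℕ x)))))) (encoded-length xs)
  where
  number : ∀ x → length (bin x) ≤ length (encℕ x)
  number x = digits (bin x)
    where
    digits : ∀ bs → length bs ≤ length (concatMap (λ b → b ∷ b ∷ []) bs ++ false ∷ true ∷ [])
    digits []       = z≤n
    digits (b ∷ bs) = s≤s (≤-trans (digits bs) (n≤1+n _))

dayRow-short : ∀ I j → All (λ b → length b ≤ length (encode I)) (dayRow I j)
dayRow-short I j with subst (λ x → All (λ y → length (bin y) ≤ length x) (n I ∷ m I ∷ toℕ (k I) ∷ entries I)) (sym (encode-entries I)) (encoded-length (n I ∷ m I ∷ toℕ (k I) ∷ entries I))
... | _ ∷ _ ∷ _ ∷ short =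
  AllP.tabulate⁻ {f = d I} (AllP.++⁻ˡ (tabulate (d I)) short) j ∷
  AllP.tabulate⁺ (λ i → AllP.tabulate⁻ {f = p I i} (AllP.tabulate⁻ {f = λ i → tabulate (p I i)} (AllP.concat⁻ (AllP.++⁻ʳ (tabulate (d I)) short)) i) j)

-- Blocks of exchanges

sumBy : ∀ {A : Set} → (A → ℕ) → List A → ℕ
sumBy f []       = 0
sumBy f (x ∷ xs) = f x + sumBy f xs

sumBy-++ : ∀ {A : Set} (f : A → ℕ) xs ys → sumBy f (xs ++ ys) ≡ sumBy f xs + sumBy f ys
sumBy-++ f []       ys = refl
sumBy-++ f (x ∷ xs) ys = trans (cong (f x +_) (sumBy-++ f xs ys)) (sym (+-assoc (f x) _ _))

sumBy-concat : ∀ {A : Set} (f : A → ℕ) xss → sumBy f (concat xss) ≡ sumBy (sumBy f) xss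
sumBy-concat f []         = refl
sumBy-concat f (xs ∷ xss) = trans (sumBy-++ f xs (concat xss)) (cong (sumBy f xs +_) (sumBy-concat f xss))

sumBy-≤ : ∀ {A : Set} {f g : A → ℕ} {xs} → All (λ x → f x ≤ g x) xs → sumBy f xs ≤ sumBy g xs
sumBy-≤ []         = z≤n
sumBy-≤ (le ∷ les) = +-mono-≤ le (sumBy-≤ les)

sumBy-↭ : ∀ {A : Set} (f : A → ℕ) {xs ys} → xs ↭ ys → sumBy f xs ≡ sumBy f ys
sumBy-↭ f ↭.refl          = refl
sumBy-↭ f (↭.prep x p)    = cong (f x +_) (sumBy-↭ f p)
sumBy-↭ f (↭.swap {ys = ys} x y p) = trans (cong (λ s → f x + (f y + s)) (sumBy-↭ f p)) (arith (f x) (f y) (sumBy f ys))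
  where
  arith : ∀ a b c → a + (b + c) ≡ b + (a + c)
  arith = solve-∀
sumBy-↭ f (↭.trans p q)   = trans (sumBy-↭ f p) (sumBy-↭ f q)

concat-↭ : ∀ {A : Set} {xss yss : List (List A)} → xss ↭ yss → concat xss ↭ concat yss
concat-↭ ↭.refl          = ↭.refl
concat-↭ (↭.prep xs p)   = ↭P.++⁺ˡ xs (concat-↭ p)
concat-↭ (↭.swap xs ys p) = ↭.trans (↭P.++⁺ˡ xs (↭P.++⁺ˡ ys (concat-↭ p))) (↭P.shifts xs ys)
concat-↭ (↭.trans p q)   = ↭.trans (concat-↭ p) (concat-↭ q)

-- A list of vectors falls into blocks of bounded length whose sums have, in each coordinate,
-- all the same sign.  The vector of x has coordinates up i x − dn i x.

module _ {A : Set} (f g : A → ℕ) where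

  private
    F G : List A → ℕ
    F = sumBy f
    G = sumBy g

  -- The coordinate sum `F b` - `G b` lies in the interval from -`N` to `P`, expressed without
  -- subtraction.
  Within : ℕ → ℕ → List A → Set
  Within P N b = F b ≤ G b + P × G b ≤ F b + N

  -- `out` has reached the smaller interval. `pool` waits for partners; it contains one strict sign
  -- only, since a newcomer of the other sign is paired with a member at once.
  record Paired (P N s : ℕ) (bs : List (List A)) : Set where
    field
      out pool     : List (List A)
      regroup      : concat (out ++ pool) ↭ concat bs
      out-length   : All (λ b → length b ≤ 2 * s) out
      pool-length  : All (λ b → length b ≤ s) pool
      out-within   : All (Within P N) out
      pool-within  : All (Within (suc P) (suc N)) pool
      pool-sign    : All (λ b → G b < F b) pool ⊎ All (λ b → F b < G b) pool

  open Paired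

  pair-with : ∀ {P N s x bs} (pd : Paired P N s bs) {y ys} → pool pd ≡ y ∷ ys → length x ≤ s →
              Within P N (x ++ y) → Paired P N s (x ∷ bs)
  pair-with {s = s} {x = x} pd {y} {ys} eq le within with pool pd | eq | regroup pd | pool-length pd | pool-within pd | pool-sign pd
  ... | _ | refl | rg | le′ ∷ les | _ ∷ wi | sg = record
    { out = (x ++ y) ∷ out pd ; pool = ys
    ; regroup = ↭.trans (↭.↭-reflexive (++-assoc x y _))
        (↭P.++⁺ˡ x (↭.trans (concat-↭ (↭.↭-sym (↭P.shift y (out pd) ys))) rg))
    ; out-length = ≤-trans (≤-reflexive (length-++ x)) (+-mono-≤ le (≤-trans le′ (m≤m+n s 0))) ∷ out-length pd
    ; pool-length = les
    ; out-within = within ∷ out-within pd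
    ; pool-within = wi
    ; pool-sign = Data.Sum.map All.tail All.tail sg
    }

  set-aside : ∀ {P N s x bs} (pd : Paired P N s bs) → length x ≤ s → Within (suc P) (suc N) x →
              All (λ b → G b < F b) (x ∷ pool pd) ⊎ All (λ b → F b < G b) (x ∷ pool pd) → Paired P N s (x ∷ bs)
  set-aside {x = x} pd le within sg = record
    { out = out pd ; pool = x ∷ pool pd
    ; regroup = ↭.trans (concat-↭ (↭P.shift x (out pd) (pool pd))) (↭P.++⁺ˡ x (regroup pd))
    ; out-length = out-length pd ; pool-length = le ∷ pool-length pd
    ; out-within = out-within pd ; pool-within = within ∷ pool-within pd
    ; pool-sign = sg
    }

  -- A pair of a positive and a negative sum lies strictly inside the bounds for both.
  opposite-within : ∀ {P N} x y → Within (suc P) (suc N) x → Within (suc P) (suc N) y → G x < F x → F y < G y →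
                    Within P N (x ++ y) × Within P N (y ++ x)
  opposite-within {P} {N} x y (Fx≤ , Gx≤) (Fy≤ , Gy≤) pos neg =
    subst₂ (λ a b → a ≤ b + P × b ≤ a + N) (sym (sumBy-++ f x y)) (sym (sumBy-++ g x y)) core ,
    subst₂ (λ a b → a ≤ b + P × b ≤ a + N)
      (trans (+-comm (F x) (F y)) (sym (sumBy-++ f y x))) (trans (+-comm (G x) (G y)) (sym (sumBy-++ g y x))) core
    where
    core : F x + F y ≤ G x + G y + P × G x + G y ≤ F x + F y + N
    core = ≤-pred (≤-trans (≤-reflexive (sym (+-suc (F x) (F y)))) (≤-trans (+-mono-≤ Fx≤ neg) (≤-reflexive (arith (G x) (G y) P)))) ,
           ≤-pred (≤-trans (+-mono-≤ pos Gy≤) (≤-reflexive (arith′ (F x) (F y) N)))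
      where
      arith : ∀ a b c → a + suc c + b ≡ suc (a + b + c)
      arith = solve-∀
      arith′ : ∀ a b c → a + (b + suc c) ≡ suc (a + b + c)
      arith′ = solve-∀

  pair-up : ∀ P N s bs → All (λ b → length b ≤ s) bs → All (Within (suc P) (suc N)) bs → Paired P N s bs
  pair-up P N s []       []         []       = record
    { out = [] ; pool = [] ; regroup = ↭.refl ; out-length = [] ; pool-length = [] ; out-within = [] ; pool-within = [] ; pool-sign = inj₁ [] }
  pair-up P N s (x ∷ bs) (le ∷ les) (w ∷ ws) = place (pair-up P N s bs les ws) (<-cmp (F x) (G x))
    where
    place : Paired P N s bs → Tri (F x < G x) (F x ≡ G x) (G x < F x) → Paired P N s (x ∷ bs)
    place pd (tri≈ _ eq _) = record
      { out = x ∷ out pd ; pool = pool pd ; regroup = ↭P.++⁺ˡ x (regroup pd)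
      ; out-length = ≤-trans le (m≤m+n s _) ∷ out-length pd ; pool-length = pool-length pd
      ; out-within = (≤-trans (≤-reflexive eq) (m≤m+n _ P) , ≤-trans (≤-reflexive (sym eq)) (m≤m+n _ N)) ∷ out-within pd
      ; pool-within = pool-within pd ; pool-sign = pool-sign pd }
    place pd (tri< neg _ _) = go-neg (pool pd) refl (pool-within pd) (pool-sign pd)
      where
      go-neg : ∀ ys → pool pd ≡ ys → All (Within (suc P) (suc N)) ys →
               All (λ b → G b < F b) ys ⊎ All (λ b → F b < G b) ys → Paired P N s (x ∷ bs)
      go-neg []       eq wys sg = set-aside pd le w (inj₂ (neg ∷ subst (All _) (sym eq) []))
      go-neg (y ∷ ys) eq (wy ∷ _) (inj₁ (pos ∷ _)) = pair-with pd eq le (proj₂ (opposite-within y x wy w pos neg))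
      go-neg (y ∷ ys) eq wys (inj₂ negs) = set-aside pd le w (inj₂ (neg ∷ subst (All _) (sym eq) negs))
    place pd (tri> _ _ pos) = go-pos (pool pd) refl (pool-within pd) (pool-sign pd)
      where
      go-pos : ∀ ys → pool pd ≡ ys → All (Within (suc P) (suc N)) ys →
               All (λ b → G b < F b) ys ⊎ All (λ b → F b < G b) ys → Paired P N s (x ∷ bs)
      go-pos []       eq wys sg = set-aside pd le w (inj₁ (pos ∷ subst (All _) (sym eq) []))
      go-pos (y ∷ ys) eq (wy ∷ _) (inj₂ (neg ∷ _)) = pair-with pd eq le (proj₁ (opposite-within x y w wy pos neg))
      go-pos (y ∷ ys) eq wys (inj₁ poss) = set-aside pd le w (inj₁ (pos ∷ subst (All _) (sym eq) poss))

  SameSign : List (List A) → Set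
  SameSign bs = All (λ b → G b ≤ F b) bs ⊎ All (λ b → F b ≤ G b) bs

  Merged : ℕ → List (List A) → Set
  Merged s bs = Σ (List (List A)) λ bs′ → concat bs′ ↭ concat bs × All (λ b → length b ≤ s) bs′ × SameSign bs′

  -- By induction on `P + N`. If the unpaired blocks are positive, none of them lies below zero and
  -- the bound `N` can be lowered; if they are negative, `P` can. Each round doubles the length, and
  -- once one of the bounds is zero, all sums agree in sign.
  merge : ∀ P N s bs → All (λ b → length b ≤ s) bs → All (Within P N) bs → Merged (2 ^ (P + N) * s) bs
  merge zero N s bs les ws = bs , ↭.refl , All.map (λ le → ≤-trans le (m≤n*m s (2 ^ N) ⦃ ℕ.>-nonZero (m^n>0 2 N) ⦄)) les ,
    inj₂ (All.map (λ { (F≤ , _) → ≤-trans F≤ (≤-reflexive (+-identityʳ _)) }) ws)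
  merge (suc P) zero s bs les ws = bs , ↭.refl , All.map (λ le → ≤-trans le (m≤n*m s (2 ^ (suc P + 0)) ⦃ ℕ.>-nonZero (m^n>0 2 (suc P + 0)) ⦄)) les ,
    inj₁ (All.map (λ { (_ , G≤) → ≤-trans G≤ (≤-reflexive (+-identityʳ _)) }) ws)
  merge (suc P) (suc N) s bs les ws = again (pool-sign pd)
    where
    pd = pair-up P N s bs les ws
    les′ : All (λ b → length b ≤ 2 * s) (out pd ++ pool pd)
    les′ = AllP.++⁺ (out-length pd) (All.map (λ le → ≤-trans le (m≤m+n s _)) (pool-length pd))
    up-within : ∀ {a b c} → a ≤ b + c → a ≤ b + suc c
    up-within {b = b} le = ≤-trans le (+-monoʳ-≤ b (n≤1+n _))
    again : All (λ b → G b < F b) (pool pd) ⊎ All (λ b → F b < G b) (pool pd) → Merged (2 ^ (suc P + suc N) * s) bs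
    again (inj₁ poss) =
      let bs′ , perm , len , sg = merge (suc P) N (2 * s) (out pd ++ pool pd) les′
            (AllP.++⁺ (All.map (λ { (F≤ , G≤) → up-within F≤ , G≤ }) (out-within pd))
              (All.zipWith (λ { ((F≤ , _) , pos) → F≤ , ≤-trans (<⇒≤ pos) (m≤m+n _ N) }) (pool-within pd , poss)))
      in bs′ , ↭.trans perm (regroup pd) , All.map (λ le → ≤-trans le (≤-reflexive (arith (suc P + N) (suc P + suc N) (sym (+-suc (suc P) N))))) len , sg
      where
      arith : ∀ e e′ → suc e ≡ e′ → 2 ^ e * (2 * s) ≡ 2 ^ e′ * s
      arith e _ refl = trans (sym (*-assoc (2 ^ e) 2 s)) (cong (_* s) (*-comm (2 ^ e) 2))
    again (inj₂ negs) =
      let bs′ , perm , len , sg = merge P (suc N) (2 * s) (out pd ++ pool pd) les′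
            (AllP.++⁺ (All.map (λ { (F≤ , G≤) → F≤ , up-within G≤ }) (out-within pd))
              (All.zipWith (λ { ((_ , G≤) , neg) → ≤-trans (<⇒≤ neg) (m≤m+n _ P) , G≤ }) (pool-within pd , negs)))
      in bs′ , ↭.trans perm (regroup pd) , All.map (λ le → ≤-trans le (≤-reflexive (arith (P + suc N)))) len , sg
      where
      arith : ∀ e → 2 ^ e * (2 * s) ≡ 2 ^ suc e * s
      arith e = trans (sym (*-assoc (2 ^ e) 2 s)) (cong (_* s) (*-comm (2 ^ e) 2))

module _ {A : Set} (up dn : ℕ → A → ℕ) (up≤1 : ∀ i x → up i x ≤ 1) (dn≤1 : ∀ i x → dn i x ≤ 1) where

  private
    U D : ℕ → List A → ℕ
    U i = sumBy (up i)
    D i = sumBy (dn i)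

  record Partition (t : ℕ) (xs : List A) : Set where
    field
      blocks : List (List A)
      covers : concat blocks ↭ xs
      small  : All (λ b → length b ≤ blockSize t) blocks
      signs  : ∀ {i} → i < t → SameSign (up i) (dn i) blocks

  sumBy-≤length : ∀ (f : A → ℕ) → (∀ x → f x ≤ 1) → ∀ xs → sumBy f xs ≤ length xs
  sumBy-≤length f le []       = z≤n
  sumBy-≤length f le (x ∷ xs) = +-mono-≤ (le x) (sumBy-≤length f le xs)

  concat-length-≤ : ∀ {b} {g : List (List A)} → All (λ x → length x ≤ b) g → length (concat g) ≤ length g * b
  concat-length-≤ []                   = z≤n
  concat-length-≤ {g = x ∷ g} (le ∷ les) = ≤-trans (≤-reflexive (length-++ x)) (+-mono-≤ le (concat-length-≤ les))

  singletons : ∀ {B : Set} → List B → List (List B)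
  singletons = map (_∷ [])

  concat-singletons : ∀ {B : Set} (xs : List B) → concat (singletons xs) ≡ xs
  concat-singletons []       = refl
  concat-singletons (x ∷ xs) = cong (x ∷_) (concat-singletons xs)

  concat-concat : ∀ (gs : List (List (List A))) → concat (map concat gs) ≡ concat (concat gs)
  concat-concat []       = refl
  concat-concat (g ∷ gs) = trans (cong (concat g ++_) (concat-concat gs)) (concat-++ g (concat gs))

  -- The blocks for the earlier coordinates are the elements that are merged for the next one.
  -- Joining sums of one sign preserves this sign, so coordinates once settled remain so.
  partition : ∀ t xs → Partition t xs
  partition zero xs = record
    { blocks = singletons xs
    ; covers = ↭.↭-reflexive (concat-singletons xs)
    ; small  = AllP.map⁺ (All.universal (λ _ → s≤s z≤n) xs)
    ; signs  = λ () }
  partition (suc t) xs = record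
    { blocks = map concat groups
    ; covers = ↭.trans (↭.↭-reflexive (concat-concat groups)) (↭.trans (concat-↭ regroup) (covers part))
    ; small  = AllP.map⁺ (All.zipWith
        (λ { (len , sm) → ≤-trans (concat-length-≤ sm) (*-monoˡ-≤ b (≤-trans len (≤-reflexive power))) })
        (lens , AllP.concat⁻ (↭P.All-resp-↭ (↭.↭-sym regroup) (small part))))
    ; signs  = λ i<1+t → signs′ (m≤n⇒m<n∨m≡n (≤-pred i<1+t)) }
    where
    open Partition
    part = partition t xs
    b    = blockSize t
    -- Entries are at most 1, so a block of length at most `b` has both sums at most `b`. As lists
    -- of blocks, the singletons have length 1.
    merged = merge (U t) (D t) b b 1 (singletons (blocks part)) (AllP.map⁺ (All.universal (λ _ → s≤s z≤n) (blocks part)))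
      (AllP.map⁺ (All.map (λ {x} le →
        ≤-trans (≤-reflexive (+-identityʳ (U t x))) (≤-trans (≤-trans (sumBy-≤length (up t) (up≤1 t) x) le) (m≤n+m b (D t x + 0))) ,
        ≤-trans (≤-reflexive (+-identityʳ (D t x))) (≤-trans (≤-trans (sumBy-≤length (dn t) (dn≤1 t) x) le) (m≤n+m b (U t x + 0)))) (small part)))
    groups = proj₁ merged
    regroup : concat groups ↭ blocks part
    regroup = subst (concat groups ↭_) (concat-singletons (blocks part)) (proj₁ (proj₂ merged))
    lens = proj₁ (proj₂ (proj₂ merged))
    power : 2 ^ (b + b) * 1 ≡ 4 ^ b
    power = trans (*-identityʳ _) (trans (cong (λ e → 2 ^ (b + e)) (sym (+-identityʳ b))) (sym (^-*-assoc 2 2 b)))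
    join : ∀ (f g : A → ℕ) {gs} → All (λ g′ → sumBy (sumBy f) g′ ≤ sumBy (sumBy g) g′) gs →
           All (λ b′ → sumBy f b′ ≤ sumBy g b′) (map concat gs)
    join f g les = AllP.map⁺ (All.map (λ {x} le → subst₂ _≤_ (sym (sumBy-concat f x)) (sym (sumBy-concat g x)) le) les)
    spread : ∀ (f g : A → ℕ) → All (λ b′ → sumBy f b′ ≤ sumBy g b′) (blocks part) →
             All (λ g′ → sumBy (sumBy f) g′ ≤ sumBy (sumBy g) g′) groups
    spread f g les = All.map sumBy-≤ (AllP.concat⁻ (↭P.All-resp-↭ (↭.↭-sym regroup) les))
    signs′ : ∀ {i} → i < t ⊎ i ≡ t → SameSign (up i) (dn i) (map concat groups)
    signs′ {i} (inj₁ i<t) = Data.Sum.map (join (dn i) (up i) ∘ spread (dn i) (up i)) (join (up i) (dn i) ∘ spread (up i) (dn i)) (signs part i<t)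
    signs′ (inj₂ refl) = Data.Sum.map (join (dn t) (up t)) (join (up t) (dn t)) (proj₂ (proj₂ (proj₂ merged)))

-- Subsequences and exchanges that lower the deficit

data Sub {A : Set} : List A → List A → Set where
  []   : Sub [] []
  skip : ∀ {x xs ys} → Sub xs ys → Sub xs (x ∷ ys)
  keep : ∀ {x xs ys} → Sub xs ys → Sub (x ∷ xs) (x ∷ ys)

sub-prefix : ∀ {A : Set} (xs ys : List A) → Sub xs (xs ++ ys)
sub-prefix []       []       = []
sub-prefix []       (y ∷ ys) = skip (sub-prefix [] ys)
sub-prefix (x ∷ xs) ys       = keep (sub-prefix xs ys)

-- A block is contiguous only in a rearrangement of the days. Brought back to their own order, its
-- elements form a subsequence, which a single pass over the days can follow.
sub-↭ : ∀ {A : Set} {bs xs ys : List A} → xs ↭ ys → Sub bs xs → Σ (List A) λ cs → Sub cs ys × bs ↭ cs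
sub-↭ ↭.refl sb = _ , sb , ↭.refl
sub-↭ (↭.prep x p) (skip sb) = let cs , sc , q = sub-↭ p sb in cs , skip sc , q
sub-↭ (↭.prep x p) (keep sb) = let cs , sc , q = sub-↭ p sb in x ∷ cs , keep sc , ↭.prep x q
sub-↭ (↭.swap x y p) (skip (skip sb)) = let cs , sc , q = sub-↭ p sb in cs , skip (skip sc) , q
sub-↭ (↭.swap x y p) (skip (keep sb)) = let cs , sc , q = sub-↭ p sb in y ∷ cs , keep (skip sc) , ↭.prep y q
sub-↭ (↭.swap x y p) (keep (skip sb)) = let cs , sc , q = sub-↭ p sb in x ∷ cs , skip (keep sc) , ↭.prep x q
sub-↭ (↭.swap x y p) (keep (keep sb)) = let cs , sc , q = sub-↭ p sb in y ∷ x ∷ cs , keep (keep sc) , ↭.swap x y q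
sub-↭ (↭.trans p p′) sb =
  let cs , sc , q = sub-↭ p sb ; es , se , q′ = sub-↭ p′ sc in es , se , ↭.trans q q′

module _ where
  open import Data.List.Membership.Propositional using (_∈_)
  open import Data.List.Relation.Unary.Any using (here; there)

  sub-concat : ∀ {A : Set} {b : List A} {bs} → b ∈ bs → Σ (List A) λ r → b ++ r ↭ concat bs
  sub-concat {bs = _ ∷ bs} (here refl) = concat bs , ↭.refl
  sub-concat {b = b} {bs = c ∷ bs} (there b∈) =
    let r , p = sub-concat b∈ in c ++ r , ↭.trans (↭P.shifts b c) (↭P.++⁺ˡ c p)

  larger-summand : ∀ {B : Set} (f g : B → ℕ) xs → sumBy f xs < sumBy g xs → Σ B λ x → x ∈ xs × f x < g x
  larger-summand f g (x ∷ xs) lt with f x <? g x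
  ... | yes fx<gx = x , here refl , fx<gx
  ... | no  fx≮gx = let y , y∈ , lt′ = larger-summand f g xs (+-cancelˡ-< (f x) _ _ (≤-trans lt (+-monoˡ-≤ _ (≮⇒≥ fx≮gx))))
                    in y , there y∈ , lt′

  -- The gaps of the other summands are non-negative, so a single gap is at most the total one. It
  -- is used for a coordinate in which all blocks lose: one block cannot lose more than all of them
  -- together.
  summand-gap : ∀ {B : Set} (f g : B → ℕ) {x xs} → x ∈ xs → All (λ y → f y ≤ g y) xs → sumBy f xs + g x ≤ sumBy g xs + f x
  summand-gap f g {x} {_ ∷ xs} (here refl) (le ∷ les) = ≤-trans (≤-reflexive (arith (f x) (sumBy f xs) (g x)))
    (≤-trans (+-monoʳ-≤ (g x + f x) (sumBy-≤ les)) (≤-reflexive (arith′ (g x) (f x) (sumBy g xs))))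
    where
    arith : ∀ a b c → a + b + c ≡ c + a + b
    arith = solve-∀
    arith′ : ∀ a b c → a + b + c ≡ a + c + b
    arith′ = solve-∀
  summand-gap f g {x} {y ∷ xs} (there x∈) (le ∷ les) = ≤-trans (≤-reflexive (+-assoc (f y) _ _))
    (≤-trans (+-mono-≤ le (summand-gap f g x∈ les)) (≤-reflexive (sym (+-assoc (g y) _ _))))

sumTo-≤ : ∀ j {f g} → (∀ {i} → i < j → f i ≤ g i) → sumTo j f ≤ sumTo j g
sumTo-≤ zero    le = z≤n
sumTo-≤ (suc j) le = +-mono-≤ (le ≤-refl) (sumTo-≤ j (λ i<j → le (≤-trans i<j (n≤1+n j))))

sumTo-< : ∀ j {f g} → (∀ {i} → i < j → f i ≤ g i) → ∀ {i₀} → i₀ < j → f i₀ < g i₀ → sumTo j f < sumTo j g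
sumTo-< (suc j) le {i₀} i₀<1+j lt with m≤n⇒m<n∨m≡n (≤-pred i₀<1+j)
... | inj₁ i₀<j = +-mono-≤-< (le ≤-refl) (sumTo-< j (λ i<j → le (≤-trans i<j (n≤1+n j))) i₀<j lt)
... | inj₂ refl = +-mono-<-≤ lt (sumTo-≤ j (λ i<j → le (≤-trans i<j (n≤1+n j))))

sumTo-positive : ∀ j {f} → 0 < sumTo j f → Σ ℕ λ i → i < j × 0 < f i
sumTo-positive (suc j) {f} pos with 0 <? f j
... | yes fj>0 = j , ≤-refl , fj>0
... | no  fj≯0 =
  let i , i<j , fi>0 = sumTo-positive j (subst (λ v → 0 < v + sumTo j f) (n≤0⇒n≡0 (≮⇒≥ fj≯0)) pos)
  in i , ≤-trans i<j (n≤1+n j) , fi>0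

sumTo-zero : ∀ j {f} → sumTo j f ≡ 0 → ∀ {i} → i < j → f i ≡ 0
sumTo-zero (suc j) {f} eq {i} i<1+j with m≤n⇒m<n∨m≡n (≤-pred i<1+j)
... | inj₁ i<j  = sumTo-zero j (m+n≡0⇒n≡0 (f j) eq) i<j
... | inj₂ refl = m+n≡0⇒m≡0 (f j) eq

-- If the old vectors leave a deficit which the new vectors avoid, then exchanging the
-- vectors of a block that gains in a deficient coordinate lowers the deficit: a block
-- loses in a coordinate only if all blocks do, and then at most down to the new sum.
module _ {A : Set} (up dn : ℕ → A → ℕ) (up≤1 : ∀ i x → up i x ≤ 1) (dn≤1 : ∀ i x → dn i x ≤ 1) where
  open import Data.List.Membership.Propositional using (_∈_)

  improving-block : ∀ t k xs → (∀ {i} → i < t → k ≤ sumBy (up i) xs) → 0 < sumTo t (λ i → k ∸ sumBy (dn i) xs) →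
    Σ (List A) λ b → Sub b xs × length b ≤ blockSize t ×
      ∀ (c : ℕ → ℕ) → (∀ i → c i + sumBy (dn i) b ≡ sumBy (dn i) xs + sumBy (up i) b) →
      sumTo t (λ i → k ∸ c i) < sumTo t (λ i → k ∸ sumBy (dn i) xs)
  improving-block t k xs enough deficit>0 =
    let cs , sc , b↭cs = sub-↭ (↭.trans (proj₂ (sub-concat b∈)) covers) (sub-prefix b _)
    in cs , sc , subst (_≤ blockSize t) (↭P.↭-length b↭cs) (All.lookup small b∈) ,
       λ c eq → improves c λ i → trans (cong (c i +_) (sumBy-↭ (dn i) b↭cs)) (trans (eq i) (cong (sumBy (dn i) xs +_) (sym (sumBy-↭ (up i) b↭cs))))
    where
    open Partition (partition up dn up≤1 dn≤1 t xs)
    deficient = sumTo-positive t deficit>0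
    i₀ = proj₁ deficient
    i₀<t = proj₁ (proj₂ deficient)
    sum-blocks : ∀ (f : A → ℕ) → sumBy (sumBy f) blocks ≡ sumBy f xs
    sum-blocks f = trans (sym (sumBy-concat f blocks)) (sumBy-↭ f covers)
    old<k : sumBy (dn i₀) xs < k
    old<k = m∸n≢0⇒n<m (λ eq → <-irrefl (sym eq) (proj₂ (proj₂ deficient)))
    -- In the deficient coordinate the old total is below `k` and the new one is not, so some block
    -- gains there.
    chosen = larger-summand (sumBy (dn i₀)) (sumBy (up i₀)) blocks
      (subst₂ _<_ (sym (sum-blocks (dn i₀))) (sym (sum-blocks (up i₀))) (≤-trans old<k (enough i₀<t)))
    b  = proj₁ chosen
    b∈ = proj₁ (proj₂ chosen)
    improves : ∀ (c : ℕ → ℕ) → (∀ i → c i + sumBy (dn i) b ≡ sumBy (dn i) xs + sumBy (up i) b) →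
               sumTo t (λ i → k ∸ c i) < sumTo t (λ i → k ∸ sumBy (dn i) xs)
    improves c eq = sumTo-< t no-loss i₀<t (≤-<-trans (∸-monoʳ-≤ k gain) (∸-monoʳ-< (n<1+n (sumBy (dn i₀) xs)) old<k))
      where
      gain : sumBy (dn i₀) xs < c i₀
      gain = +-cancelʳ-< (sumBy (dn i₀) b) _ _
        (≤-trans (+-monoʳ-< (sumBy (dn i₀) xs) (proj₂ (proj₂ chosen))) (≤-reflexive (sym (eq i₀))))
      no-loss : ∀ {i} → i < t → k ∸ c i ≤ k ∸ sumBy (dn i) xs
      no-loss {i} i<t with signs i<t
      ... | inj₁ gains = ∸-monoʳ-≤ k (+-cancelʳ-≤ (sumBy (dn i) b) _ _
              (≤-trans (+-monoʳ-≤ (sumBy (dn i) xs) (All.lookup gains b∈)) (≤-reflexive (sym (eq i)))))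
      ... | inj₂ losses = ≤-trans (≤-reflexive (m≤n⇒m∸n≡0 (≤-trans (enough i<t) bound))) z≤n
        where
        bound : sumBy (up i) xs ≤ c i
        bound = +-cancelʳ-≤ (sumBy (dn i) b) _ _
          (≤-trans (subst₂ (λ x y → x + sumBy (dn i) b ≤ y + sumBy (up i) b) (sum-blocks (up i)) (sum-blocks (dn i))
                     (summand-gap (sumBy (up i)) (sumBy (dn i)) b∈ losses))
                   (≤-reflexive (sym (eq i))))

-- Local search

Valid : DayV → Set
Valid (static , S) = FitsDay S (reverse static)

ShortDay : List Bool → DayV → Set
ShortDay fuel day = All (λ b → length b ≤ length fuel) (reverse (proj₁ day))

applyV : List Bool → DayV → List (List Bool) × List DayV → List (List Bool) × List DayV
applyV fuel day st = eval applyStep (fuel ∷ day ∷ st ∷ [])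

-- Validity and counts hold whether or not a possible move is carried out, so `kept` records no
-- reason. That a possible move is indeed carried out is the content of `apply-moves`.
data Applied (rem : List (List Bool)) (out : List DayV) : DayV → List (List Bool) × List DayV → Set where
  kept  : ∀ {day} → Applied rem out day (rem , day ∷ out)
  moved : ∀ {static old new rem′} → rem ≡ old ∷ new ∷ rem′ → FitsDay new (reverse static) →
          Applied rem out (static , old) (rem′ , (static , new) ∷ out)

if-view : ∀ {A : Set} (P : A → Set) {a b} c → (c ≡ true → P a) → (c ≡ false → P b) → P (if c then a else b)
if-view P true  t f = t refl
if-view P false t f = f refl

∧-split : ∀ a {b} → (if a then b else false) ≡ true → a ≡ true × b ≡ true
∧-split true eq = refl , eq

apply-view : ∀ fuel day rem out → ShortDay fuel day → Applied rem out day (applyV fuel day (rem , out))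
apply-view fuel (static , cur) []                  out short = kept
apply-view fuel (static , cur) (old ∷ [])          out short = kept
apply-view fuel (static , cur) (old ∷ new ∷ rem)   out short =
  if-view (Applied (old ∷ new ∷ rem) out (static , cur)) match
    (λ eq → let eq₁ , eq₂ = ∧-split (eval equal (old ∷ cur ∷ [])) eq in
       do-move (Equivalence.to (equal-correct old cur) eq₁) (Equivalence.to (feasible-correct fuel new static short) eq₂))
    (λ _ → kept)
  where
  match = if eval equal (old ∷ cur ∷ []) then eval feasible (fuel ∷ new ∷ static ∷ []) else false
  do-move : old ≡ cur → FitsDay new (reverse static) → Applied (old ∷ new ∷ rem) out (static , cur) (rem , (static , new) ∷ out)
  do-move refl fits = moved refl fits

apply-moves : ∀ fuel static old new rem out → ShortDay fuel (static , old) → FitsDay new (reverse static) →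
              proj₁ (applyV fuel (static , old) (old ∷ new ∷ rem , out)) ≡ rem
apply-moves fuel static old new rem out short fits
  rewrite Equivalence.from (equal-correct old old) refl | Equivalence.from (feasible-correct fuel new static short) fits = refl

applyLoop : List Bool → List (List Bool) → List DayV → List (List Bool) × List DayV
applyLoop fuel seq = foldr (applyV fuel) (seq , [])

olds news : List (List Bool) → ℕ → ℕ
olds (old ∷ new ∷ seq) i = bitAt old i + olds seq i
olds _                 i = 0
news (old ∷ new ∷ seq) i = bitAt new i + news seq i
news _                 i = 0

Bounded : ℕ → List DayV → Set
Bounded w = All (λ day → length (proj₂ day) ≤ w)

-- `counts` is a conservation law: an executed move trades its old set for its new one. The moves
-- still pending are cancelled by appearing on the opposite sides, which avoids subtraction.
record AppliedLoop (w : ℕ) (seq : List (List Bool)) (days : List DayV) (res : List (List Bool) × List DayV) : Set where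
  field
    statics : map proj₁ (proj₂ res) ≡ map proj₁ days
    valid   : All Valid days → All Valid (proj₂ res)
    bounded : All (λ S → length S ≤ w) seq → Bounded w days → All (λ S → length S ≤ w) (proj₁ res) × Bounded w (proj₂ res)
    counts  : ∀ i → countAt (proj₂ res) i + olds seq i + news (proj₁ res) i ≡ countAt days i + news seq i + olds (proj₁ res) i

open AppliedLoop

applyLoop-spec : ∀ fuel w seq days → All (ShortDay fuel) days → AppliedLoop w seq days (applyLoop fuel seq days)
applyLoop-spec fuel w seq []           []             = record
  { statics = refl ; valid = λ _ → [] ; bounded = λ b _ → b , [] ; counts = λ i → +-comm (olds seq i) (news seq i) }
applyLoop-spec fuel w seq (day ∷ days) (short ∷ shorts) =
  extend (applyLoop-spec fuel w seq days shorts) (apply-view fuel day _ _ short)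
  where
  extend : ∀ {rem out res} → AppliedLoop w seq days (rem , out) → Applied rem out day res → AppliedLoop w seq (day ∷ days) res
  extend {rem} {out} ih kept = record
    { statics = cong (proj₁ day ∷_) (statics ih)
    ; valid   = λ { (v ∷ vs) → v ∷ valid ih vs }
    ; bounded = λ { b (le ∷ les) → let b₁ , b₂ = bounded ih b les in b₁ , le ∷ b₂ }
    ; counts  = λ i → trans (arith (bitAt (proj₂ day) i) (countAt out i) (olds seq i) (news rem i))
        (trans (cong (bitAt (proj₂ day) i +_) (counts ih i)) (sym (arith (bitAt (proj₂ day) i) (countAt days i) (news seq i) (olds rem i)))) }
    where
    arith : ∀ a b c d → a + b + c + d ≡ a + (b + c + d)
    arith = solve-∀
  extend {out = out} ih (moved {static} {old} {new} {rem′} refl fits) = record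
    { statics = cong (static ∷_) (statics ih)
    ; valid   = λ { (_ ∷ vs) → fits ∷ valid ih vs }
    ; bounded = λ { b (_ ∷ les) → let b₁ , b₂ = bounded ih b les in All.tail (All.tail b₁) , All.head (All.tail b₁) ∷ b₂ }
    ; counts  = λ i → trans (arith (bitAt new i) (countAt out i) (olds seq i) (news rem′ i))
        (trans (counts ih i) (arith′ (bitAt old i) (countAt days i) (news seq i) (olds rem′ i))) }
    where
    arith : ∀ a b c d → a + b + c + d ≡ b + c + (a + d)
    arith = solve-∀
    arith′ : ∀ a b c d → b + c + (a + d) ≡ a + b + c + d
    arith′ = solve-∀

record Item : Set where
  constructor item
  field
    static   : List (List Bool)
    old new  : List Bool

oldDay newDay : Item → DayV
oldDay (item static old new) = static , old
newDay (item static old new) = static , new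

oldBit newBit : ℕ → Item → ℕ
oldBit i it = bitAt (Item.old it) i
newBit i it = bitAt (Item.new it) i

bitAt≤1 : ∀ S i → bitAt S i ≤ 1
bitAt≤1 []          i       = z≤n
bitAt≤1 (false ∷ S) zero    = z≤n
bitAt≤1 (true ∷ S)  zero    = ≤-refl
bitAt≤1 (b ∷ S)     (suc i) = bitAt≤1 S i

-- Days are visited from the last one on.
movesOf : List Item → List (List Bool)
movesOf []         = []
movesOf (it ∷ its) = movesOf its ++ Item.old it ∷ Item.new it ∷ []

movesOf-olds : ∀ its seq i → olds (movesOf its ++ seq) i ≡ sumBy (oldBit i) its + olds seq i
movesOf-olds []         seq i = refl
movesOf-olds (it ∷ its) seq i = trans (cong (λ x → olds x i) (++-assoc (movesOf its) _ seq))
  (trans (movesOf-olds its (Item.old it ∷ Item.new it ∷ seq) i) (arith (sumBy (oldBit i) its) (oldBit i it) (olds seq i)))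
  where
  arith : ∀ a b c → a + (b + c) ≡ b + a + c
  arith = solve-∀

movesOf-news : ∀ its seq i → news (movesOf its ++ seq) i ≡ sumBy (newBit i) its + news seq i
movesOf-news []         seq i = refl
movesOf-news (it ∷ its) seq i = trans (cong (λ x → news x i) (++-assoc (movesOf its) _ seq))
  (trans (movesOf-news its (Item.old it ∷ Item.new it ∷ seq) i) (arith (sumBy (newBit i) its) (newBit i it) (news seq i)))
  where
  arith : ∀ a b c → a + (b + c) ≡ b + a + c
  arith = solve-∀

movesOf-length : ∀ its → length (movesOf its) ≡ 2 * length its
movesOf-length []         = refl
movesOf-length (it ∷ its) = trans (length-++ (movesOf its)) (trans (cong (_+ 2) (movesOf-length its)) (arith (length its)))
  where
  arith : ∀ l → 2 * l + 2 ≡ 2 * suc l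
  arith = solve-∀

sub-All : ∀ {A : Set} {P : A → Set} {xs ys} → Sub xs ys → All P ys → All P xs
sub-All []        []         = []
sub-All (skip sb) (p ∷ ps) = sub-All sb ps
sub-All (keep sb) (p ∷ ps) = p ∷ sub-All sb ps

movesOf-bounded : ∀ {w its} → All (λ it → length (Item.old it) ≤ w × length (Item.new it) ≤ w) its → All (λ S → length S ≤ w) (movesOf its)
movesOf-bounded []                 = []
movesOf-bounded ((le , le′) ∷ les) = AllP.++⁺ (movesOf-bounded les) (le ∷ le′ ∷ [])

-- Suffixes by whole moves: a difference of one entry would exchange the roles of old and new sets.
data _≼_ : List (List Bool) → List (List Bool) → Set where
  same  : ∀ {v} → v ≼ v
  later : ∀ {r old new v} → r ≼ v → r ≼ (old ∷ new ∷ v)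

≼-tail : ∀ {old new r v} → (old ∷ new ∷ r) ≼ v → r ≼ v
≼-tail same       = later same
≼-tail (later r≼) = later (≼-tail r≼)

≼-applied : ∀ {rem out day res v} → Applied rem out day res → rem ≼ v → proj₁ res ≼ v
≼-applied kept             r≼ = r≼
≼-applied (moved refl fits) r≼ = ≼-tail r≼

-- Greedy stays ahead: it has always executed at least the moves of the items visited.
greedy : ∀ fuel {b its} → Sub b its → All (ShortDay fuel ∘ oldDay) its → All (Valid ∘ newDay) its → ∀ v →
         proj₁ (applyLoop fuel (movesOf b ++ v) (map oldDay its)) ≼ v
greedy fuel [] [] [] v = same
greedy fuel {b} {it ∷ its} (skip sb) (sh ∷ shs) (_ ∷ vs) v =
  ≼-applied (apply-view fuel (oldDay it) _ _ sh) (greedy fuel sb shs vs v)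
greedy fuel {item static old new ∷ b} {_ ∷ its} (keep sb) (sh ∷ shs) (fits ∷ vs) v
  rewrite ++-assoc (movesOf b) (old ∷ new ∷ []) v = consume (applyLoop fuel (movesOf b ++ old ∷ new ∷ v) (map oldDay its)) (greedy fuel sb shs vs (old ∷ new ∷ v))
  where
  -- Either the move of this item is next, and then the day permits it, or the pass is already
  -- beyond it.
  consume : ∀ res → proj₁ res ≼ (old ∷ new ∷ v) → proj₁ (applyV fuel (static , old) res) ≼ v
  consume (rem , out) same       = subst (_≼ v) (sym (apply-moves fuel static old new v out sh fits)) same
  consume (rem , out) (later r≼) = ≼-applied (apply-view fuel (static , old) rem out sh) r≼

items : ∀ days sol → map proj₁ days ≡ map proj₁ sol → Σ (List Item) λ its → map oldDay its ≡ days × map newDay its ≡ sol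
items []                    []                  eq = [] , refl , refl
items ((static , S) ∷ days) ((static′ , S′) ∷ sol) eq with ∷-injective eq
... | refl , eq′ = let its , eq₁ , eq₂ = items days sol eq′ in
  item static S S′ ∷ its , cong (_ ∷_) eq₁ , cong (_ ∷_) eq₂

countAt-old : ∀ its i → countAt (map oldDay its) i ≡ sumBy (oldBit i) its
countAt-old []         i = refl
countAt-old (it ∷ its) i = cong (oldBit i it +_) (countAt-old its i)

countAt-new : ∀ its i → countAt (map newDay its) i ≡ sumBy (newBit i) its
countAt-new []         i = refl
countAt-new (it ∷ its) i = cong (newBit i it +_) (countAt-new its i)

module Search (fuel : List Bool) (nᵘ kᵘ : List ⊤) (seqs : List (List (List Bool))) (rows : List (List (List Bool)))
  (shortRows : All (λ row → All (λ b → length b ≤ length fuel) (reverse row)) rows) where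

  open import Data.List.Membership.Propositional using (_∈_)
  open import Data.List.Relation.Unary.Any using (here; there)

  w k̂ : ℕ
  w = length nᵘ
  k̂ = length kᵘ

  Φ : List DayV → ℕ
  Φ = deficitOf w k̂

  -- `allBounded` keeps the current sets among the enumerated ones, so that moves which start from
  -- them are tried in the later rounds as well.
  record Good (days : List DayV) : Set where
    field
      sameRows : map proj₁ days ≡ rows
      allValid : All Valid days
      allBounded : Bounded w days

  open Good public

  Solution : Set
  Solution = Σ (List DayV) λ sol → Good sol × (∀ {i} → i < w → k̂ ≤ countAt sol i)

  good-short : ∀ {days} → Good days → All (ShortDay fuel) days
  good-short good = AllP.map⁻ (subst (All _) (sym (sameRows good)) shortRows)

  applied : List (List Bool) → List DayV → List DayV
  applied seq days = eval applyMoves (fuel ∷ seq ∷ days ∷ [])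

  applied-good : ∀ {seq days} → All (λ S → length S ≤ w) seq → Good days → Good (applied seq days)
  applied-good {seq} {days} b good =
    let sp = applyLoop-spec fuel w seq days (good-short good) in record
    { sameRows = trans (statics sp) (sameRows good)
    ; allValid = valid sp (allValid good)
    ; allBounded = proj₂ (bounded sp b (allBounded good)) }

  improving-moves : ∀ {days} → Good days → Solution → 0 < Φ days →
    Σ (List (List Bool)) λ seq → All (λ S → length S ≤ w) seq × length seq ≤ 2 * blockSize w × Φ (applied seq days) < Φ days
  improving-moves {days} good (sol , goodSol , enough) deficit>0 with items days sol (trans (sameRows good) (sym (sameRows goodSol)))
  ... | its , refl , refl = seq , movesOf-bounded (sub-All sb bounds) ,
      ≤-trans (≤-reflexive (movesOf-length b)) (*-monoʳ-≤ 2 b-small) ,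
      ≤-trans (better (countAt (applied seq (map oldDay its))) new-counts)
        (≤-reflexive (sumTo-cong w (λ i → cong (k̂ ∸_) (sym (countAt-old its i)))))
    where
    block = improving-block newBit oldBit (λ i it → bitAt≤1 (Item.new it) i) (λ i it → bitAt≤1 (Item.old it) i) w k̂ its
      (λ {i} i<w → ≤-trans (enough i<w) (≤-reflexive (countAt-new its i)))
      (≤-trans deficit>0 (≤-reflexive (sumTo-cong w (λ i → cong (k̂ ∸_) (countAt-old its i)))))
    b       = proj₁ block
    sb      = proj₁ (proj₂ block)
    b-small = proj₁ (proj₂ (proj₂ block))
    better  = proj₂ (proj₂ (proj₂ block))
    seq     = movesOf b
    bounds : All (λ it → length (Item.old it) ≤ w × length (Item.new it) ≤ w) its
    bounds = All.zip (AllP.map⁻ (allBounded good) , AllP.map⁻ (allBounded goodSol))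
    loop = applyLoop fuel seq (map oldDay its)
    nothing-left : proj₁ loop ≼ []
    nothing-left = subst (λ x → proj₁ (applyLoop fuel x (map oldDay its)) ≼ []) (++-identityʳ seq)
      (greedy fuel sb (AllP.map⁻ (good-short good)) (AllP.map⁻ (allValid goodSol)) [])
    ≼[] : ∀ {r} → r ≼ [] → r ≡ []
    ≼[] same = refl
    flat : ∀ its i → olds (movesOf its) i ≡ sumBy (oldBit i) its × news (movesOf its) i ≡ sumBy (newBit i) its
    flat its i =
      trans (cong (λ x → olds x i) (sym (++-identityʳ (movesOf its)))) (trans (movesOf-olds its [] i) (+-identityʳ _)) ,
      trans (cong (λ x → news x i) (sym (++-identityʳ (movesOf its)))) (trans (movesOf-news its [] i) (+-identityʳ _))
    new-counts : ∀ i → countAt (proj₂ loop) i + sumBy (oldBit i) b ≡ sumBy (oldBit i) its + sumBy (newBit i) b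
    new-counts i = begin
      countAt (proj₂ loop) i + sumBy (oldBit i) b ≡⟨ cong (countAt (proj₂ loop) i +_) (proj₁ (flat b i)) ⟨
      countAt (proj₂ loop) i + olds seq i         ≡⟨ +-identityʳ _ ⟨
      countAt (proj₂ loop) i + olds seq i + 0     ≡⟨ cong (λ r → countAt (proj₂ loop) i + olds seq i + news r i) (≼[] nothing-left) ⟨
      countAt (proj₂ loop) i + olds seq i + news (proj₁ loop) i
        ≡⟨ counts (applyLoop-spec fuel w seq (map oldDay its) (good-short good)) i ⟩
      countAt (map oldDay its) i + news seq i + olds (proj₁ loop) i
        ≡⟨ cong (λ r → countAt (map oldDay its) i + news seq i + olds r i) (≼[] nothing-left) ⟩
      countAt (map oldDay its) i + news seq i + 0 ≡⟨ +-identityʳ _ ⟩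
      countAt (map oldDay its) i + news seq i     ≡⟨ cong₂ _+_ (countAt-old its i) (proj₂ (flat b i)) ⟩
      sumBy (oldBit i) its + sumBy (newBit i) b   ∎
      where open ≡-Reasoning

  improveV : List (List Bool) → List DayV → List DayV
  improveV seq days = eval improveStep (fuel ∷ nᵘ ∷ kᵘ ∷ seq ∷ days ∷ [])

  accepts : List (List Bool) → List DayV → Bool
  accepts seq days = eval less (eval deficit (nᵘ ∷ kᵘ ∷ applied seq days ∷ []) ∷ eval deficit (nᵘ ∷ kᵘ ∷ days ∷ []) ∷ [])

  accepts-correct : ∀ seq days → accepts seq days ≡ true ⇔ Φ (applied seq days) < Φ days
  accepts-correct seq days = ⇔-trans (less-correct (eval deficit (nᵘ ∷ kᵘ ∷ applied seq days ∷ [])) (eval deficit (nᵘ ∷ kᵘ ∷ days ∷ [])))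
    (≤-cong⇔ (cong suc (deficit-length nᵘ kᵘ (applied seq days))) (deficit-length nᵘ kᵘ days))

  improveV-good : ∀ {seq days} → All (λ S → length S ≤ w) seq → Good days → Good (improveV seq days)
  improveV-good {seq} {days} b good = if-view Good (accepts seq days) (λ _ → applied-good b good) (λ _ → good)

  improveV-progress : ∀ seq days → Φ (improveV seq days) < Φ days ⊎ improveV seq days ≡ days
  improveV-progress seq days = if-view (λ x → Φ x < Φ days ⊎ x ≡ days) (accepts seq days)
    (λ eq → inj₁ (Equivalence.to (accepts-correct seq days) eq)) (λ _ → inj₂ refl)

  improveV-strict : ∀ seq days → Φ (applied seq days) < Φ days → Φ (improveV seq days) < Φ days
  improveV-strict seq days lt = if-view (λ x → Φ x < Φ days) (accepts seq days)
    (λ eq → Equivalence.to (accepts-correct seq days) eq)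
    (λ eq → ⊥-elim (true≢false (trans (sym (Equivalence.from (accepts-correct seq days) lt)) eq)))
    where
    true≢false : true ≢ false
    true≢false ()

  improveAll : List (List (List Bool)) → List DayV → List DayV
  improveAll ss days = foldr improveV days ss

  improveAll-good : ∀ {ss days} → All (All (λ S → length S ≤ w)) ss → Good days → Good (improveAll ss days)
  improveAll-good []       good = good
  improveAll-good (b ∷ bs) good = improveV-good b (improveAll-good bs good)

  improveAll-progress : ∀ ss days → Φ (improveAll ss days) < Φ days ⊎ improveAll ss days ≡ days
  improveAll-progress []         days = inj₂ refl
  improveAll-progress (seq ∷ ss) days with improveAll-progress ss days | improveV-progress seq (improveAll ss days)
  ... | inj₁ lt | inj₁ lt′ = inj₁ (<-trans lt′ lt)
  ... | inj₁ lt | inj₂ eq  = inj₁ (subst (λ x → Φ x < Φ days) (sym eq) lt)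
  ... | inj₂ eq | inj₁ lt  = inj₁ (subst (λ x → Φ (improveV seq (improveAll ss days)) < Φ x) eq lt)
  ... | inj₂ eq | inj₂ eq′ = inj₂ (trans eq′ eq)

  -- Sequences are tried on the current days, not on the initial ones. If an earlier one was
  -- accepted, the deficit has already dropped and never rises again; if none was, the days are
  -- unchanged when `seq` gets its turn.
  improveAll-strict : ∀ {ss days seq} → seq ∈ ss → Φ (applied seq days) < Φ days → Φ (improveAll ss days) < Φ days
  improveAll-strict {_ ∷ ss} {days} {seq} (here refl) lt with improveAll-progress ss days
  ... | inj₂ eq  = subst (λ x → Φ (improveV seq x) < Φ days) (sym eq) (improveV-strict seq days lt)
  ... | inj₁ lt′ with improveV-progress seq (improveAll ss days)
  ...   | inj₁ lt″ = <-trans lt″ lt′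
  ...   | inj₂ eq  = subst (λ x → Φ x < Φ days) (sym eq) lt′
  improveAll-strict {seq′ ∷ ss} {days} (there seq∈) lt with improveV-progress seq′ (improveAll ss days)
  ... | inj₁ lt′ = <-trans lt′ (improveAll-strict seq∈ lt)
  ... | inj₂ eq  = subst (λ x → Φ x < Φ days) (sym eq) (improveAll-strict seq∈ lt)

  searchLoop : List ⊤ → List DayV → List DayV
  searchLoop rounds days = foldr (λ _ acc → improveAll seqs acc) days rounds

  module _ (allMoves : ∀ seq → length seq ≤ 2 * blockSize w → All (λ S → length S ≤ w) seq → seq ∈ seqs)
           (onlyBounded : All (All (λ S → length S ≤ w)) seqs) where

    searchLoop-good : ∀ rounds {days} → Good days → Good (searchLoop rounds days)
    searchLoop-good []           good = good
    searchLoop-good (_ ∷ rounds) good = improveAll-good onlyBounded (searchLoop-good rounds good)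

    -- Truncated subtraction matches both cases: a positive deficit drops by at least one, and a
    -- deficit of zero stays zero.
    searchLoop-deficit : ∀ rounds {days} → Good days → Solution → Φ (searchLoop rounds days) ≤ Φ days ∸ length rounds
    searchLoop-deficit []           good sol = ≤-refl
    searchLoop-deficit (_ ∷ rounds) {days} good sol with Φ (searchLoop rounds days) in eq
    ... | zero = ≤-trans (≤-trans never-worse (≤-reflexive eq)) z≤n
      where
      never-worse : Φ (improveAll seqs (searchLoop rounds days)) ≤ Φ (searchLoop rounds days)
      never-worse with improveAll-progress seqs (searchLoop rounds days)
      ... | inj₁ lt  = <⇒≤ lt
      ... | inj₂ eq′ = ≤-reflexive (cong Φ eq′)
    ... | suc j =
      let seq , b , len , lt = improving-moves (searchLoop-good rounds good) sol (≤-trans (s≤s z≤n) (≤-reflexive (sym eq)))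
          lt′ = improveAll-strict (allMoves seq len b) lt
      in ≤-trans (∸-monoˡ-≤ 1 lt′) (≤-trans (∸-monoˡ-≤ 1 (searchLoop-deficit rounds good sol))
           (≤-reflexive (trans (∸-+-assoc (Φ days) (length rounds) 1) (cong (Φ days ∸_) (+-comm (length rounds) 1)))))

    search-correct : ∀ {days} → Good days → eval search (fuel ∷ nᵘ ∷ kᵘ ∷ seqs ∷ days ∷ []) ≡ true ⇔ Solution
    search-correct {days} good = ⇔-trans (verdict (eval deficit (nᵘ ∷ kᵘ ∷ res ∷ [])))
      (⇔-trans (≡-cong⇔ (deficit-length nᵘ kᵘ res)) (mk⇔ found none-left))
      where
      rounds = eval deficit (nᵘ ∷ kᵘ ∷ days ∷ [])
      res    = searchLoop rounds days
      verdict : ∀ (r : List ⊤) → caseList r true (λ _ _ → false) ≡ true ⇔ length r ≡ 0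
      verdict []      = mk⇔ (λ _ → refl) (λ _ → refl)
      verdict (_ ∷ _) = mk⇔ (λ ()) (λ ())
      ≡-cong⇔ : ∀ {x y} → x ≡ y → x ≡ 0 ⇔ y ≡ 0
      ≡-cong⇔ refl = mk⇔ id id
      found : Φ res ≡ 0 → Solution
      found eq = res , searchLoop-good rounds good , λ i<w → m∸n≡0⇒m≤n (sumTo-zero w eq i<w)
      none-left : Solution → Φ res ≡ 0
      none-left sol = n≤0⇒n≡0 (≤-trans (searchLoop-deficit rounds good sol)
        (≤-reflexive (trans (cong (Φ days ∸_) (deficit-length nᵘ kᵘ days)) (n∸n≡0 (Φ days)))))

-- Schedules and sets of on-time clients

module _ where
  open import Data.Fin using (fromℕ; punchIn)
  open import Data.Fin.Permutation using (Permutation′; _⟨$⟩ʳ_; lift₀; insert; insert-punchIn) renaming (id to idᵖ)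
  open import Data.Nat.ListAction using (sum)

  sum-tabulate-≤ : ∀ {r} {f g : Fin r → ℕ} → (∀ i → f i ≤ g i) → sum (tabulate f) ≤ sum (tabulate g)
  sum-tabulate-≤ {zero}  le = z≤n
  sum-tabulate-≤ {suc r} le = +-mono-≤ (le zero) (sum-tabulate-≤ (le ∘ suc))

  -- The permutation is built client by client: a selected client is put before all the later ones,
  -- any other behind them.
  selected-first : ∀ {r} (b : Fin r → Bool) → Σ (Permutation′ r) λ π →
                   ∀ x y → b y ≡ true → toℕ (π ⟨$⟩ʳ x) ≤ toℕ (π ⟨$⟩ʳ y) → b x ≡ true
  selected-first {zero}  b = idᵖ , λ ()
  selected-first {suc r} b with selected-first (b ∘ suc) | b zero in eq
  ... | π , first | true = lift₀ π , first′
    where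
    first′ : ∀ x y → b y ≡ true → toℕ (lift₀ π ⟨$⟩ʳ x) ≤ toℕ (lift₀ π ⟨$⟩ʳ y) → b x ≡ true
    first′ zero    y       by le       = eq
    first′ (suc x) zero    by ()
    first′ (suc x) (suc y) by (s≤s le) = first x y by le
  ... | π , first | false = π′ , first′
    where
    π′ : Permutation′ (suc r)
    π′ = insert zero (fromℕ r) π
    punchIn-last : ∀ {r} (i : Fin r) → toℕ (punchIn (fromℕ r) i) ≡ toℕ i
    punchIn-last zero    = refl
    punchIn-last (suc i) = cong suc (punchIn-last i)
    at-suc : ∀ i → toℕ (π′ ⟨$⟩ʳ suc i) ≡ toℕ (π ⟨$⟩ʳ i)
    at-suc i = trans (cong toℕ (insert-punchIn zero (fromℕ r) π i)) (punchIn-last (π ⟨$⟩ʳ i))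
    first′ : ∀ x y → b y ≡ true → toℕ (π′ ⟨$⟩ʳ x) ≤ toℕ (π′ ⟨$⟩ʳ y) → b x ≡ true
    first′ x       zero    by le with trans (sym eq) by
    ... | ()
    first′ zero    (suc y) by le = ⊥-elim (<-irrefl refl (≤-trans (Fin.toℕ<n (π ⟨$⟩ʳ y))
      (≤-trans (≤-reflexive (sym (Fin.toℕ-fromℕ r))) (≤-trans le (≤-reflexive (at-suc y))))))
    first′ (suc x) (suc y) by le = first x y by (subst₂ _≤_ (at-suc x) (at-suc y) le)

  maximal : ∀ {r} (b : Fin r → Bool) (f : Fin r → ℕ) →
            (∀ i → b i ≡ false) ⊎ Σ (Fin r) λ i → b i ≡ true × (∀ i′ → b i′ ≡ true → f i′ ≤ f i)
  maximal {zero}  b f = inj₁ λ ()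
  maximal {suc r} b f with maximal (b ∘ suc) (f ∘ suc) | b zero in eq
  ... | inj₁ none | false = inj₁ λ { zero → eq ; (suc i) → none i }
  ... | inj₁ none | true  = inj₂ (zero , eq , λ { zero _ → ≤-refl ; (suc i) bi → ⊥-elim (contra (trans (sym (none i)) bi)) })
    where
    contra : false ≢ true
    contra ()
  ... | inj₂ (i , bi , max) | false = inj₂ (suc i , bi , λ { zero b0 → ⊥-elim (contra (trans (sym eq) b0)) ; (suc i′) bi′ → max i′ bi′ })
    where
    contra : false ≢ true
    contra ()
  ... | inj₂ (i , bi , max) | true with ≤-total (f zero) (f (suc i))
  ...   | inj₁ le = inj₂ (suc i , bi , λ { zero _ → le ; (suc i′) bi′ → max i′ bi′ })
  ...   | inj₂ ge = inj₂ (zero , eq , λ { zero _ → ≤-refl ; (suc i′) bi′ → ≤-trans (max i′ bi′) ge })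

  weight-sum : ∀ {r} (q : Fin r → ℕ) S → weight S (tabulate (λ i → bin (q i))) ≡ sum (tabulate λ i → bitAt S (toℕ i) * q i)
  weight-sum {zero}  q []      = refl
  weight-sum {zero}  q (b ∷ S) = refl
  weight-sum {suc r} q []      = weight-none (suc r)
    where
    weight-none : ∀ r → 0 ≡ sum (tabulate {n = r} λ i → 0)
    weight-none zero    = refl
    weight-none (suc r) = weight-none r
  weight-sum {suc r} q (b ∷ S) = cong₂ _+_ (cong (flag b *_) (value-bin (q zero))) (weight-sum (q ∘ suc) S)

  bitAt-tabulate : ∀ {r} (b : Fin r → Bool) i → bitAt (tabulate b) (toℕ i) ≡ flag (b i)
  bitAt-tabulate b zero    = refl
  bitAt-tabulate b (suc i) = bitAt-tabulate (b ∘ suc) i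

  countAt-tabulate : ∀ {r} (row : Fin r → List (List Bool)) (S : Fin r → List Bool) i →
                     countAt (tabulate λ j → row j , S j) i ≡ sum (tabulate λ j → bitAt (S j) i)
  countAt-tabulate {zero}  row S i = refl
  countAt-tabulate {suc r} row S i = cong (bitAt (S zero) i +_) (countAt-tabulate (row ∘ suc) (S ∘ suc) i)

  filter-count : ∀ {A : Set} {P : A → Set} (P? : ∀ x → Dec (P x)) {r} (f : Fin r → A) →
                 length (filter P? (tabulate f)) ≡ sum (tabulate λ j → flag ⌊ P? (f j) ⌋)
  filter-count P? {zero}  f = refl
  filter-count P? {suc r} f with P? (f zero)
  ... | yes _ = cong suc (filter-count P? (f ∘ suc))
  ... | no  _ = filter-count P? (f ∘ suc)

  ⌊⌋-holds : ∀ {P : Set} (P? : Dec P) → ⌊ P? ⌋ ≡ true → P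
  ⌊⌋-holds (yes p) _ = p

  module _ (I : Instance) where

    rowsOf : List (List (List Bool))
    rowsOf = tabulate λ j → reverse (dayRow I j)

    -- Gives access to the summand that is local to the definition of `completion`.
    summands : ∀ σ i j → Σ (Fin (n I) → ℕ) λ f → completion I σ i j ≡ sum (tabulate f)
    summands σ i j = _ , refl

    summand-cases : ∀ σ i j i₀ →
      (toℕ (σ j ⟨$⟩ʳ i₀) ≤ toℕ (σ j ⟨$⟩ʳ i) × proj₁ (summands σ i j) i₀ ≡ p I i₀ j)
      ⊎ (¬ toℕ (σ j ⟨$⟩ʳ i₀) ≤ toℕ (σ j ⟨$⟩ʳ i) × proj₁ (summands σ i j) i₀ ≡ 0)
    summand-cases σ i j i₀ with (σ j ⟨$⟩ʳ i₀) Fin.≤? (σ j ⟨$⟩ʳ i)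
    ... | yes le = inj₁ (le , refl)
    ... | no gt  = inj₂ (gt , refl)

    onTime? : ∀ σ i j → Dec (completion I σ i j ≤ d I j)
    onTime? σ i j = completion I σ i j ≤? d I j

    onTimeDays-sum : ∀ σ i → onTimeDays I σ i ≡ sum (tabulate λ j → flag ⌊ onTime? σ i j ⌋)
    onTimeDays-sum σ i = filter-count (onTime? σ i) (λ j → j)

    IsSolution : List DayV → Set
    IsSolution sol = map proj₁ sol ≡ rowsOf × All Valid sol × (∀ {i} → i < n I → toℕ (k I) ≤ countAt sol i)

    sets-of : ∀ {r} (row : Fin r → List (List Bool)) sol → map proj₁ sol ≡ tabulate row →
              Σ (Fin r → List Bool) λ S → sol ≡ tabulate (λ j → row j , S j)
    sets-of {zero}  row []               eq = (λ ()) , refl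
    sets-of {suc r} row ((st , S) ∷ sol) eq with ∷-injective eq
    ... | refl , eq′ = let T , eq″ = sets-of (row ∘ suc) sol eq′ in
      (λ { zero → S ; (suc j) → T j }) , cong (_ ∷_) eq″

    hasBit : List Bool → ℕ → Bool
    hasBit []      i       = false
    hasBit (b ∷ S) zero    = b
    hasBit (b ∷ S) (suc i) = hasBit S i

    bitAt-hasBit : ∀ S i → bitAt S i ≡ flag (hasBit S i)
    bitAt-hasBit []      i       = refl
    bitAt-hasBit (b ∷ S) zero    = refl
    bitAt-hasBit (b ∷ S) (suc i) = bitAt-hasBit S i

    valid-sum : ∀ j S → Valid (reverse (dayRow I j) , S) ⇔ sum (tabulate λ i → flag (hasBit S (toℕ i)) * p I i j) ≤ d I j
    valid-sum j S = subst (λ row → FitsDay S row ⇔ sum (tabulate λ i → flag (hasBit S (toℕ i)) * p I i j) ≤ d I j) (sym (reverse-involutive (dayRow I j)))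
      (≤-cong⇔ (trans (weight-sum (λ i → p I i j) S)
          (cong sum (tabulate-cong λ i → cong (_* p I i j) (bitAt-hasBit S (toℕ i))))) (value-bin (d I j)))

    solution⇒schedules : ∀ {sol} → IsSolution sol → ESSD I
    solution⇒schedules {sol} (eq , valids , enough) with sets-of (λ j → reverse (dayRow I j)) sol eq
    ... | S , refl = σ , λ i → ≤-trans (enough (Fin.toℕ<n i)) (≤-trans (≤-reflexive (countAt-tabulate _ S (toℕ i)))
                       (≤-trans (sum-tabulate-≤ (on-time i)) (≤-reflexive (sym (onTimeDays-sum σ i)))))
      where
      first : ∀ j → _
      first j = selected-first {n I} (λ i → hasBit (S j) (toℕ i))
      σ : Schedules I
      σ j = proj₁ (first j)
      completes : ∀ i j → hasBit (S j) (toℕ i) ≡ true → completion I σ i j ≤ d I j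
      completes i j hit = ≤-trans (sum-tabulate-≤ summand-≤) (Equivalence.to (valid-sum j (S j)) (AllP.tabulate⁻ valids j))
        where
        summand-≤ : ∀ i₀ → proj₁ (summands σ i j) i₀ ≤ flag (hasBit (S j) (toℕ i₀)) * p I i₀ j
        summand-≤ i₀ with summand-cases σ i j i₀
        -- Whoever is processed no later than a selected client is selected too, so its time is
        -- counted in the weight of the set.
        ... | inj₁ (le , eq₀) rewrite proj₂ (first j) i₀ i hit le = ≤-trans (≤-reflexive eq₀) (m≤m+n _ 0)
        ... | inj₂ (_ , eq₀)  = ≤-trans (≤-reflexive eq₀) z≤n
      on-time : ∀ i j → bitAt (S j) (toℕ i) ≤ flag ⌊ onTime? σ i j ⌋
      on-time i j rewrite bitAt-hasBit (S j) (toℕ i) with hasBit (S j) (toℕ i) in eq | onTime? σ i j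
      ... | false | _      = z≤n
      ... | true  | yes _  = ≤-refl
      ... | true  | no late = ⊥-elim (late (completes i j eq))

    schedules⇒solution : ESSD I → Σ (List DayV) λ sol → IsSolution sol × Bounded (n I) sol
    schedules⇒solution (σ , enough) = sol , (map-tabulate _ proj₁ , AllP.tabulate⁺ valid-day , counts′) ,
        AllP.tabulate⁺ (λ j → ≤-reflexive (length-tabulate (on j)))
      where
      on : Fin (m I) → Fin (n I) → Bool
      on j i = ⌊ onTime? σ i j ⌋
      sol : List DayV
      sol = tabulate λ j → reverse (dayRow I j) , tabulate (on j)
      hasBit-tabulate : ∀ {r} (b : Fin r → Bool) i → hasBit (tabulate b) (toℕ i) ≡ b i
      hasBit-tabulate b zero    = refl
      hasBit-tabulate b (suc i) = hasBit-tabulate (b ∘ suc) i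
      total-≤ : ∀ j → sum (tabulate λ i → flag (on j i) * p I i j) ≤ d I j
      -- The on-time client in the latest position waits for all the others that are on time, so its
      -- completion time is at least their total.
      total-≤ j with maximal (on j) (λ i → toℕ (σ j ⟨$⟩ʳ i))
      ... | inj₁ none = ≤-trans (sum-tabulate-≤ {g = λ _ → 0} λ i → ≤-reflexive (cong (λ b → flag b * p I i j) (none i)))
                          (≤-trans (≤-reflexive (zeros (n I))) z≤n)
        where
        zeros : ∀ r → sum (tabulate {n = r} λ i → 0) ≡ 0
        zeros zero    = refl
        zeros (suc r) = zeros r
      ... | inj₂ (i , oni , max) = ≤-trans (sum-tabulate-≤ summand-≥) (⌊⌋-holds (onTime? σ i j) oni)
        where
        summand-≥ : ∀ i₀ → flag (on j i₀) * p I i₀ j ≤ proj₁ (summands σ i j) i₀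
        summand-≥ i₀ with on j i₀ in eq
        ... | false = z≤n
        ... | true  = ≤-reflexive (trans (+-identityʳ _) (sym (before (summand-cases σ i j i₀))))
          where
          before : _ → proj₁ (summands σ i j) i₀ ≡ p I i₀ j
          before (inj₁ (_ , eq₀))  = eq₀
          before (inj₂ (gt , _)) = ⊥-elim (gt (max i₀ eq))
      valid-day : ∀ j → Valid (reverse (dayRow I j) , tabulate (on j))
      valid-day j = Equivalence.from (valid-sum j (tabulate (on j)))
        (≤-trans (≤-reflexive (cong sum (tabulate-cong λ i → cong (λ b → flag b * p I i j) (hasBit-tabulate (on j) i)))) (total-≤ j))
      counts′ : ∀ {i} → i < n I → toℕ (k I) ≤ countAt sol i
      counts′ {i} i<n = subst (λ x → toℕ (k I) ≤ countAt sol x) (Fin.toℕ-fromℕ< i<n)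
        (≤-trans (enough i′) (≤-reflexive (trans (onTimeDays-sum σ i′)
          (sym (trans (countAt-tabulate _ (λ j → tabulate (on j)) (toℕ i′)) (cong sum (tabulate-cong λ j → bitAt-tabulate (on j) i′)))))))
        where
        i′ = Data.Fin.fromℕ< i<n

-- Sizes of the accumulated values

mutual
  -- Expressions without folds satisfy `Fits` for every bound. As a Boolean test this is settled by
  -- `refl`.
  free : ∀ {Γ τ} → Exp Γ τ → Bool
  free (cond e a b)  = free e ∧ free a ∧ free b
  free (pair a b)    = free a ∧ free b
  free (split e b)   = free e ∧ free b
  free (cons a b)    = free a ∧ free b
  free (caseL e a b) = free e ∧ free a ∧ free b
  free (rev e)       = free e
  free (fold l i b)  = false
  free (letE e b)    = free e ∧ free b
  free (call f as)   = frees as ∧ free f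
  free _             = true

  frees : ∀ {Γ Δ} → Args Γ Δ → Bool
  frees []       = true
  frees (a ∷ as) = free a ∧ frees as

both : ∀ a {b} → a ∧ b ≡ true → a ≡ true × b ≡ true
both true eq = refl , eq

mutual
  fits-free : ∀ {N Γ τ} (e : Exp Γ τ) {ρ} → free e ≡ true → Fits N e ρ
  fits-free (var x)       eq = tt
  fits-free unit          eq = tt
  fits-free (bit b)       eq = tt
  fits-free nil           eq = tt
  fits-free (cond e a b)  eq with both (free e) eq
  ... | eq₁ , eq′ with both (free a) eq′
  ...   | eq₂ , eq₃ = fits-free e eq₁ , fits-free a eq₂ , fits-free b eq₃
  fits-free (pair a b)    eq with both (free a) eq
  ... | eq₁ , eq₂ = fits-free a eq₁ , fits-free b eq₂
  fits-free (split e b)   eq with both (free e) eq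
  ... | eq₁ , eq₂ = fits-free e eq₁ , fits-free b eq₂
  fits-free (cons a b)    eq with both (free a) eq
  ... | eq₁ , eq₂ = fits-free a eq₁ , fits-free b eq₂
  fits-free {N} (caseL e a b) {ρ} eq with both (free e) eq
  ... | eq₁ , eq′ with both (free a) eq′
  ...   | eq₂ , eq₃ = fits-free e eq₁ , fits-free a eq₂ , branches (eval e ρ)
    where
    branches : ∀ xs → caseList xs ⊤ (λ x xs′ → Fits N b (x ∷ xs′ ∷ ρ))
    branches []       = tt
    branches (x ∷ xs) = fits-free b eq₃
  fits-free (rev e)       eq = fits-free e eq
  fits-free (letE e b)    eq with both (free e) eq
  ... | eq₁ , eq₂ = fits-free e eq₁ , fits-free b eq₂
  fits-free (call f as)   eq with both (frees as) eq
  ... | eq₁ , eq₂ = fits-frees as eq₁ , fits-free f eq₂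

  fits-frees : ∀ {N Γ Δ} (as : Args Γ Δ) {ρ} → frees as ≡ true → FitsArgs N as ρ
  fits-frees []       eq = tt
  fits-frees (a ∷ as) eq with both (free a) eq
  ... | eq₁ , eq₂ = fits-free a eq₁ , fits-frees as eq₂

mutual
  fits-mono : ∀ {N N′ Γ τ} (e : Exp Γ τ) {ρ} → N ≤ N′ → Fits N e ρ → Fits N′ e ρ
  fits-mono (var x)       le f = tt
  fits-mono unit          le f = tt
  fits-mono (bit b)       le f = tt
  fits-mono nil           le f = tt
  fits-mono (cond e a b)  le (f , g , h) = fits-mono e le f , fits-mono a le g , fits-mono b le h
  fits-mono (pair a b)    le (f , g) = fits-mono a le f , fits-mono b le g
  fits-mono (split e b)   le (f , g) = fits-mono e le f , fits-mono b le g
  fits-mono (cons a b)    le (f , g) = fits-mono a le f , fits-mono b le g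
  fits-mono {N} {N′} (caseL e a b) {ρ} le (f , g , h) = fits-mono e le f , fits-mono a le g , branches (eval e ρ) h
    where
    branches : ∀ xs → caseList xs ⊤ (λ x xs′ → Fits N b (x ∷ xs′ ∷ ρ)) → caseList xs ⊤ (λ x xs′ → Fits N′ b (x ∷ xs′ ∷ ρ))
    branches []       h = tt
    branches (x ∷ xs) h = fits-mono b le h
  fits-mono (rev e)       le f = fits-mono e le f
  fits-mono (fold l i b) {ρ} le (f , g , h) = fits-mono l le f , fits-mono i le g , fitsFold-mono b le (eval l ρ) h
  fits-mono (letE e b)    le (f , g) = fits-mono e le f , fits-mono b le g
  fits-mono (call f as)   le (g , h) = fitsArgs-mono as le g , fits-mono f le h

  fitsFold-mono : ∀ {N N′ Γ σ τ} (b : Exp (σ ∷ τ ∷ Γ) τ) {ρ i} → N ≤ N′ → ∀ xs → FitsFold N b ρ i xs → FitsFold N′ b ρ i xs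
  fitsFold-mono b le []       f = tt
  fitsFold-mono b le (x ∷ xs) (f , g , h) = ≤-trans f le , fits-mono b le g , fitsFold-mono b le xs h

  fitsArgs-mono : ∀ {N N′ Γ Δ} (as : Args Γ Δ) {ρ} → N ≤ N′ → FitsArgs N as ρ → FitsArgs N′ as ρ
  fitsArgs-mono []       le f = tt
  fitsArgs-mono (a ∷ as) le (f , g) = fits-mono a le f , fitsArgs-mono as le g

mutual
  -- An evaluation meets finitely many accumulators, so some bound exists. This suffices for
  -- `moveSeqs`, whose cost depends on n alone and may be arbitrary.
  fits-some : ∀ {Γ τ} (e : Exp Γ τ) ρ → Σ ℕ λ N → Fits N e ρ
  fits-some (var x)       ρ = 0 , tt
  fits-some unit          ρ = 0 , tt
  fits-some (bit b)       ρ = 0 , tt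
  fits-some nil           ρ = 0 , tt
  fits-some (cond e a b)  ρ =
    let N₁ , f = fits-some e ρ ; N₂ , g = fits-some a ρ ; N₃ , h = fits-some b ρ
    in N₁ + (N₂ + N₃) , fits-mono e (m≤m+n N₁ _) f , fits-mono a (≤-trans (m≤m+n N₂ N₃) (m≤n+m _ N₁)) g , fits-mono b (≤-trans (m≤n+m N₃ N₂) (m≤n+m _ N₁)) h
  fits-some (pair a b)    ρ =
    let N₁ , f = fits-some a ρ ; N₂ , g = fits-some b ρ in N₁ + N₂ , fits-mono a (m≤m+n N₁ N₂) f , fits-mono b (m≤n+m N₂ N₁) g
  fits-some (split e b)   ρ =
    let N₁ , f = fits-some e ρ ; N₂ , g = fits-some b _ in N₁ + N₂ , fits-mono e (m≤m+n N₁ N₂) f , fits-mono b (m≤n+m N₂ N₁) g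
  fits-some (cons a b)    ρ =
    let N₁ , f = fits-some a ρ ; N₂ , g = fits-some b ρ in N₁ + N₂ , fits-mono a (m≤m+n N₁ N₂) f , fits-mono b (m≤n+m N₂ N₁) g
  fits-some (caseL {σ} e a b) ρ =
    let N₁ , f = fits-some e ρ ; N₂ , g = fits-some a ρ ; N₃ , h = branches (eval e ρ)
    in N₁ + (N₂ + N₃) , fits-mono e (m≤m+n N₁ _) f , fits-mono a (≤-trans (m≤m+n N₂ N₃) (m≤n+m _ N₁)) g ,
       weaken-branches (≤-trans (m≤n+m N₃ N₂) (m≤n+m _ N₁)) (eval e ρ) h
    where
    branches : ∀ xs → Σ ℕ λ N → caseList xs ⊤ (λ x xs′ → Fits N b (x ∷ xs′ ∷ ρ))
    branches []       = 0 , tt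
    branches (x ∷ xs) = fits-some b (x ∷ xs ∷ ρ)
    weaken-branches : ∀ {N N′} → N ≤ N′ → ∀ xs → caseList xs ⊤ (λ x xs′ → Fits N b (x ∷ xs′ ∷ ρ)) → caseList xs ⊤ (λ x xs′ → Fits N′ b (x ∷ xs′ ∷ ρ))
    weaken-branches le []       h = tt
    weaken-branches le (x ∷ xs) h = fits-mono b le h
  fits-some (rev e)       ρ = fits-some e ρ
  fits-some (fold l i b)  ρ =
    let N₁ , f = fits-some l ρ ; N₂ , g = fits-some i ρ ; N₃ , h = fitsFold-some b ρ (eval i ρ) (eval l ρ)
    in N₁ + (N₂ + N₃) , fits-mono l (m≤m+n N₁ _) f , fits-mono i (≤-trans (m≤m+n N₂ N₃) (m≤n+m _ N₁)) g ,
       fitsFold-mono b (≤-trans (m≤n+m N₃ N₂) (m≤n+m _ N₁)) (eval l ρ) h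
  fits-some (letE e b)    ρ =
    let N₁ , f = fits-some e ρ ; N₂ , g = fits-some b _ in N₁ + N₂ , fits-mono e (m≤m+n N₁ N₂) f , fits-mono b (m≤n+m N₂ N₁) g
  fits-some (call f as)   ρ =
    let N₁ , g = fitsArgs-some as ρ ; N₂ , h = fits-some f (evals as ρ)
    in N₁ + N₂ , fitsArgs-mono as (m≤m+n N₁ N₂) g , fits-mono f (m≤n+m N₂ N₁) h

  fitsFold-some : ∀ {Γ σ τ} (b : Exp (σ ∷ τ ∷ Γ) τ) ρ i xs → Σ ℕ λ N → FitsFold N b ρ i xs
  fitsFold-some b ρ i []       = 0 , tt
  fitsFold-some {τ = τ} b ρ i (x ∷ xs) =
    let acc = foldr (λ x acc → eval b (x ∷ acc ∷ ρ)) i xs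
        N₁ = sz τ acc ; N₂ , g = fits-some b (x ∷ acc ∷ ρ) ; N₃ , h = fitsFold-some b ρ i xs
    in N₁ + (N₂ + N₃) , m≤m+n N₁ _ , fits-mono b (≤-trans (m≤m+n N₂ N₃) (m≤n+m _ N₁)) g ,
       fitsFold-mono b (≤-trans (m≤n+m N₃ N₂) (m≤n+m _ N₁)) xs h

  fitsArgs-some : ∀ {Γ Δ} (as : Args Γ Δ) ρ → Σ ℕ λ N → FitsArgs N as ρ
  fitsArgs-some []       ρ = 0 , tt
  fitsArgs-some (a ∷ as) ρ =
    let N₁ , f = fits-some a ρ ; N₂ , g = fitsArgs-some as ρ in N₁ + N₂ , fits-mono a (m≤m+n N₁ N₂) f , fitsArgs-mono as (m≤n+m N₂ N₁) g

sz≥1 : ∀ τ a → 1 ≤ sz τ a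
sz≥1 τ a = size≥1 (tree τ a)

module _ {Γ σ τ} (b : Exp (σ ∷ τ ∷ Γ) τ) (ρ : Env Γ) (K : ℕ)
         (grows : ∀ x acc → sz τ (eval b (x ∷ acc ∷ ρ)) ≤ K * suc (sz σ x) + sz τ acc) where

  foldV : ⟦ τ ⟧ → List ⟦ σ ⟧ → ⟦ τ ⟧
  foldV = foldr (λ x acc → eval b (x ∷ acc ∷ ρ))

  -- An element contributes exactly `suc (sz σ x)` to the size of the list, so the growth of all
  -- rounds adds up to `K` times that size. The bound stays additive in the initial value, and this
  -- keeps nested folds polynomial.
  fold-size : ∀ i xs → sz τ (foldV i xs) ≤ sz τ i + K * sz (𝕃 σ) xs
  fold-size i []       = m≤m+n _ _
  fold-size i (x ∷ xs) = ≤-trans (grows x (foldV i xs)) (≤-trans (+-monoʳ-≤ (K * suc (sz σ x)) (fold-size i xs))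
    (≤-reflexive (arith K (suc (sz σ x)) (sz τ i) (sz (𝕃 σ) xs))))
    where
    arith : ∀ k x i l → k * x + (i + k * l) ≡ i + k * (x + l)
    arith = solve-∀

  fits-fold : ∀ {N} i xs → sz τ i + K * sz (𝕃 σ) xs ≤ N →
    (∀ x acc → sz σ x ≤ sz (𝕃 σ) xs → sz τ acc ≤ sz τ i + K * sz (𝕃 σ) xs → Fits N b (x ∷ acc ∷ ρ)) →
    FitsFold N b ρ i xs
  fits-fold i []       le body = tt
  fits-fold i (x ∷ xs) le body =
    ≤-trans (fold-size i xs) (≤-trans shorter le) ,
    body x (foldV i xs) (≤-trans (m≤m+n (sz σ x) _) (n≤1+n _)) (≤-trans (fold-size i xs) shorter) ,
    fits-fold i xs (≤-trans shorter le) (λ y acc ly la → body y acc (≤-trans ly longer) (≤-trans la shorter))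
    where
    longer : sz (𝕃 σ) xs ≤ sz (𝕃 σ) (x ∷ xs)
    longer = ≤-trans (m≤n+m _ (sz σ x)) (n≤1+n _)
    shorter : sz τ i + K * sz (𝕃 σ) xs ≤ sz τ i + K * sz (𝕃 σ) (x ∷ xs)
    shorter = +-monoʳ-≤ (sz τ i) (*-monoʳ-≤ K longer)

sz-reverse : ∀ {τ} (xs : List ⟦ τ ⟧) → sz (𝕃 τ) (reverse xs) ≡ sz (𝕃 τ) xs
sz-reverse {τ} xs = trans (as-sum (reverse xs)) (trans (cong suc (sumBy-↭ (suc ∘ sz τ) (↭P.↭-reverse xs))) (sym (as-sum xs)))
  where
  as-sum : ∀ xs → sz (𝕃 τ) xs ≡ suc (sumBy (suc ∘ sz τ) xs)
  as-sum []       = refl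
  as-sum (x ∷ xs) = cong suc (trans (cong (sz τ x +_) (as-sum xs)) (+-suc (sz τ x) _))

sz-ℕᵗ : ∀ u → sz ℕᵗ u ≡ 1 + 2 * length u
sz-ℕᵗ []      = refl
sz-ℕᵗ (x ∷ u) = cong suc (trans (cong suc (sz-ℕᵗ u)) (sym (*-suc 2 (length u))))

infix 4 _≤+_
_≤+_ : ∀ x k → x ≤ k + x
x ≤+ k = m≤n+m x k

append-grows : ∀ {τ} (x : ⟦ τ ⟧) acc {xs ys} → sz (𝕃 τ) (eval (appendBody {τ}) (x ∷ acc ∷ xs ∷ ys ∷ [])) ≤ 1 * suc (sz τ x) + sz (𝕃 τ) acc
append-grows {τ} x acc = ≤-reflexive (cong (λ a → suc (a + sz (𝕃 τ) acc)) (sym (+-identityʳ (sz τ x))))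

append-size : ∀ {τ} (xs ys : List ⟦ τ ⟧) → sz (𝕃 τ) (eval (append {τ}) (xs ∷ ys ∷ [])) ≤ sz (𝕃 τ) xs + sz (𝕃 τ) ys
append-size {τ} xs ys = ≤-trans (fold-size (appendBody {τ}) (xs ∷ ys ∷ []) 1 (λ x acc → append-grows {τ} x acc {xs} {ys}) ys xs)
  (≤-reflexive (trans (cong (sz (𝕃 τ) ys +_) (*-identityˡ _)) (+-comm (sz (𝕃 τ) ys) _)))

append-fits : ∀ {N τ} (xs ys : List ⟦ τ ⟧) → sz (𝕃 τ) xs + sz (𝕃 τ) ys ≤ N → Fits N (append {τ}) (xs ∷ ys ∷ [])
append-fits {N} {τ} xs ys le = tt , tt ,
  fits-fold (appendBody {τ}) (xs ∷ ys ∷ []) 1 (λ x acc → append-grows {τ} x acc {xs} {ys}) ys xs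
    (≤-trans (≤-reflexive (trans (cong (sz (𝕃 τ) ys +_) (*-identityˡ _)) (+-comm (sz (𝕃 τ) ys) _))) le)
    (λ x acc _ _ → fits-free {0} (appendBody {τ}) {x ∷ acc ∷ xs ∷ ys ∷ []} refl)

double-fits : ∀ {N} u → 1 + 2 * sz ℕᵗ u ≤ N → Fits N double (u ∷ [])
double-fits u le = tt , tt , fits-fold doubleBody (u ∷ []) 2 (λ _ _ → ≤-refl) [] u le
  (λ x acc _ _ → fits-free {0} doubleBody {x ∷ acc ∷ u ∷ []} refl)

-- The accumulator doubles in each round, so a bound by additive growth is out of reach. Its length
-- is the value of the digits read so far, which is at most the value of the whole number.
toUnary-fits : ∀ {N} bs → 3 + 4 * value bs ≤ N → Fits N toUnary (bs ∷ [])
toUnary-fits {N} bs le = tt , tt , suffixes bs bs le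
  where
  suffixes : ∀ orig bs → 3 + 4 * value bs ≤ N → FitsFold N toUnaryBody (orig ∷ []) [] bs
  suffixes orig []       le = tt
  suffixes orig (b ∷ bs) le =
    ≤-trans (≤-reflexive (sz-ℕᵗ acc)) (≤-trans (≤-trans (+-monoʳ-≤ 1 (*-monoˡ-≤ (length acc) {2} {4} (s≤s (s≤s z≤n)))) (m≤n+m _ 2)) acc-fits) ,
    (tt , (tt , tt , (tt , tt) , double-fits acc twice) , (tt , (tt , tt) , double-fits acc twice)) ,
    suffixes orig bs le′
    where
    acc = eval toUnary (bs ∷ [])
    smaller : value bs ≤ value (b ∷ bs)
    smaller = ≤-trans (m≤m+n (value bs) _) (m≤n+m _ (digit b))
    le′ : 3 + 4 * value bs ≤ N
    le′ = ≤-trans (+-monoʳ-≤ 3 (*-monoʳ-≤ 4 smaller)) le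
    acc-fits : 3 + 4 * length acc ≤ N
    acc-fits = subst (λ v → 3 + 4 * v ≤ N) (sym (toUnary-length bs)) le′
    twice : 1 + 2 * sz ℕᵗ acc ≤ N
    twice = ≤-trans (≤-reflexive (trans (cong (λ x → 1 + 2 * x) (sz-ℕᵗ acc)) (arith (length acc)))) acc-fits
      where
      arith : ∀ l → 1 + 2 * (1 + 2 * l) ≡ 3 + 4 * l
      arith = solve-∀

parse-grows : ∀ {bs : List Bool} b st → sz ParserState (eval parseStep (b ∷ st ∷ bs ∷ [])) ≤ 4 * suc (sz 𝔹 b) + sz ParserState st
parse-grows false (false , false , its)    = _ ≤+ 6
parse-grows true  (false , false , its)    = _ ≤+ 12
parse-grows false (false , true , its)     = _ ≤+ 8
parse-grows true  (false , true , its)     = _ ≤+ 14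
parse-grows true  (true , true , [])       = _ ≤+ 20
parse-grows true  (true , true , it ∷ its) = _ ≤+ 16
parse-grows false (true , true , its)      = _ ≤+ 10
parse-grows false (true , false , [])       = _ ≤+ 10
parse-grows true  (true , false , [])       = _ ≤+ 18
parse-grows false (true , false , it ∷ its) = _ ≤+ 8
parse-grows true  (true , false , it ∷ its) = _ ≤+ 16

parse-fits : ∀ {N} bs → 5 + 4 * sz Bits bs ≤ N → Fits N parse (bs ∷ [])
parse-fits bs le = (tt , (tt , tt , tt) , fits-fold parseStep (bs ∷ []) 4 (parse-grows {bs}) (false , false , []) bs le
    (λ x acc _ _ → fits-free {0} parseStep {x ∷ acc ∷ bs ∷ []} refl)) , tt , tt

parse-size : ∀ bs → sz (𝕃 Bits) (eval parse (bs ∷ [])) ≤ 5 + 4 * sz Bits bs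
parse-size bs = ≤-trans (last (proj₁ st) (proj₁ (proj₂ st)) (proj₂ (proj₂ st)))
  (fold-size parseStep (bs ∷ []) 4 (parse-grows {bs}) (false , false , []) bs)
  where
  st = parser bs
  last : ∀ a b c → sz (𝕃 Bits) c ≤ sz ParserState (a , b , c)
  last a b c = ≤-trans (≤-trans (m≤n+m _ (sz 𝔹 b)) (≤-trans (n≤1+n _) (m≤n+m _ (sz 𝔹 a)))) (n≤1+n _)

module _ (ps : List (List Bool)) where

  private
    grows : ∀ x acc → sz (Bits ⊗ 𝕃 Bits) (eval popHeadsBody (x ∷ acc ∷ ps ∷ [])) ≤ 1 * suc (sz Bits x) + sz (Bits ⊗ 𝕃 Bits) acc
    grows []      (hs , ts) = _ ≤+ 2
    grows (b ∷ l) (hs , ts) = ≤-reflexive (arith (sz 𝔹 b) (sz Bits hs) (sz Bits l) (sz (𝕃 Bits) ts))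
      where
      arith : ∀ b h l t → suc (suc (b + h) + suc (l + t)) ≡ 1 * suc (suc (b + l)) + suc (h + t)
      arith = solve-∀

  popHeads-size : sz (Bits ⊗ 𝕃 Bits) (eval popHeads (ps ∷ [])) ≤ 3 + sz (𝕃 Bits) ps
  popHeads-size = ≤-trans (fold-size popHeadsBody (ps ∷ []) 1 grows ([] , []) ps) (≤-reflexive (cong (3 +_) (*-identityˡ _)))

  popHeads-fits : ∀ {N} → 3 + sz (𝕃 Bits) ps ≤ N → Fits N popHeads (ps ∷ [])
  popHeads-fits le = tt , (tt , tt) , fits-fold popHeadsBody (ps ∷ []) 1 grows ([] , []) ps
    (≤-trans (≤-reflexive (cong (3 +_) (*-identityˡ _))) le) (λ x acc _ _ → fits-free {0} popHeadsBody {x ∷ acc ∷ ps ∷ []} refl)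

-- A digit that is taken off frees a node and its own tree, hence at least 2 units.
popHeads-shrinks : ∀ ps → sz (𝕃 Bits) (proj₂ (eval popHeads (ps ∷ []))) + 2 * length (proj₁ (eval popHeads (ps ∷ []))) ≤ sz (𝕃 Bits) ps
popHeads-shrinks []             = ≤-refl
popHeads-shrinks ([] ∷ ps)      = ≤-trans (popHeads-shrinks ps) (sz (𝕃 Bits) ps ≤+ 2)
popHeads-shrinks ((b ∷ l) ∷ ps) = ≤-trans (≤-reflexive (arith (sz Bits l) _ (length (proj₁ (eval popHeads (ps ∷ []))))))
  (+-mono-≤ (s≤s (s≤s (+-monoˡ-≤ (sz Bits l) (sz≥1 𝔹 b)))) (popHeads-shrinks ps))
  where
  arith : ∀ l t h → suc (l + t) + 2 * suc h ≡ 3 + l + (t + 2 * h)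
  arith = solve-∀

module _ (S : List Bool) (ps : List (List Bool)) where

  private
    grows : ∀ x acc → sz (𝕃 Bits ⊗ 𝕃 Bits) (eval selectBody (x ∷ acc ∷ S ∷ ps ∷ [])) ≤ 0 * suc (sz 𝔹 x) + sz (𝕃 Bits ⊗ 𝕃 Bits) acc
    grows x     ([] , out)      = ≤-refl
    grows false (p ∷ rem , out) = s≤s (≤-trans (m≤n+m _ (suc (sz Bits p))) (≤-reflexive (sym (+-assoc (suc (sz Bits p)) (sz (𝕃 Bits) rem) _))))
    grows true  (p ∷ rem , out) = ≤-reflexive (arith (sz Bits p) (sz (𝕃 Bits) rem) (sz (𝕃 Bits) out))
      where
      arith : ∀ p r o → suc (r + suc (p + o)) ≡ suc (suc (p + r) + o)
      arith p r o = cong suc (trans (+-suc r (p + o)) (cong suc (trans (sym (+-assoc r p o)) (cong (_+ o) (+-comm r p)))))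
    bound : ∀ {N} → 2 + sz (𝕃 Bits) ps ≤ N → sz (𝕃 Bits ⊗ 𝕃 Bits) (ps , []) + 0 * sz Bits (reverse S) ≤ N
    bound le = ≤-trans (≤-reflexive (trans (+-identityʳ _) (cong suc (+-comm (sz (𝕃 Bits) ps) 1)))) le

  select-size : sz (𝕃 Bits) (eval select (S ∷ ps ∷ [])) ≤ 2 + sz (𝕃 Bits) ps
  select-size = ≤-trans (≤-trans (m≤n+m _ (sz (𝕃 Bits) (proj₁ st))) (n≤1+n _))
    (≤-trans (fold-size selectBody (S ∷ ps ∷ []) 0 grows (ps , []) (reverse S)) (bound ≤-refl))
    where st = foldr selectStep (ps , []) (reverse S)

  select-fits : ∀ {N} → 2 + sz (𝕃 Bits) ps ≤ N → Fits N select (S ∷ ps ∷ [])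
  select-fits le = (tt , (tt , tt) , fits-fold selectBody (S ∷ ps ∷ []) 0 grows (ps , []) (reverse S) (bound le)
    (λ x acc _ _ → fits-free {0} selectBody {x ∷ acc ∷ S ∷ ps ∷ []} refl)) , tt

module _ (hs : List Bool) (r : List ⊤) where

  private
    grows : ∀ x acc → sz ℕᵗ (eval addDigitsBody (x ∷ acc ∷ hs ∷ r ∷ [])) ≤ 1 * suc (sz 𝔹 x) + sz ℕᵗ acc
    grows false acc = ≤-refl
    grows true  acc = ≤-refl
    bound : ∀ {N} → sz Bits hs + sz ℕᵗ r ≤ N → sz ℕᵗ r + 1 * sz Bits hs ≤ N
    bound le = ≤-trans (≤-reflexive (trans (cong (sz ℕᵗ r +_) (*-identityˡ _)) (+-comm (sz ℕᵗ r) _))) le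

  addDigits-size : sz ℕᵗ (eval addDigits (hs ∷ r ∷ [])) ≤ sz Bits hs + sz ℕᵗ r
  addDigits-size = ≤-trans (fold-size addDigitsBody (hs ∷ r ∷ []) 1 grows r hs) (bound ≤-refl)

  addDigits-fits : ∀ {N} → sz Bits hs + sz ℕᵗ r ≤ N → Fits N addDigits (hs ∷ r ∷ [])
  addDigits-fits le = tt , tt , fits-fold addDigitsBody (hs ∷ r ∷ []) 1 grows r hs (bound le)
    (λ x acc _ _ → fits-free {0} addDigitsBody {x ∷ acc ∷ hs ∷ r ∷ []} refl)

half-fits : ∀ {N} u → 3 + sz ℕᵗ u ≤ N → Fits N half (u ∷ [])
half-fits u le = (tt , (tt , tt) , fits-fold halfBody (u ∷ []) 1 grows (false , []) u
    (≤-trans (≤-reflexive (cong (3 +_) (*-identityˡ _))) le) (λ x acc _ _ → fits-free {0} halfBody {x ∷ acc ∷ u ∷ []} refl)) , tt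
  where
  grows : ∀ x acc → sz (𝔹 ⊗ ℕᵗ) (eval halfBody (x ∷ acc ∷ u ∷ [])) ≤ 1 * suc (sz 𝟙 x) + sz (𝔹 ⊗ ℕᵗ) acc
  grows x (false , h) = ≤-refl
  grows x (true , h)  = _ ≤+ 2

tail-size : ∀ u → sz ℕᵗ (eval tailᵉ (u ∷ [])) ≤ sz ℕᵗ u
tail-size []      = ≤-refl
tail-size (x ∷ u) = _ ≤+ 2

module _ (hs : List Bool) (k : List ⊤) where

  private
    grows : ∀ x acc → sz ℕᵗ (eval dropOnesBody (x ∷ acc ∷ hs ∷ k ∷ [])) ≤ 0 * suc (sz 𝔹 x) + sz ℕᵗ acc
    grows false acc = ≤-refl
    grows true  acc = tail-size acc

  dropOnes-size : sz ℕᵗ (eval dropOnes (hs ∷ k ∷ [])) ≤ sz ℕᵗ k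
  dropOnes-size = ≤-trans (fold-size dropOnesBody (hs ∷ k ∷ []) 0 grows k hs) (≤-reflexive (+-identityʳ _))

  dropOnes-fits : ∀ {N} → sz ℕᵗ k ≤ N → Fits N dropOnes (hs ∷ k ∷ [])
  dropOnes-fits le = tt , tt , fits-fold dropOnesBody (hs ∷ k ∷ []) 0 grows k hs (≤-trans (≤-reflexive (+-identityʳ _)) le)
    (λ x acc _ _ → fits-free {0} dropOnesBody {x ∷ acc ∷ hs ∷ k ∷ []} refl)

equal-fits : ∀ {N} xs ys → 4 + sz Bits ys ≤ N → Fits N equal (xs ∷ ys ∷ [])
equal-fits xs ys le = (tt , (tt , tt) , fits-fold equalBody (xs ∷ ys ∷ []) 0 grows (ys , true) (reverse xs)
    (≤-trans (≤-reflexive (trans (+-identityʳ _) (cong suc (+-comm (sz Bits ys) 3)))) le)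
    (λ x acc _ _ → fits-free {0} equalBody {x ∷ acc ∷ xs ∷ ys ∷ []} refl)) ,
  tt , tt , branches (proj₁ (foldr equalStep (ys , true) (reverse xs)))
  where
  branches : ∀ (r : List Bool) → caseList r ⊤ (λ _ _ → ⊤)
  branches []      = tt
  branches (_ ∷ _) = tt
  shrink : ∀ y (rem : List Bool) {o o′} → o′ ≤ o → suc (sz Bits rem + o′) ≤ suc (suc (sz 𝔹 y + sz Bits rem) + o)
  shrink y rem le = s≤s (+-mono-≤ (≤-trans (m≤n+m _ (sz 𝔹 y)) (n≤1+n _)) le)
  grows : ∀ x acc → sz (Bits ⊗ 𝔹) (eval equalBody (x ∷ acc ∷ xs ∷ ys ∷ [])) ≤ 0 * suc (sz 𝔹 x) + sz (Bits ⊗ 𝔹) acc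
  grows x     ([] , ok)          = s≤s (s≤s (sz≥1 𝔹 ok))
  grows true  (true ∷ rem , ok)  = shrink true rem ≤-refl
  grows true  (false ∷ rem , ok) = shrink false rem (sz≥1 𝔹 ok)
  grows false (true ∷ rem , ok)  = shrink true rem (sz≥1 𝔹 ok)
  grows false (false ∷ rem , ok) = shrink false rem ≤-refl

less-fits : ∀ {N} xs ys → sz ℕᵗ ys ≤ N → Fits N less (xs ∷ ys ∷ [])
less-fits {N} xs ys le = (tt , tt , fits-fold lessBody (xs ∷ ys ∷ []) 0 (λ x acc → tail-size acc) ys xs
    (≤-trans (≤-reflexive (+-identityʳ _)) le) (λ x acc _ _ → fits-free {0} lessBody {x ∷ acc ∷ xs ∷ ys ∷ []} refl)) ,
  tt , branches (eval (fold #0 #1 lessBody) (xs ∷ ys ∷ []))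
  where
  branches : ∀ (r : List ⊤) → caseList r ⊤ (λ _ _ → ⊤)
  branches []      = tt
  branches (_ ∷ _) = tt

module _ (st : ⟦ SumState ⟧) where

  private
    r  = proj₁ st
    D  = proj₁ (proj₂ st)
    ps = proj₂ (proj₂ st)
    hs = proj₁ (eval popHeads (ps ∷ []))
    ts = proj₂ (eval popHeads (ps ∷ []))
    sumOf halfSum : List ⊤ → List ⊤
    sumOf r′   = eval addDigits (hs ∷ r′ ∷ [])
    halfSum r′ = eval half (sumOf r′ ∷ [])

  -- The digits added to the carry are paid for by the heads removed from the summands.
  sumStep-size : sz SumState (eval sumStep (st ∷ [])) ≤ 2 + sz SumState st
  sumStep-size = cases D
    where
    digits≤ : ∀ hs → foldr (λ b → digit b +_) 0 hs ≤ 2 * length hs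
    digits≤ []           = z≤n
    digits≤ (false ∷ hs) = ≤-trans (+-mono-≤ (s≤s (z≤n {1})) (digits≤ hs)) (≤-reflexive (sym (*-suc 2 (length hs))))
    digits≤ (true ∷ hs)  = ≤-trans (+-monoʳ-≤ 2 (digits≤ hs)) (≤-reflexive (sym (*-suc 2 (length hs))))
    half≤ : ∀ r′ → length r′ ≤ 2 + length r → sz ℕᵗ (eval half (eval addDigits (hs ∷ r′ ∷ []) ∷ [])) ≤ 2 + (2 * length hs + sz ℕᵗ r)
    half≤ r′ le = begin
      sz ℕᵗ (eval half (sum ∷ []))        ≡⟨ sz-ℕᵗ (eval half (sum ∷ [])) ⟩
      1 + 2 * length (eval half (sum ∷ [])) ≤⟨ s≤s (m≤n+m _ (flag (proj₁ (half-length sum)))) ⟩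
      1 + (flag (proj₁ (half-length sum)) + 2 * length (eval half (sum ∷ []))) ≡⟨ cong suc (trans (proj₂ (half-length sum)) (addDigits-length hs r′)) ⟩
      1 + (foldr (λ b → digit b +_) 0 hs + length r′) ≤⟨ s≤s (+-mono-≤ (digits≤ hs) le) ⟩
      1 + (2 * length hs + (2 + length r)) ≤⟨ s≤s (+-monoʳ-≤ (2 * length hs) (+-monoʳ-≤ 2 (m≤m+n (length r) (length r + 0)))) ⟩
      1 + (2 * length hs + (2 + 2 * length r)) ≡⟨ arith (2 * length hs) (2 * length r) ⟩
      2 + (2 * length hs + (1 + 2 * length r)) ≡⟨ cong (λ x → 2 + (2 * length hs + x)) (sz-ℕᵗ r) ⟨
      2 + (2 * length hs + sz ℕᵗ r) ∎
      where
      open ≤-Reasoning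
      sum = eval addDigits (hs ∷ r′ ∷ [])
      arith : ∀ h r → 1 + (h + (2 + r)) ≡ 2 + (h + (1 + r))
      arith = solve-∀
    whole : ∀ r′ D D′ → sz ℕᵗ r′ ≤ 2 + (2 * length hs + sz ℕᵗ r) → sz Bits D′ ≤ sz Bits D →
            sz SumState (r′ , D′ , ts) ≤ 2 + sz SumState (r , D , ps)
    whole r′ D D′ le le′ = ≤-trans (s≤s (+-mono-≤ le (s≤s (+-monoˡ-≤ (sz (𝕃 Bits) ts) le′))))
      (≤-trans (≤-reflexive (arith (2 * length hs) (sz ℕᵗ r) (sz Bits D) (sz (𝕃 Bits) ts)))
        (+-monoʳ-≤ 3 (+-monoʳ-≤ (sz ℕᵗ r) (s≤s (+-monoʳ-≤ (sz Bits D) (popHeads-shrinks ps))))))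
      where
      arith : ∀ h r d t → 1 + (2 + (h + r) + (1 + (d + t))) ≡ 3 + (r + (1 + (d + (t + h))))
      arith = solve-∀
    cases : ∀ D → sz SumState (eval sumStep ((r , D , ps) ∷ [])) ≤ 2 + sz SumState (r , D , ps)
    cases []          = whole (halfSum (tt ∷ tt ∷ r)) [] [] (half≤ (tt ∷ tt ∷ r) ≤-refl) ≤-refl
    cases (false ∷ D) = whole (halfSum (tt ∷ r)) (false ∷ D) D (half≤ (tt ∷ r) (n≤1+n _)) (sz Bits D ≤+ 2)
    cases (true ∷ D)  = whole (halfSum r) (true ∷ D) D (half≤ r (length r ≤+ 2)) (sz Bits D ≤+ 4)

  sumStep-fits : ∀ {N} → 10 + 2 * sz SumState st ≤ N → Fits N sumStep (st ∷ [])
  sumStep-fits {N} le = tt , tt , ((tt , tt) , popHeads-fits ps (≤-trans popHeads≤ le)) , tt ,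
      (((((tt , (tt , tt , tt) , tt) , addDigits-fits hs (tt ∷ tt ∷ r) (sum≤ (tt ∷ tt ∷ r) ≤-refl)) , tt) ,
        half-fits (sumOf (tt ∷ tt ∷ r)) (half≤ (tt ∷ tt ∷ r) ≤-refl)) , tt , tt) , branches D
    where
    S = sz SumState st
    ps≤ : 3 + sz (𝕃 Bits) ps + sz ℕᵗ r ≤ 2 + S
    ps≤ = s≤s (s≤s (s≤s (≤-trans (≤-reflexive (+-comm (sz (𝕃 Bits) ps) (sz ℕᵗ r))) (+-monoʳ-≤ (sz ℕᵗ r) (≤-trans (m≤n+m _ (sz Bits D)) (n≤1+n _))))))
    popHeads≤ : 3 + sz (𝕃 Bits) ps ≤ 10 + 2 * S
    popHeads≤ = ≤-trans (m≤m+n _ (sz ℕᵗ r)) (≤-trans ps≤ (+-mono-≤ (s≤s (s≤s (z≤n {8}))) (m≤m+n S _)))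
    sum-size : ∀ r′ → sz ℕᵗ r′ ≤ 4 + sz ℕᵗ r → sz Bits hs + sz ℕᵗ r′ ≤ 6 + S
    sum-size r′ le′ = ≤-trans (+-mono-≤ (≤-trans (≤-trans (m≤m+n _ _) (n≤1+n _)) (popHeads-size ps)) le′)
      (≤-trans (≤-reflexive (arith (sz (𝕃 Bits) ps) (sz ℕᵗ r))) (+-monoʳ-≤ 4 ps≤))
      where
      arith : ∀ a b → 3 + a + (4 + b) ≡ 4 + (3 + a + b)
      arith = solve-∀
    sum≤ : ∀ r′ → sz ℕᵗ r′ ≤ 4 + sz ℕᵗ r → sz Bits hs + sz ℕᵗ r′ ≤ N
    sum≤ r′ le′ = ≤-trans (sum-size r′ le′) (≤-trans (+-mono-≤ (6 ≤+ 4) (m≤m+n S (S + 0))) le)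
    half≤ : ∀ r′ → sz ℕᵗ r′ ≤ 4 + sz ℕᵗ r → 3 + sz ℕᵗ (eval addDigits (hs ∷ r′ ∷ [])) ≤ N
    half≤ r′ le′ = ≤-trans (+-monoʳ-≤ 3 (≤-trans (addDigits-size hs r′) (sum-size r′ le′))) (≤-trans (+-mono-≤ (9 ≤+ 1) (m≤m+n S (S + 0))) le)
    carry : Bool → List ⊤
    carry b = if b then r else tt ∷ r
    carry≤ : ∀ b → sz ℕᵗ (carry b) ≤ 4 + sz ℕᵗ r
    carry≤ false = _ ≤+ 2
    carry≤ true  = _ ≤+ 4
    branches : ∀ D′ → caseList D′ ⊤ (λ b D″ → Fits N
      (pair (call half (call addDigits (#2 ∷ cond #0 #6 (sucᵉ #6) ∷ []) ∷ [])) (pair #1 #3))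
      (b ∷ D″ ∷ hs ∷ ts ∷ D ∷ ps ∷ r ∷ proj₂ st ∷ st ∷ []))
    branches []       = tt
    branches (b ∷ D″) = ((((tt , (tt , tt , tt , tt) , tt) , addDigits-fits hs (carry b) (sum≤ (carry b) (carry≤ b))) , tt) ,
      half-fits (sumOf (carry b)) (half≤ (carry b) (carry≤ b))) , tt , tt

module _ (fuel S : List Bool) (static : List (List Bool)) where

  -- The initial state has size at most 6 + M, and `fuel` pays for the 2 units that each column may
  -- add, so accumulators stay below 6 + 2M. One step requires 10 plus twice that, which is 22 + 4M.
  feasible-fits : ∀ {N M} → sz Bits fuel ≤ M → sz (𝕃 Bits) static ≤ M → 22 + 4 * M ≤ N → Fits N feasible (fuel ∷ S ∷ static ∷ [])
  feasible-fits {N} {M} fuel≤ static≤ le = tt , tt , branches (reverse static) (≤-trans (≤-reflexive (sz-reverse {Bits} static)) static≤)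
    where
    verdict : ∀ (r : List ⊤) → caseList r ⊤ (λ _ r′ → ⊤ × ⊤ × caseList r′ ⊤ (λ _ _ → ⊤))
    verdict []          = tt
    verdict (_ ∷ [])    = tt , tt , tt
    verdict (_ ∷ _ ∷ _) = tt , tt , tt
    grows : ∀ {ρ} x acc → sz SumState (eval sumBody (x ∷ acc ∷ ρ)) ≤ 1 * suc (sz 𝔹 x) + sz SumState acc
    grows x acc = ≤-trans (sumStep-size acc) (+-monoˡ-≤ (sz SumState acc) (s≤s (≤-trans (sz≥1 𝔹 x) (≤-reflexive (sym (+-identityʳ _))))))
    branches : ∀ row → sz (𝕃 Bits) row ≤ M → caseList row ⊤ (λ D ps → Fits N
      (split (fold #2 (pair (sucᵉ nil) (pair #0 (call select (#3 ∷ #1 ∷ [])))) sumBody)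
        (caseL #0 (bit true) (caseL #1 (bit true) (bit false)))) (D ∷ ps ∷ fuel ∷ S ∷ static ∷ []))
    branches []       row≤ = tt
    branches (D ∷ ps) row≤ =
      (tt , ((tt , tt) , tt , ((tt , tt , tt) , select-fits S ps (≤-trans select≤ (≤-trans (+-mono-≤ (2 ≤+ 20) (m≤m+n M _)) le)))) ,
       fits-fold sumBody _ 1 (grows {D ∷ ps ∷ fuel ∷ S ∷ static ∷ []}) st fuel (≤-trans acc≤ (≤-trans small le))
         (λ x acc _ le′ → (tt , tt) , sumStep-fits acc (≤-trans (+-monoʳ-≤ 10 (*-monoʳ-≤ 2 (≤-trans le′ acc≤))) (≤-trans (≤-reflexive (arith M)) le)))) ,
      tt , tt , verdict (proj₁ (sumLoop fuel st))
      where
      sel = eval select (S ∷ ps ∷ [])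
      st : ⟦ SumState ⟧
      st = tt ∷ [] , D , sel
      select≤ : 2 + sz (𝕃 Bits) ps ≤ 2 + M
      select≤ = +-monoʳ-≤ 2 (≤-trans (≤-trans (m≤n+m _ (sz Bits D)) (n≤1+n _)) row≤)
      st≤ : sz SumState st ≤ 6 + M
      st≤ = ≤-trans (+-monoʳ-≤ (5 + sz Bits D) (select-size S ps)) (≤-trans (≤-reflexive (arith′ (sz Bits D) (sz (𝕃 Bits) ps))) (+-monoʳ-≤ 6 row≤))
        where
        arith′ : ∀ d p → 5 + d + (2 + p) ≡ 6 + (1 + (d + p))
        arith′ = solve-∀
      acc≤ : sz SumState st + 1 * sz Bits fuel ≤ 6 + M + M
      acc≤ = +-mono-≤ st≤ (≤-trans (≤-reflexive (*-identityˡ _)) fuel≤)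
      small : 6 + M + M ≤ 22 + 4 * M
      small = ≤-trans (≤-reflexive (+-assoc 6 M M)) (+-mono-≤ (6 ≤+ 16) (+-monoʳ-≤ M (m≤m+n M _)))
      arith : ∀ m → 10 + 2 * (6 + m + m) ≡ 22 + 4 * m
      arith = solve-∀

-- Accumulators are at most 3 + M + M², where the square comes from a sum over the clients with
-- terms of size at most that of k. Another 3 + M is left for the work within a round.
deficitᵖ : Poly
deficitᵖ = K 6 ⊕ K 2 ⊙ X ⊕ X ⊙ X

module _ (nᵘ kᵘ : List ⊤) (days : List DayV) {M : ℕ}
         (n≤ : sz ℕᵗ nᵘ ≤ M) (k≤ : sz ℕᵗ kᵘ ≤ M) (days≤ : sz (𝕃 Day) days ≤ M) where

  private
    ρ : Env (ℕᵗ ∷ ℕᵗ ∷ 𝕃 Day ∷ [])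
    ρ = nᵘ ∷ kᵘ ∷ days ∷ []
    State = 𝕃 Bits ⊗ ℕᵗ

    column-grows : ∀ x acc → sz (𝕃 Bits) (eval columnBody (x ∷ acc ∷ ρ)) ≤ 1 * suc (sz Day x) + sz (𝕃 Bits) acc
    column-grows (static , S) acc = s≤s (+-monoˡ-≤ (sz (𝕃 Bits) acc)
      (≤-trans (≤-trans (m≤n+m _ (sz (𝕃 Bits) static)) (n≤1+n _)) (≤-reflexive (sym (+-identityʳ _)))))

    cols : List (List Bool)
    cols = foldV columnBody ρ 1 column-grows [] days

    cols≤ : sz (𝕃 Bits) cols ≤ 1 + M
    cols≤ = ≤-trans (fold-size columnBody ρ 1 column-grows [] days) (s≤s (≤-trans (≤-reflexive (*-identityˡ _)) days≤))

    grows : ∀ x acc → sz State (eval deficitBody (x ∷ acc ∷ ρ)) ≤ M * suc (sz 𝟙 x) + sz State acc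
    grows x (cs , Φ) = ≤-trans (s≤s (+-mono-≤ (m+n≤o⇒m≤o _ (popHeads-shrinks cs))
        (≤-trans (append-size {𝟙} drop Φ) (+-monoˡ-≤ (sz ℕᵗ Φ) (≤-trans (dropOnes-size hs kᵘ) k≤)))))
      (≤-trans (≤-reflexive (arith (sz (𝕃 Bits) cs) M (sz ℕᵗ Φ))) (+-monoˡ-≤ (sz State (cs , Φ)) (m≤m*n M 2)))
      where
      hs = proj₁ (eval popHeads (cs ∷ []))
      drop = eval dropOnes (hs ∷ kᵘ ∷ [])
      arith : ∀ c m f → 1 + (c + (m + f)) ≡ m + (1 + (c + f))
      arith = solve-∀

    bound : sz State (cols , []) + M * sz ℕᵗ nᵘ ≤ 3 + M + M * M
    bound = +-mono-≤ (s≤s (≤-trans (+-monoˡ-≤ 1 cols≤) (≤-reflexive (+-comm (1 + M) 1)))) (*-monoʳ-≤ M n≤)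

  deficit-size : sz ℕᵗ (eval deficit ρ) ≤ 3 + M + M * M
  deficit-size = ≤-trans (≤-trans (m≤n+m _ (sz (𝕃 Bits) (proj₁ st))) (n≤1+n _))
    (≤-trans (fold-size deficitBody ρ M grows (cols , []) nᵘ) bound)
    where st = foldV deficitBody ρ M grows (cols , []) nᵘ

  deficit-fits : ∀ {N} → ⟪ deficitᵖ ⟫ M ≤ N → Fits N deficit ρ
  deficit-fits {N} le =
    (tt , ((tt , tt , fits-fold columnBody ρ 1 column-grows [] days cols-fit (λ x acc _ _ → fits-free {0} columnBody {x ∷ acc ∷ ρ} refl)) , tt) ,
     fits-fold deficitBody ρ M grows (cols , []) nᵘ (≤-trans bound (≤-trans (≤-trans (m≤n+m _ (3 + M)) enough) le))
       (λ { x (cs , Φ) _ acc≤ → body-fits cs Φ (≤-trans acc≤ bound) })) , tt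
    where
    B = 3 + M + M * M
    enough : 3 + M + B ≤ ⟪ deficitᵖ ⟫ M
    enough = ≤-reflexive (arith M (M * M))
      where
      arith : ∀ m q → 3 + m + (3 + m + q) ≡ 6 + 2 * m + q
      arith = solve-∀
    cols-fit : sz (𝕃 Bits) [] + 1 * sz (𝕃 Day) days ≤ N
    cols-fit = ≤-trans (s≤s (≤-trans (≤-reflexive (*-identityˡ _)) days≤)) (≤-trans (≤-trans (_ ≤+ 2) (m≤m+n (3 + M) B)) (≤-trans enough le))
    body-fits : ∀ {x} cs Φ → sz State (cs , Φ) ≤ B → Fits N deficitBody (x ∷ (cs , Φ) ∷ ρ)
    body-fits cs Φ acc≤ = tt , ((tt , tt) , popHeads-fits cs (≤-trans (+-mono-≤ (m≤m+n 3 M) cs≤) (≤-trans enough le))) , tt ,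
      (((tt , tt , tt) , dropOnes-fits hs kᵘ (≤-trans k≤ (≤-trans (≤-trans (M ≤+ 3) (m≤m+n (3 + M) B)) (≤-trans enough le)))) , tt , tt) ,
      append-fits {τ = 𝟙} drop Φ (≤-trans (+-mono-≤ (≤-trans (≤-trans (dropOnes-size hs kᵘ) k≤) (M ≤+ 3)) Φ≤) (≤-trans enough le))
      where
      hs = proj₁ (eval popHeads (cs ∷ []))
      drop = eval dropOnes (hs ∷ kᵘ ∷ [])
      cs≤ : sz (𝕃 Bits) cs ≤ B
      cs≤ = ≤-trans (≤-trans (m≤m+n _ _) (n≤1+n _)) acc≤
      Φ≤ : sz ℕᵗ Φ ≤ B
      Φ≤ = ≤-trans (≤-trans (m≤n+m _ (sz (𝕃 Bits) cs)) (n≤1+n _)) acc≤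

module _ (fuel : List Bool) (seq : List (List Bool)) (days : List DayV) where

  private
    ρ : Env (Bits ∷ 𝕃 Bits ∷ 𝕃 Day ∷ [])
    ρ = fuel ∷ seq ∷ days ∷ []
    State = 𝕃 Bits ⊗ 𝕃 Day

    keeps : ∀ rem (day : DayV) out → sz State (rem , day ∷ out) ≤ 1 * suc (sz Day day) + sz State (rem , out)
    keeps rem day out = ≤-reflexive (arith (sz (𝕃 Bits) rem) (sz Day day) (sz (𝕃 Day) out))
      where
      arith : ∀ r d o → 1 + (r + (1 + (d + o))) ≡ 1 * (1 + d) + (1 + (r + o))
      arith = solve-∀

    grows : ∀ x acc → sz State (eval applyBody (x ∷ acc ∷ ρ)) ≤ 1 * suc (sz Day x) + sz State acc
    grows day ([] , out)                        = keeps [] day out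
    grows day (old ∷ [] , out)                  = keeps (old ∷ []) day out
    grows (static , cur) (old ∷ new ∷ rem , out) =
      if-view (λ res → sz State res ≤ 1 * suc (sz Day (static , cur)) + sz State (old ∷ new ∷ rem , out))
        (if eval equal (old ∷ cur ∷ []) then eval feasible (fuel ∷ new ∷ static ∷ []) else false)
        (λ _ → ≤-trans (m≤m+n _ (2 + sz Bits cur + sz Bits old))
          (≤-reflexive (arith (sz (𝕃 Bits) rem) (sz (𝕃 Bits) static) (sz Bits cur) (sz Bits old) (sz Bits new) (sz (𝕃 Day) out))))
        (λ _ → keeps (old ∷ new ∷ rem) (static , cur) out)
      where
      arith : ∀ r s c o n u → 1 + (r + (1 + (1 + (s + n) + u))) + (2 + c + o) ≡ 1 * (1 + (1 + (s + c))) + (1 + (1 + (o + (1 + (n + r))) + u))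
      arith = solve-∀

    bound : sz State (seq , []) + 1 * sz (𝕃 Day) days ≤ 2 + (sz (𝕃 Bits) seq + sz (𝕃 Day) days)
    bound = ≤-reflexive (cong₂ _+_ (cong suc (+-comm (sz (𝕃 Bits) seq) 1)) (*-identityˡ _))

  -- A move takes its new set out of the pending sequence. Sets are transferred rather than copied,
  -- so a pass adds at most about the size of the sequence, whatever the number of days.
  applied-size : sz (𝕃 Day) (eval applyMoves ρ) ≤ 2 + (sz (𝕃 Bits) seq + sz (𝕃 Day) days)
  applied-size = ≤-trans (≤-trans (m≤n+m _ (sz (𝕃 Bits) (proj₁ st))) (n≤1+n _))
    (≤-trans (fold-size applyBody ρ 1 grows (seq , []) days) bound)
    where st = foldV applyBody ρ 1 grows (seq , []) days

  applyMoves-fits : ∀ {N M} → sz Bits fuel ≤ M → sz (𝕃 Bits) seq ≤ M → sz (𝕃 Day) days ≤ M → 22 + 4 * M ≤ N → Fits N applyMoves ρ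
  applyMoves-fits {N} {M} fuel≤ seq≤ days≤ le =
    (tt , (tt , tt) , fits-fold applyBody ρ 1 grows (seq , []) days (≤-trans bound (≤-trans (+-mono-≤ (2 ≤+ 20) (+-mono-≤ seq≤ (≤-trans days≤ (m≤m+n M _)))) le))
      (λ { (static , cur) (rem , out) day≤ _ → (tt , tt , tt , tt) , tt , tt , (tt , tt , tt) ,
        branches static cur out (≤-trans day≤ days≤) rem })) , tt
    where
    inner : ∀ static cur out old rem₀ → sz Day (static , cur) ≤ M → ∀ rem′ → caseList rem′ ⊤ (λ new rem″ → Fits N
      (split #7 (cond (cond (call equal (#4 ∷ #1 ∷ [])) (call feasible (#8 ∷ #2 ∷ #0 ∷ [])) (bit false))
        (pair #3 (cons (pair #0 #2) #7)) (pair #6 (cons (pair #0 #1) #7))))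
      (new ∷ rem″ ∷ old ∷ rem′ ∷ rem₀ ∷ out ∷ fuel ∷ (static , cur) ∷ (rem₀ , out) ∷ []))
    inner static cur out old rem₀ day≤ []           = tt
    inner static cur out old rem₀ day≤ (new ∷ rem″) =
      tt , (((tt , tt , tt) , equal-fits old cur (≤-trans (+-mono-≤ (4 ≤+ 18) (≤-trans (≤-trans (m≤n+m _ (sz (𝕃 Bits) static)) (n≤1+n _)) (≤-trans day≤ (m≤m+n M _)))) le)) ,
            ((tt , tt , tt , tt) , feasible-fits fuel new static fuel≤ (≤-trans (≤-trans (m≤m+n _ (sz Bits cur)) (n≤1+n _)) day≤) le) , tt) ,
      (tt , (tt , tt) , tt) , tt , (tt , tt) , tt
    branches : ∀ static cur out → sz Day (static , cur) ≤ M → ∀ rem → caseList rem ⊤ (λ old rem′ → Fits N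
      (caseL #1 (pair #2 (cons #5 #3)) (split #7 (cond (cond (call equal (#4 ∷ #1 ∷ [])) (call feasible (#8 ∷ #2 ∷ #0 ∷ [])) (bit false))
        (pair #3 (cons (pair #0 #2) #7)) (pair #6 (cons (pair #0 #1) #7)))))
      (old ∷ rem′ ∷ rem ∷ out ∷ fuel ∷ (static , cur) ∷ (rem , out) ∷ []))
    branches static cur out day≤ []           = tt
    branches static cur out day≤ (old ∷ rem′) = tt , (tt , tt , tt) , inner static cur out old (old ∷ rem′) day≤ rem′

-- One pass brings the days to at most 2 + 2M, and trying all sequences once to 3M. Over the whole
-- search the growth is at most M for each unit of size of the unary initial deficit, which is at
-- most 3 + M + M².
improveStepᵖ improveᵖ searchBoundᵖ searchᵖ : Poly
improveStepᵖ = (K 22 ⊕ K 4 ⊙ X) ⊕ deficitᵖ ∘ᵖ (K 2 ⊕ K 2 ⊙ X)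
improveᵖ     = improveStepᵖ ∘ᵖ (K 3 ⊙ X)
searchBoundᵖ = X ⊕ X ⊙ (K 3 ⊕ X ⊕ X ⊙ X)
searchᵖ      = deficitᵖ ⊕ (improveᵖ ∘ᵖ searchBoundᵖ ⊕ deficitᵖ ∘ᵖ searchBoundᵖ)

module _ (fuel : List Bool) (nᵘ kᵘ : List ⊤) where

  module _ (seq : List (List Bool)) (days : List DayV) where

    improveStep-size : sz (𝕃 Day) (eval improveStep (fuel ∷ nᵘ ∷ kᵘ ∷ seq ∷ days ∷ [])) ≤ 2 * suc (sz (𝕃 Bits) seq) + sz (𝕃 Day) days
    improveStep-size = if-view (λ res → sz (𝕃 Day) res ≤ 2 * suc (sz (𝕃 Bits) seq) + sz (𝕃 Day) days)
      (eval less (eval deficit (nᵘ ∷ kᵘ ∷ eval applyMoves (fuel ∷ seq ∷ days ∷ []) ∷ []) ∷ eval deficit (nᵘ ∷ kᵘ ∷ days ∷ []) ∷ []))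
      (λ _ → ≤-trans (applied-size fuel seq days) (≤-trans (≤-reflexive (sym (+-assoc 2 (sz (𝕃 Bits) seq) (sz (𝕃 Day) days))))
        (+-monoˡ-≤ (sz (𝕃 Day) days) (≤-trans (m≤m+n (2 + sz (𝕃 Bits) seq) (sz (𝕃 Bits) seq)) (≤-reflexive (arith (sz (𝕃 Bits) seq)))))))
      (λ _ → m≤n+m _ (2 * suc (sz (𝕃 Bits) seq)))
      where
      arith : ∀ x → 2 + x + x ≡ 2 * (1 + x)
      arith = solve-∀

    improveStep-fits : ∀ {N M} → sz Bits fuel ≤ M → sz ℕᵗ nᵘ ≤ M → sz ℕᵗ kᵘ ≤ M → sz (𝕃 Bits) seq ≤ M → sz (𝕃 Day) days ≤ M →
                       ⟪ improveStepᵖ ⟫ M ≤ N → Fits N improveStep (fuel ∷ nᵘ ∷ kᵘ ∷ seq ∷ days ∷ [])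
    improveStep-fits {N} {M} fuel≤ n≤ k≤ seq≤ days≤ le =
      ((tt , tt , tt , tt) , applyMoves-fits fuel seq days fuel≤ seq≤ days≤ (m+n≤o⇒m≤o _ le)) ,
      ((((tt , tt , tt , tt) , deficit-fits nᵘ kᵘ new (to n≤) (to k≤) new≤ deficit≤) ,
        ((tt , tt , tt , tt) , deficit-fits nᵘ kᵘ days (to n≤) (to k≤) (to days≤) deficit≤) , tt) ,
       less-fits (eval deficit (nᵘ ∷ kᵘ ∷ new ∷ [])) (eval deficit (nᵘ ∷ kᵘ ∷ days ∷ []))
         (≤-trans (deficit-size nᵘ kᵘ days (to n≤) (to k≤) (to days≤)) (≤-trans (+-monoˡ-≤ (M₁ * M₁) (+-mono-≤ (3 ≤+ 3) (m≤m+n M₁ _))) deficit≤))) ,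
      tt , tt
      where
      M₁ = 2 + 2 * M
      new = eval applyMoves (fuel ∷ seq ∷ days ∷ [])
      to : ∀ {x} → x ≤ M → x ≤ M₁
      to le = ≤-trans le (≤-trans (m≤m+n M _) (_ ≤+ 2))
      new≤ : sz (𝕃 Day) new ≤ M₁
      new≤ = ≤-trans (applied-size fuel seq days) (+-monoʳ-≤ 2 (+-mono-≤ seq≤ (≤-trans days≤ (m≤m+n M 0))))
      deficit≤ : ⟪ deficitᵖ ⟫ M₁ ≤ N
      deficit≤ = m+n≤o⇒n≤o (22 + 4 * M) le

  module _ (seqs : List (List (List Bool))) where

    improve-size : ∀ days → sz (𝕃 Day) (eval improve (fuel ∷ nᵘ ∷ kᵘ ∷ seqs ∷ days ∷ [])) ≤ sz (𝕃 Day) days + 2 * sz (𝕃 (𝕃 Bits)) seqs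
    improve-size days = fold-size improveBody (fuel ∷ nᵘ ∷ kᵘ ∷ seqs ∷ days ∷ []) 2 improveStep-size days seqs

    improve-fits : ∀ {N M} days → sz Bits fuel ≤ M → sz ℕᵗ nᵘ ≤ M → sz ℕᵗ kᵘ ≤ M → sz (𝕃 (𝕃 Bits)) seqs ≤ M → sz (𝕃 Day) days ≤ M →
                   ⟪ improveᵖ ⟫ M ≤ N → Fits N improve (fuel ∷ nᵘ ∷ kᵘ ∷ seqs ∷ days ∷ [])
    improve-fits {N} {M} days fuel≤ n≤ k≤ seqs≤ days≤ le = tt , tt ,
      fits-fold improveBody (fuel ∷ nᵘ ∷ kᵘ ∷ seqs ∷ days ∷ []) 2 improveStep-size days seqs
        (≤-trans acc≤ (≤-trans (≤-trans (m≤n*m (3 * M) 4) (≤-trans (_ ≤+ 22) (m≤m+n (22 + 4 * (3 * M)) _))) le))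
        (λ seq acc seq≤ le′ → (tt , tt , tt , tt , tt , tt) ,
          improveStep-fits seq acc (to fuel≤) (to n≤) (to k≤) (to (≤-trans seq≤ seqs≤)) (≤-trans le′ acc≤) le)
      where
      to : ∀ {x} → x ≤ M → x ≤ 3 * M
      to le = ≤-trans le (m≤m+n M _)
      acc≤ : sz (𝕃 Day) days + 2 * sz (𝕃 (𝕃 Bits)) seqs ≤ 3 * M
      acc≤ = +-mono-≤ days≤ (*-monoʳ-≤ 2 seqs≤)

    search-fits : ∀ {N M} days → sz Bits fuel ≤ M → sz ℕᵗ nᵘ ≤ M → sz ℕᵗ kᵘ ≤ M → sz (𝕃 (𝕃 Bits)) seqs ≤ M → sz (𝕃 Day) days ≤ M →
                  ⟪ searchᵖ ⟫ M ≤ N → Fits N search (fuel ∷ nᵘ ∷ kᵘ ∷ seqs ∷ days ∷ [])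
    search-fits {N} {M} days fuel≤ n≤ k≤ seqs≤ days≤ le =
      ((tt , tt , (((tt , tt , tt , tt) , deficit-fits nᵘ kᵘ days n≤ k≤ days≤ (m+n≤o⇒m≤o _ le)) , tt ,
         fits-fold searchBody ρ M grows days rounds (≤-trans acc≤ bound≤N)
           (λ x acc _ le′ → (tt , tt , tt , tt , tt , tt) ,
             improve-fits acc (to fuel≤) (to n≤) (to k≤) (to seqs≤) (≤-trans le′ acc≤) (m+n≤o⇒m≤o _ (m+n≤o⇒n≤o (⟪ deficitᵖ ⟫ M) le)))) , tt) ,
       deficit-fits nᵘ kᵘ res (to n≤) (to k≤) (≤-trans (fold-size searchBody ρ M grows days rounds) acc≤) deficit≤) ,
      tt , verdict (eval deficit (nᵘ ∷ kᵘ ∷ res ∷ []))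
      where
      ρ : Env (Bits ∷ ℕᵗ ∷ ℕᵗ ∷ 𝕃 (𝕃 Bits) ∷ 𝕃 Day ∷ [])
      ρ = fuel ∷ nᵘ ∷ kᵘ ∷ seqs ∷ days ∷ []
      M₂ = ⟪ searchBoundᵖ ⟫ M
      rounds = eval deficit (nᵘ ∷ kᵘ ∷ days ∷ [])
      to : ∀ {x} → x ≤ M → x ≤ M₂
      to le = ≤-trans le (m≤m+n M _)
      grows : ∀ x acc → sz (𝕃 Day) (eval searchBody (x ∷ acc ∷ ρ)) ≤ M * suc (sz 𝟙 x) + sz (𝕃 Day) acc
      grows x acc = ≤-trans (improve-size acc) (≤-trans (+-monoʳ-≤ (sz (𝕃 Day) acc) (≤-trans (*-monoʳ-≤ 2 seqs≤) (≤-reflexive (*-comm 2 M))))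
        (≤-reflexive (+-comm (sz (𝕃 Day) acc) (M * 2))))
      res = foldV searchBody ρ M grows days rounds
      acc≤ : sz (𝕃 Day) days + M * sz ℕᵗ rounds ≤ M₂
      acc≤ = +-mono-≤ days≤ (*-monoʳ-≤ M (deficit-size nᵘ kᵘ days n≤ k≤ days≤))
      deficit≤ : ⟪ deficitᵖ ⟫ M₂ ≤ N
      deficit≤ = m+n≤o⇒n≤o (⟪ improveᵖ ∘ᵖ searchBoundᵖ ⟫ M) (m+n≤o⇒n≤o (⟪ deficitᵖ ⟫ M) le)
      bound≤N : M₂ ≤ N
      bound≤N = ≤-trans (≤-trans (m≤m+n M₂ _) (≤-trans (_ ≤+ 6) (m≤m+n (6 + 2 * M₂) (M₂ * M₂)))) deficit≤
      verdict : ∀ (r : List ⊤) → caseList r ⊤ (λ _ _ → ⊤)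
      verdict []      = tt
      verdict (_ ∷ _) = tt

module _ (u : List ⊤) (its : List (List Bool)) {M : ℕ} (u≤ : sz ℕᵗ u ≤ M) (its≤ : sz (𝕃 Bits) its ≤ M) where

  private
    ρ : Env (ℕᵗ ∷ 𝕃 Bits ∷ [])
    ρ = u ∷ its ∷ []

    empty-grows : ∀ x acc → sz (𝕃 Day) (eval emptyDayBody (x ∷ acc ∷ ρ)) ≤ 2 * suc (sz 𝟙 x) + sz (𝕃 Day) acc
    empty-grows x acc = ≤-refl

    start₀ : List DayV
    start₀ = foldV emptyDayBody ρ 2 empty-grows [] u

    start≤ : sz (𝕃 Day) [] + 2 * sz ℕᵗ u ≤ 1 + 2 * M
    start≤ = +-monoʳ-≤ 1 (*-monoʳ-≤ 2 u≤)

    snoc-size : ∀ x (day : DayV) q →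
      sz (𝕃 Day) q + sz (𝕃 Day) (addTo x day ∷ []) ≤ 2 + sz Bits x + sz (𝕃 Day) (day ∷ q)
    snoc-size x (static , S) q = ≤-reflexive (arith (sz (𝕃 Day) q) (sz Bits x) (sz (𝕃 Bits) static) (sz Bits S))
      where
      arith : ∀ q x t c → q + (1 + (1 + (1 + (x + t) + c) + 1)) ≡ 2 + x + (1 + (1 + (t + c) + q))
      arith = solve-∀

    rotate-grows : ∀ x acc → sz (𝕃 Day) (eval rotateBody (x ∷ acc ∷ ρ)) ≤ 2 * suc (sz Bits x) + sz (𝕃 Day) acc
    rotate-grows x []        = _ ≤+ (2 * suc (sz Bits x))
    rotate-grows x (day ∷ q) = ≤-trans (append-size {Day} q (addTo x day ∷ [])) (≤-trans (snoc-size x day q)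
      (+-monoˡ-≤ (sz (𝕃 Day) (day ∷ q)) (≤-trans (m≤m+n _ (sz Bits x)) (≤-reflexive (arith (sz Bits x))))))
      where
      arith : ∀ x → 2 + x + x ≡ 2 * (1 + x)
      arith = solve-∀

    days≤ : sz (𝕃 Day) start₀ + 2 * sz (𝕃 Bits) (reverse its) ≤ 1 + 4 * M
    days≤ = ≤-trans (+-mono-≤ (≤-trans (fold-size emptyDayBody ρ 2 empty-grows [] u) start≤)
        (*-monoʳ-≤ 2 (≤-trans (≤-reflexive (sz-reverse {Bits} its)) its≤))) (≤-reflexive (arith M))
      where
      arith : ∀ m → 1 + 2 * m + 2 * m ≡ 1 + 4 * m
      arith = solve-∀

  buildDays-size : sz (𝕃 Day) (eval buildDays ρ) ≤ 1 + 4 * M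
  buildDays-size = ≤-trans (fold-size rotateBody ρ 2 rotate-grows start₀ (reverse its)) days≤

  buildDays-fits : ∀ {N} → 5 + 5 * M ≤ N → Fits N buildDays ρ
  buildDays-fits {N} le = tt ,
    (tt , tt , fits-fold emptyDayBody ρ 2 empty-grows [] u (≤-trans start≤ (≤-trans (+-mono-≤ (1 ≤+ 4) (*-monoˡ-≤ M {2} {5} (2 ≤+ 3))) le))
      (λ x acc _ _ → fits-free {0} emptyDayBody {x ∷ acc ∷ ρ} refl)) ,
    fits-fold rotateBody ρ 2 rotate-grows start₀ (reverse its) (≤-trans days≤ (≤-trans (+-mono-≤ (1 ≤+ 4) (*-monoˡ-≤ M {4} {5} (4 ≤+ 1))) le))
      (λ x acc x≤ acc≤ → (tt , tt , tt) , tt , tt , branches x acc (≤-trans x≤ (≤-trans (≤-reflexive (sz-reverse {Bits} its)) its≤)) (≤-trans acc≤ days≤))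
    where
    branches : ∀ x acc → sz Bits x ≤ M → sz (𝕃 Day) acc ≤ 1 + 4 * M → caseList acc ⊤ (λ day q → Fits N
      (call append (#1 ∷ cons (split #0 (pair (cons #4 #0) #1)) nil ∷ [])) (day ∷ q ∷ x ∷ acc ∷ []))
    branches x []        x≤ acc≤ = tt
    branches x (day ∷ q) x≤ acc≤ = (tt , ((tt , (tt , tt) , tt) , tt) , tt) ,
      append-fits {τ = Day} q (addTo x day ∷ []) (≤-trans (snoc-size x day q)
        (≤-trans (+-mono-≤ (+-monoʳ-≤ 2 x≤) acc≤) (≤-trans (≤-reflexive (arith M)) (≤-trans (+-monoˡ-≤ (5 * M) (3 ≤+ 2)) le))))
      where
      arith : ∀ m → 2 + m + (1 + 4 * m) ≡ 3 + 5 * m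
      arith = solve-∀

-- Correctness of the decision procedure

allLists-bounded : ∀ {τ} {P : ⟦ τ ⟧ → Set} {as} t → All P as →
                   All (λ xs → length xs ≤ length t × All P xs) (eval (allLists {τ}) (as ∷ t ∷ []))
allLists-bounded []      all = (z≤n , []) ∷ []
allLists-bounded {τ} {P} {as} (_ ∷ t) all = (z≤n , []) ∷ consAll-bounded all (allLists-bounded t all)
  where
  Q = λ k xs → length xs ≤ k × All P xs
  consAll-bounded : ∀ {k as ls} → All P as → All (Q k) ls → All (Q (suc k)) (eval (consAll {τ}) (as ∷ ls ∷ []))
  consAll-bounded         []         qs = []
  consAll-bounded {k} {a ∷ as} {ls} (pa ∷ pas) qs = prepend ls qs
    where
    prepend : ∀ ls′ → All (Q k) ls′ → All (Q (suc k)) (foldr (λ l acc → (a ∷ l) ∷ acc) (eval (consAll {τ}) (as ∷ ls ∷ [])) ls′)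
    prepend []        []                = consAll-bounded pas qs
    prepend (l ∷ ls′) ((le , ps) ∷ qs′) = (s≤s le , pa ∷ ps) ∷ prepend ls′ qs′

moveSeqs-bounded : ∀ nᵘ → All (All (λ S → length S ≤ length nᵘ)) (eval moveSeqs (nᵘ ∷ []))
moveSeqs-bounded nᵘ = All.map proj₂ (allLists-bounded {Bits} (eval double (eval blockBound (nᵘ ∷ []) ∷ []))
  (All.map proj₁ (allLists-bounded {𝔹} {P = λ _ → ⊤} nᵘ (tt ∷ tt ∷ []))))


unary : ℕ → List ⊤
unary x = eval toUnary (bin x ∷ [])

unary-length : ∀ x → length (unary x) ≡ x
unary-length x = trans (toUnary-length (bin x)) (value-bin x)

module Correct (I : Instance) where

  nᵘ kᵘ : List ⊤
  nᵘ = unary (n I)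
  kᵘ = unary (toℕ (k I))

  seqs : List (List (List Bool))
  seqs = eval moveSeqs (nᵘ ∷ [])

  days : List DayV
  days = eval buildDays (unary (m I) ∷ map bin (entries I) ∷ [])

  parsed : eval parse (encode I ∷ []) ≡ map bin (n I ∷ m I ∷ toℕ (k I) ∷ entries I)
  parsed = trans (cong (λ x → eval parse (x ∷ [])) (encode-entries I)) (parse-numbers (n I ∷ m I ∷ toℕ (k I) ∷ entries I))

  decide-eval : eval decideESSD (encode I ∷ []) ≡ eval search (encode I ∷ nᵘ ∷ kᵘ ∷ seqs ∷ days ∷ [])
  decide-eval = cong after parsed
    where
    after : List (List Bool) → Bool
    after its = caseList its false λ nb its₁ → caseList its₁ false λ mb its₂ → caseList its₂ false λ kb its₃ →
      eval search (encode I ∷ eval toUnary (nb ∷ []) ∷ eval toUnary (kb ∷ []) ∷ eval moveSeqs (eval toUnary (nb ∷ []) ∷ [])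
        ∷ eval buildDays (eval toUnary (mb ∷ []) ∷ its₃ ∷ []) ∷ [])

  short-rows : All (λ row → All (λ b → length b ≤ length (encode I)) (reverse row)) (rowsOf I)
  short-rows = AllP.tabulate⁺ λ j →
    subst (All (λ b → length b ≤ length (encode I))) (sym (reverse-involutive (dayRow I j))) (dayRow-short I j)

  open Search (encode I) nᵘ kᵘ seqs (rowsOf I) short-rows

  days-good : Good days
  days-good = subst Good (sym (buildDays-eval I (unary (m I)) (unary-length (m I)))) record
    { sameRows   = map-tabulate (λ j → reverse (dayRow I j) , []) proj₁
    ; allValid   = AllP.tabulate⁺ λ j → empty-fits (reverse (reverse (dayRow I j)))
    ; allBounded = AllP.tabulate⁺ λ j → z≤n }
    where
    empty-fits : ∀ row → FitsDay [] row
    empty-fits []      = tt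
    empty-fits (_ ∷ _) = z≤n

  solution⇔ESSD : Solution ⇔ ESSD I
  solution⇔ESSD = mk⇔
    (λ { (sol , good , enough) → solution⇒schedules I (sameRows good , allValid good ,
           λ {i} i<n → subst (_≤ countAt sol i) (unary-length (toℕ (k I))) (enough (≤-trans i<n (≤-reflexive (sym (unary-length (n I))))))) })
    (λ essd → let sol , (rows , valids , enough) , bounds = schedules⇒solution I essd in
       sol , record { sameRows = rows ; allValid = valids ; allBounded = subst (λ w → Bounded w sol) (sym (unary-length (n I))) bounds } ,
       λ {i} i<w → subst (_≤ countAt sol i) (sym (unary-length (toℕ (k I)))) (enough (≤-trans i<w (≤-reflexive (unary-length (n I))))))

  decide-correct : eval decideESSD (encode I ∷ []) ≡ true ⇔ ESSD I
  decide-correct = ⇔-trans (mk⇔ (trans (sym decide-eval)) (trans decide-eval))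
    (⇔-trans (search-correct (moveSeqs-∋ nᵘ) (moveSeqs-bounded nᵘ) days-good) solution⇔ESSD)


-- The running time

-- Everything that is computed from n alone contributes an arbitrary function of n.
clientCost : ℕ → ℕ
clientCost n = n + (sz (𝕃 (𝕃 Bits)) (eval moveSeqs (unary n ∷ [])) + proj₁ (fits-some moveSeqs (unary n ∷ [])))

-- For a code of length ℓ the list of bits has size at most 1 + 4ℓ, the parsed items 5 + 4·(1 + 4ℓ)
-- = 9 + 16ℓ, and the days 1 + 4·(9 + 16ℓ) = 37 + 64ℓ.
sizeᵖ : Poly
sizeᵖ = K 37 ⊕ K 64 ⊙ X

search≥2M : ∀ M → 2 * M ≤ ⟪ searchᵖ ⟫ M
search≥2M M = ≤-trans (m≤n+m (2 * M) 6) (≤-trans (m≤m+n (6 + 2 * M) (M * M)) (m≤m+n (⟪ deficitᵖ ⟫ M) _))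

numbers-length : ∀ xs → length xs ≤ length (concatMap encℕ xs)
numbers-length []       = z≤n
numbers-length (x ∷ xs) = ≤-trans (+-mono-≤ (nonempty (concatMap (λ b → b ∷ b ∷ []) (bin x))) (numbers-length xs)) (≤-reflexive (sym (length-++ (encℕ x))))
  where
  nonempty : ∀ bs → 1 ≤ length (bs ++ false ∷ true ∷ [])
  nonempty []       = s≤s z≤n
  nonempty (_ ∷ bs) = s≤s z≤n

entries-length : ∀ I → 3 + length (entries I) ≤ length (encode I)
entries-length I = subst (λ x → 3 + length (entries I) ≤ length x) (sym (encode-entries I)) (numbers-length (n I ∷ m I ∷ toℕ (k I) ∷ entries I))

encode-nonempty : ∀ I → 1 ≤ length (encode I)
encode-nonempty I = ≤-trans (s≤s z≤n) (entries-length I)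

module Cost (I : Instance) (Y : ℕ) (ℓ≤Y : length (encode I) ≤ Y) (cost≤Y : clientCost (n I) ≤ Y)
            (M : ℕ) (M≥ : 37 + 64 * Y ≤ M) where
  open Correct I using (nᵘ; kᵘ; seqs; days; parsed)

  private
    ℓ M₁ : ℕ
    ℓ = length (encode I)
    M₁ = 9 + 16 * ℓ

  -- Each day has a deadline in the code, and each number takes at least one bit. There is no such
  -- bound for n when there are no days, which is why `clientCost` contains n.
  m≤ℓ : m I ≤ ℓ
  m≤ℓ = ≤-trans (≤-trans (≤-reflexive (sym (length-tabulate (d I)))) (≤-trans (m≤m+n _ _) (≤-reflexive (sym (length-++ (tabulate (d I)))))))
    (≤-trans (length (entries I) ≤+ 3) (entries-length I))

  k≤ℓ : toℕ (k I) ≤ ℓ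
  k≤ℓ = ≤-trans (≤-pred (Fin.toℕ<n (k I))) m≤ℓ

  private
    n≤Y : n I ≤ Y
    n≤Y = ≤-trans (m≤m+n (n I) _) cost≤Y

    linear : ∀ {a b c x} → a ≤ b → x ≤ Y → c ≤ 80 → a + c * x ≤ b + 80 * Y
    linear a≤b x≤Y c≤80 = +-mono-≤ a≤b (*-mono-≤ c≤80 x≤Y)

    unary≤M : ∀ x → x ≤ Y → sz ℕᵗ (unary x) ≤ M
    unary≤M x x≤Y = ≤-trans (≤-reflexive (trans (sz-ℕᵗ (unary x)) (cong (λ l → 1 + 2 * l) (unary-length x))))
      (≤-trans (+-mono-≤ (1 ≤+ 36) (*-mono-≤ (2 ≤+ 62) x≤Y)) M≥)

    bits≤ : sz Bits (encode I) ≤ 1 + 4 * ℓ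
    bits≤ = size-bits (encode I)

    items≤ : sz (𝕃 Bits) (eval parse (encode I ∷ [])) ≤ M₁
    items≤ = ≤-trans (parse-size (encode I)) (≤-trans (+-monoʳ-≤ 5 (*-monoʳ-≤ 4 bits≤)) (≤-reflexive (arith ℓ)))
      where
      arith : ∀ l → 5 + 4 * (1 + 4 * l) ≡ 9 + 16 * l
      arith = solve-∀

    entries≤ : sz (𝕃 Bits) (map bin (entries I)) ≤ M₁
    entries≤ = ≤-trans (≤-trans (drop (bin (toℕ (k I))) rest) (≤-trans (drop (bin (m I)) (bin (toℕ (k I)) ∷ rest)) (drop (bin (n I)) (bin (m I) ∷ bin (toℕ (k I)) ∷ rest)))) (subst (λ its → sz (𝕃 Bits) its ≤ M₁) parsed items≤)
      where
      rest = map bin (entries I)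
      drop : ∀ x its → sz (𝕃 Bits) its ≤ sz (𝕃 Bits) (x ∷ its)
      drop x its = ≤-trans (m≤n+m _ (sz Bits x)) (n≤1+n _)

    m-size : sz ℕᵗ (unary (m I)) ≤ M₁
    m-size = ≤-trans (≤-reflexive (trans (sz-ℕᵗ (unary (m I))) (cong (λ l → 1 + 2 * l) (unary-length (m I)))))
      (+-mono-≤ (1 ≤+ 8) (*-mono-≤ (2 ≤+ 14) m≤ℓ))

    days≤ : sz (𝕃 Day) days ≤ M
    days≤ = ≤-trans (buildDays-size (unary (m I)) (map bin (entries I)) m-size entries≤)
      (≤-trans (≤-reflexive (arith ℓ)) (≤-trans (+-monoʳ-≤ 37 (*-monoʳ-≤ 64 ℓ≤Y)) M≥))
      where
      arith : ∀ l → 1 + 4 * (9 + 16 * l) ≡ 37 + 64 * l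
      arith = solve-∀

    seqs≤ : sz (𝕃 (𝕃 Bits)) seqs ≤ M
    seqs≤ = ≤-trans (≤-trans (≤-trans (m≤m+n _ _) (m≤n+m _ (n I))) cost≤Y)
      (≤-trans (≤-trans (m≤n*m Y 64) (m≤n+m (64 * Y) 37)) M≥)

  decide-fits : ∀ N → ⟪ searchᵖ ⟫ M ≤ N → Fits N decideESSD (encode I ∷ [])
  decide-fits N le = ((tt , tt) , parse-fits (encode I) (below parse≤)) , tt ,
    subst (λ its → caseList its ⊤ (λ nb its₁ → Fits N (caseL #1 (bit false) (caseL #1 (bit false) main)) (nb ∷ its₁ ∷ encode I ∷ []))) (sym parsed)
      (tt , tt , tt , tt , ((tt , tt) , unary-fits (n I) n≤Y) ,
       (tt , tt , ((tt , tt) , unary-fits (toℕ (k I)) (≤-trans k≤ℓ ℓ≤Y)) ,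
        ((tt , tt) , fits-mono moveSeqs {nᵘ ∷ []} (below seqs-fit) (proj₂ (fits-some moveSeqs (nᵘ ∷ [])))) ,
        (((((tt , tt) , unary-fits (m I) (≤-trans m≤ℓ ℓ≤Y)) , tt , tt) ,
          buildDays-fits (unary (m I)) (map bin (entries I)) m-size entries≤ (below build≤)) , tt)) ,
       search-fits (encode I) nᵘ kᵘ seqs days (≤-trans bits≤ (≤-trans (+-mono-≤ (1 ≤+ 36) (*-mono-≤ (4 ≤+ 60) ℓ≤Y)) M≥))
         (unary≤M (n I) n≤Y) (unary≤M (toℕ (k I)) (≤-trans k≤ℓ ℓ≤Y)) seqs≤ days≤ le)
    where
    main = letE (call toUnary (#4 ∷ []))
      (call search (#7 ∷ #0 ∷ call toUnary (#1 ∷ []) ∷ call moveSeqs (#0 ∷ [])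
        ∷ call buildDays (call toUnary (#3 ∷ []) ∷ #2 ∷ []) ∷ []))
    -- The constants are those of `buildDays`, namely 5 + 5·(9 + 16ℓ) = 50 + 80ℓ. They also cover
    -- parsing, the unary conversions and the move sequences.
    below : ∀ {x} → x ≤ 50 + 80 * Y → x ≤ N
    below x≤ = ≤-trans x≤ (≤-trans twice (≤-trans (search≥2M M) le))
      where
      twice : 50 + 80 * Y ≤ 2 * M
      twice = ≤-trans (+-mono-≤ (50 ≤+ 24) (*-monoˡ-≤ Y {80} {128} (80 ≤+ 48))) (≤-trans (≤-reflexive (double-M Y)) (*-monoʳ-≤ 2 M≥))
        where
        double-M : ∀ y → 74 + 128 * y ≡ 2 * (37 + 64 * y)
        double-M = solve-∀
    parse≤ : 5 + 4 * sz Bits (encode I) ≤ 50 + 80 * Y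
    parse≤ = ≤-trans (+-monoʳ-≤ 5 (*-monoʳ-≤ 4 bits≤)) (≤-trans (≤-reflexive (arith ℓ)) (linear (9 ≤+ 41) ℓ≤Y (16 ≤+ 64)))
      where
      arith : ∀ l → 5 + 4 * (1 + 4 * l) ≡ 9 + 16 * l
      arith = solve-∀
    unary-fits : ∀ x → x ≤ Y → Fits N toUnary (bin x ∷ [])
    unary-fits x x≤Y = toUnary-fits (bin x) (below (subst (λ v → 3 + 4 * v ≤ 50 + 80 * Y) (sym (value-bin x)) (linear (3 ≤+ 47) x≤Y (4 ≤+ 76))))
    seqs-fit : proj₁ (fits-some moveSeqs (nᵘ ∷ [])) ≤ 50 + 80 * Y
    seqs-fit = ≤-trans (≤-trans (≤-trans (m≤n+m _ (sz (𝕃 (𝕃 Bits)) seqs)) (m≤n+m _ (n I))) cost≤Y)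
      (≤-trans (m≤n*m Y 80) (m≤n+m (80 * Y) 50))
    build≤ : 5 + 5 * M₁ ≤ 50 + 80 * Y
    build≤ = ≤-trans (≤-reflexive (arith ℓ)) (+-monoʳ-≤ 50 (*-monoʳ-≤ 80 ℓ≤Y))
      where
      arith : ∀ l → 5 + 5 * (9 + 16 * l) ≡ 50 + 80 * l
      arith = solve-∀


*-^ : ∀ a b e → (a * b) ^ e ≡ a ^ e * b ^ e
*-^ a b zero    = refl
*-^ a b (suc e) = trans (cong (a * b *_) (*-^ a b e)) (arith a b (a ^ e) (b ^ e))
  where
  arith : ∀ a b x y → a * b * (x * y) ≡ a * x * (b * y)
  arith = solve-∀

-- Separates parameter and length: for `l` at least 1 the sum `2 + (a + l)` is at most the product
-- `(3 + a) * l`, and powers of products split. The added 2 makes the base large enough for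
-- `poly-bound`.
poly-fpt : ∀ p a {l} → 1 ≤ l → ⟪ p ⟫ (a + l) ≤ (3 + a) ^ degree p * l ^ degree p
poly-fpt p a {l} 1≤l = begin
  ⟪ p ⟫ (a + l)                      ≤⟨ poly-mono p (m≤n+m (a + l) 2) ⟩
  ⟪ p ⟫ (2 + (a + l))                ≤⟨ poly-bound p (m≤m+n 2 (a + l)) ⟩
  (2 + (a + l)) ^ degree p           ≤⟨ ^-monoˡ-≤ (degree p) base ⟩
  ((3 + a) * l) ^ degree p           ≡⟨ *-^ (3 + a) l (degree p) ⟩
  (3 + a) ^ degree p * l ^ degree p  ∎
  where
  open ≤-Reasoning
  base : 2 + (a + l) ≤ (3 + a) * l
  base = ≤-trans (≤-reflexive (arith a l)) (+-monoʳ-≤ l (≤-trans (≤-reflexive (sym (*-identityʳ (2 + a)))) (*-monoʳ-≤ (2 + a) 1≤l)))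
    where
    arith : ∀ a l → 2 + (a + l) ≡ l + (2 + a)
    arith = solve-∀


-- The expression is fixed before the instance, and with it the machine and the exponent. The
-- instance enters only through the sum of `cost` and code length, which `poly-fpt` turns into the
-- required product.
fpt-algorithm : ∀ (main : Exp (Bits ∷ []) 𝔹) (values sizes : Poly) (cost : ℕ → ℕ) →
  (∀ I → 1 ≤ length (encode I)) →
  (∀ I M → ⟪ sizes ⟫ (cost (n I) + length (encode I)) ≤ M → ∀ N → ⟪ values ⟫ M ≤ N → Fits N main (encode I ∷ [])) →
  (∀ I → eval main (encode I ∷ []) ≡ true ⇔ ESSD I) →
  ESSD-FPT-by-n
fpt-algorithm main values sizes cost nonempty fits correct =
  (λ c → (3 + cost c) ^ degree timeBound) , degree timeBound , Machine.machine command , λ I →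
  eval main (encode I ∷ []) ,
  decides (encode I) (fits I (⟪ sizes ⟫ (cost (n I) + length (encode I))) ≤-refl (⟪ values ∘ᵖ sizes ⟫ (cost (n I) + length (encode I))) ≤-refl)
    (≤-trans (poly-mono stepsᵖ (+-monoʳ-≤ (⟪ values ∘ᵖ sizes ⟫ (cost (n I) + length (encode I))) (m≤n+m (length (encode I)) (cost (n I)))))
      (poly-fpt timeBound (cost (n I)) (nonempty I))) ,
  correct I
  where
  open Decide main
  timeBound : Poly
  timeBound = stepsᵖ ∘ᵖ (values ∘ᵖ sizes ⊕ X)

theorem6 : ESSD-FPT-by-n
theorem6 = fpt-algorithm decideESSD searchᵖ sizeᵖ clientCost encode-nonempty
  (λ I → Cost.decide-fits I (clientCost (n I) + length (encode I)) (m≤n+m _ (clientCost (n I))) (m≤m+n (clientCost (n I)) _))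
  Correct.decide-correct
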